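{- Let $0\leq\varepsilon_c<\varepsilon_f\leq 1$, $g=\varepsilon_f-\varepsilon_c$, $\delta\in(0,1/4)$ and $m=\lceil 8\ln(2/\delta)/g^2\rceil$. Protocol $\Pi_{\mathrm{WM}}^{\mathrm{BB}}$ (described in the context) has completeness and soundness errors at most $2\delta$ for distributional weighted Hamming-weight verification in the black-box model. In particular, when $\delta\leq1/6$, it is an $(\varepsilon_c,\varepsilon_f)$-interactive proof with respect to $\Delta_{\mathsf{dwHW}}$. When its exact-Hamming-weight subprotocol is the logarithmic-round one (see context), its resource bounds are as follows: (i) the verifier draws exactly $m=O(\ln(1/\delta)/g^2)$ samples from $D$ and, for every fixed $\delta$, makes $\widetilde{O}(1/g)$ queries to $f$; (ii) the honest prover draws no samples from $D$ and makes at most $\min\{m,|\mathcal{X}|\}$ distinct queries to $f$; (iii) the communication is $O(m\ell)+\widetilde{O}(1/g)=O\left(\ell\ln(1/\delta)/g^2\right)+\widetilde{O}(1/g)$ bits for every fixed $\delta$, and the number of rounds is $O(\log(1/g))$ up to a constant additive term. Here $\ell$ denotes the number of bits used to encode an element of $\mathcal{X}$.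
   Context: $D$ is an unknown distribution over a finite domain $\mathcal{X}$, $f\colon\mathcal{X}\to\{0,1\}$, and $\mathrm{wt}_D(f):=\mathbb{E}_{X\sim D}[f(X)]$. For a claim $\sigma\in[0,1]$, $\Delta_{\mathsf{dwHW}}((D,f),\sigma):=|\mathrm{wt}_D(f)-\sigma|$. In the black-box model a sampling call returns a fresh independent $X\sim D$ (the caller can neither choose nor inspect the randomness); both parties also have query access to $f$. An $(\varepsilon_c,\varepsilon_f)$-interactive proof with respect to $\Delta_{\mathsf{dwHW}}$ consists of a verifier and a designated honest prover such that: if $\Delta_{\mathsf{dwHW}}((D,f),\sigma)\leq\varepsilon_c$ the verifier accepts the honest prover with probability at least $2/3$; if $\Delta_{\mathsf{dwHW}}((D,f),\sigma)>\varepsilon_f$ then against every (unbounded, fully informed) prover it accepts with probability at most $1/3$. Completeness (soundness) error is the bound on the rejection (acceptance) probability in the first (second) case. Exact-Hamming-weight subprotocol: an interactive proof in which, given oracle access to $Y\in\{0,1\}^m$, a claimed weight $W\in\{0,\dots,m\}$ and proximity parameter $g/4$, the verifier accepts the honest prover with probability at least $1-\delta$ if $\|Y\|_1:=\sum_jY_j=W$, and accepts any cheating prover with probability at most $\delta$ if $|\|Y\|_1/m-W/m|>g/4$. The logarithmic-round one is such a protocol (amplified to errors at most $\delta$) with, for fixed $\delta$, $O(\log(1/g))$ rounds, $\widetilde{O}(1/g)$ verifier queries and $\widetilde{O}(1/g)$ communication on inputs of length $m$. $\widetilde O$ suppresses polylogarithmic factors. Protocol $\Pi_{\mathrm{WM}}^{\mathrm{BB}}$: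 (1) The verifier draws $X_1,\dots,X_m$ independently from $D$ and sends the ordered sample to the prover; define $Y\in\{0,1\}^m$ by $Y_j=f(X_j)$. (2) The honest prover queries $f$ once on each distinct sampled point, caches the answers, and sends $W=\|Y\|_1$. (3) The verifier rejects if $W\notin\{0,\dots,m\}$ or $|W/m-\sigma|>\varepsilon_c+g/2$. (4) The parties run the exact-Hamming-weight subprotocol on $Y$ with claimed weight $W$ and proximity parameter $g/4$ (a verifier query to position $j$ is answered by querying $f(X_j)$), and the verifier outputs its decision. -}

module Defs where

open import Level using (0ℓ)
open import Algebra.Bundles using (CommutativeRing)
open import Algebra.Structures using (IsCommutativeRing)
import Algebra.Properties.CommutativeMonoid.Sum as Sum
import Algebra.Properties.Monoid.Mult as Mult
import Algebra.Properties.Semiring.Exp as Exp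
open import Data.Bool.Base using (Bool; true; false; if_then_else_; _∧_)
import Data.Bool.Properties as Bool
open import Data.Fin.Base using (Fin; zero; suc; toℕ)
import Data.Fin.Properties as Fin
open import Data.List.Base as List using (List; []; _∷_; length)
open import Data.Nat.Base as ℕ using (ℕ; zero; suc; _!)
import Data.Nat.Properties as ℕ
open import Data.Nat.ListAction using () renaming (sum to ℕ-sum)
open import Data.Nat.DivMod using (_/_; _%_)
open import Data.Nat.Logarithm using (⌈log₂_⌉)
open import Data.Product.Base using (∃; _×_; _,_; proj₁)
open import Data.Sum.Base using ([_,_]′)
open import Data.Unit.Base using (⊤)
open import Data.Vec.Base as Vec using (Vec; []; _∷_; lookup)
open import Data.Vec.Functional using (updateAt)
open import Function.Base using (const; _∘_)
open import Relation.Binary.Core using (Rel)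
open import Relation.Binary.PropositionalEquality.Core using (_≡_; _≢_)
open import Relation.Binary.Structures using (IsDecTotalOrder)
import Relation.Binary.Construct.NonStrictToStrict as Strict
open import Relation.Nullary.Decidable.Core using (does)

-- The inverse is total; its value at 0# is unspecified.
record OrderedField : Set₁ where
  infix  4 _≤_
  infixl 6 _+_
  infixl 7 _*_
  infix  8 -_ _⁻¹
  field
    ℝ                 : Set
    _≤_               : Rel ℝ 0ℓ
    _+_ _*_           : ℝ → ℝ → ℝ
    -_ _⁻¹            : ℝ → ℝ
    0# 1#             : ℝ
    isCommutativeRing : IsCommutativeRing _≡_ _+_ _*_ -_ 0# 1#
    0≢1               : 0# ≢ 1#
    *-inverseʳ        : ∀ x → x ≢ 0# → x * x ⁻¹ ≡ 1#
    isDecTotalOrder   : IsDecTotalOrder _≡_ _≤_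
    +-monoˡ-≤         : ∀ z {x y} → x ≤ y → x + z ≤ y + z
    *-nonNeg          : ∀ {x y} → 0# ≤ x → 0# ≤ y → 0# ≤ x * y

  commutativeRing : CommutativeRing 0ℓ 0ℓ
  commutativeRing = record { isCommutativeRing = isCommutativeRing }

  open CommutativeRing commutativeRing public
    using (_-_; semiring; +-monoid; +-commutativeMonoid)
  open IsDecTotalOrder isDecTotalOrder public
    using (_≤?_) renaming (total to ≤-total)
  open Strict _≡_ _≤_ public using (_<_)
  open Sum +-commutativeMonoid public using (sum)
  open Exp semiring public using (_^_)

  fromℕ : ℕ → ℝ
  fromℕ n = n · 1#
    where open Mult +-monoid renaming (_×_ to _·_)

-- The real numbers, given axiomatically: up to isomorphism ℝ is the only
-- complete ordered field.  The order is decidable, as it is classically;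
-- deciding it is what lets a verifier compare with a real threshold.
record CompleteOrderedField : Set₁ where
  field
    orderedField : OrderedField
  open OrderedField orderedField public
  field
    archimedean : ∀ x → ∃ λ n → x ≤ fromℕ n
    -- The second clause on s is the approximation form of "s is least".
    supremum    : (P : ℝ → Set) → ∃ P → (∃ λ b → ∀ x → P x → x ≤ b) →
                  ∃ λ s → (∀ x → P x → x ≤ s) ×
                          (∀ y → y < s → ∃ λ x → P x × y < x)

module Reals (F : CompleteOrderedField) where
  open CompleteOrderedField F public

  infixl 7 _÷_
  _÷_ : ℝ → ℝ → ℝ
  x ÷ y = x * y ⁻¹

  ∣_∣ : ℝ → ℝ
  ∣ x ∣ = [ const x , const (- x) ]′ (≤-total 0# x)

  -- The least natural number n with x ≤ n, hence the ceiling when x ≥ 0.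
  ⌈_⌉ : ℝ → ℕ
  ⌈ x ⌉ = descend (proj₁ (archimedean x))
    where
    descend : ℕ → ℕ
    descend zero    = zero
    descend (suc n) = if does (x ≤? fromℕ n) then descend n else suc n

  _⟶_ : (ℕ → ℝ) → ℝ → Set
  a ⟶ L = ∀ ε → 0# < ε → ∃ λ n₀ → ∀ n → n₀ ℕ.≤ n → ∣ a n - L ∣ < ε

  -- ∑_{k ≤ n} x^k / k!
  expSum : ℝ → ℕ → ℝ
  expSum x n = sum {suc n} λ k → x ^ toℕ k ÷ fromℕ (toℕ k !)

  -- The natural logarithm: exp (ln y) = y for y > 0.  On positive arguments
  -- this determines ln.
  record Logarithm : Set where
    field
      ln     : ℝ → ℝ
      exp-ln : ∀ y → 0# < y → expSum (ln y) ⟶ y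

  𝟙 : Bool → ℝ
  𝟙 b = if b then 1# else 0#

  record Distribution (n : ℕ) : Set where
    field
      weight        : Fin n → ℝ
      weight-nonNeg : ∀ i → 0# ≤ weight i
      weight-total  : sum weight ≡ 1#

  𝔼 : ∀ {n} → Distribution n → (Fin n → ℝ) → ℝ
  𝔼 D h = sum λ i → Distribution.weight D i * h i

module Protocols (F : CompleteOrderedField) where
  open Reals F

  -- Besides querying an oracle Fin N → Bool, a party may or may not have
  -- sampling access to a distribution on Fin N.
  data Access : Set where
    queryOnly blackBox : Access

  -- Message lengths are in bits; `recv b` reads a message of at most b bits.
  -- Coins may follow any finite distribution.
  data Verifier (N : ℕ) : Access → Set where
    output : ∀ {a} → Bool → Verifier N a
    query  : ∀ {a} → Fin N → (Bool → Verifier N a) → Verifier N a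
    draw   : (Fin N → Verifier N blackBox) → Verifier N blackBox
    toss   : ∀ {a k} → Distribution k → (Fin k → Verifier N a) → Verifier N a
    send   : ∀ {a} → List Bool → Verifier N a → Verifier N a
    recv   : ∀ {a} → ℕ → (List Bool → Verifier N a) → Verifier N a

  -- A cheating prover is an arbitrary such tree, chosen after the oracle and
  -- the distribution are fixed.
  data Prover (N : ℕ) : Access → Set where
    stop  : ∀ {a} → Prover N a
    query : ∀ {a} → Fin N → (Bool → Prover N a) → Prover N a
    draw  : (Fin N → Prover N blackBox) → Prover N blackBox
    toss  : ∀ {a k} → Distribution k → (Fin k → Prover N a) → Prover N a
    send  : ∀ {a} → List Bool → Prover N a → Prover N a
    recv  : ∀ {a} → (List Bool → Prover N a) → Prover N a

  data Event (N : ℕ) : Set where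
    verifierAsks proverAsks   : Fin N → Event N
    verifierDraws proverDraws : Event N
    toProver toVerifier       : List Bool → Event N

  -- The probability tree of an interaction, with the events along its
  -- branches and the verifier's decisions at its leaves.
  data Execution (N : ℕ) : Set where
    halt   : Bool → Execution N
    event  : Event N → Execution N → Execution N
    choose : ∀ {k} → Distribution k → (Fin k → Execution N) → Execution N

  Sampler : Access → ℕ → Set
  Sampler queryOnly N = ⊤
  Sampler blackBox  N = Distribution N

  -- A prover that violates the message order, or sends an overlong message,
  -- is rejected.
  run : ∀ {N a} → Sampler a N → (Fin N → Bool) →
        Verifier N a → Prover N a → Execution N
  run D f (output b)  p           = halt b
  run D f (query q v) p           = event (verifierAsks q) (run D f (v (f q)) p)
  run D f (draw v)    p           = event verifierDraws (choose D λ x → run D f (v x) p)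
  run D f (toss c v)  p           = choose c λ i → run D f (v i) p
  run D f (send w v)  stop        = halt false
  run D f (send w v)  (query q p) = event (proverAsks q) (run D f (send w v) (p (f q)))
  run D f (send w v)  (draw p)    = event proverDraws (choose D λ x → run D f (send w v) (p x))
  run D f (send w v)  (toss c p)  = choose c λ i → run D f (send w v) (p i)
  run D f (send w v)  (send _ p)  = halt false
  run D f (send w v)  (recv p)    = event (toProver w) (run D f v (p w))
  run D f (recv b v)  stop        = halt false
  run D f (recv b v)  (query q p) = event (proverAsks q) (run D f (recv b v) (p (f q)))
  run D f (recv b v)  (draw p)    = event proverDraws (choose D λ x → run D f (recv b v) (p x))
  run D f (recv b v)  (toss c p)  = choose c λ i → run D f (recv b v) (p i)
  run D f (recv b v)  (send w p)  =
    if does (length w ℕ.≤? b)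
    then event (toVerifier w) (run D f (v w) p)
    else halt false
  run D f (recv b v)  (recv p)    = halt false

  ℙ[decision_] : ∀ {N} → Bool → Execution N → ℝ
  ℙ[decision b ] (halt b′)    = 𝟙 (does (b′ Bool.≟ b))
  ℙ[decision b ] (event _ t)  = ℙ[decision b ] t
  ℙ[decision b ] (choose D t) = 𝔼 D λ i → ℙ[decision b ] (t i)

  ℙ[accept] ℙ[reject] : ∀ {N} → Execution N → ℝ
  ℙ[accept] = ℙ[decision true ]
  ℙ[reject] = ℙ[decision false ]

  -- Q holds of the event list of every branch.
  Always : ∀ {N} → (List (Event N) → Set) → Execution N → Set
  Always Q (halt _)     = Q []
  Always Q (event e t)  = Always (λ es → Q (e ∷ es)) t
  Always Q (choose _ t) = ∀ i → Always Q (t i)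

  module _ {N : ℕ} where
    verifierQueries proverQueries : List (Event N) → List (Fin N)
    verifierQueries []                    = []
    verifierQueries (verifierAsks q ∷ es) = q ∷ verifierQueries es
    verifierQueries (_ ∷ es)              = verifierQueries es
    proverQueries []                  = []
    proverQueries (proverAsks q ∷ es) = q ∷ proverQueries es
    proverQueries (_ ∷ es)            = proverQueries es

    verifierSamples proverSamples : List (Event N) → ℕ
    verifierSamples []                   = 0
    verifierSamples (verifierDraws ∷ es) = suc (verifierSamples es)
    verifierSamples (_ ∷ es)             = verifierSamples es
    proverSamples []                 = 0
    proverSamples (proverDraws ∷ es) = suc (proverSamples es)
    proverSamples (_ ∷ es)           = proverSamples es

    messages : List (Event N) → List (List Bool)
    messages []                  = []
    messages (toProver w ∷ es)   = w ∷ messages es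
    messages (toVerifier w ∷ es) = w ∷ messages es
    messages (_ ∷ es)            = messages es

    -- Each message, in either direction, counts as one round.
    rounds communication : List (Event N) → ℕ
    rounds        = length ∘ messages
    communication = ℕ-sum ∘ List.map length ∘ messages

  -- A protocol for claims σ about an unknown distribution and function on
  -- Fin N; it may depend on neither of the two.
  record Protocol (N : ℕ) : Set where
    field
      verifier : ℝ → Verifier N blackBox
      honest   : ℝ → Prover N blackBox

  wt : ∀ {N} → Distribution N → (Fin N → Bool) → ℝ
  wt D f = 𝔼 D (𝟙 ∘ f)

  Δ : ∀ {N} → Distribution N → (Fin N → Bool) → ℝ → ℝ
  Δ D f σ = ∣ wt D f - σ ∣

  module _ {N : ℕ} (π : Protocol N) where
    open Protocol π

    HasCompletenessError : (εc e : ℝ) → Set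
    HasCompletenessError εc e = ∀ D f σ → 0# ≤ σ → σ ≤ 1# → Δ D f σ ≤ εc →
      ℙ[reject] (run D f (verifier σ) (honest σ)) ≤ e

    HasSoundnessError : (εf e : ℝ) → Set
    HasSoundnessError εf e = ∀ D f σ → 0# ≤ σ → σ ≤ 1# → εf < Δ D f σ →
      ∀ P → ℙ[accept] (run D f (verifier σ) P) ≤ e

    IsInteractiveProof : (εc εf : ℝ) → Set
    IsInteractiveProof εc εf = ∀ D f σ → 0# ≤ σ → σ ≤ 1# →
      (Δ D f σ ≤ εc →
        fromℕ 2 ÷ fromℕ 3 ≤ ℙ[accept] (run D f (verifier σ) (honest σ))) ×
      (εf < Δ D f σ →
        ∀ P → ℙ[accept] (run D f (verifier σ) P) ≤ 1# ÷ fromℕ 3)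

  -- Protocols, without sampling, about the weight of an oracle string of
  -- length m; both parties are given the claimed weight.
  record HammingProtocol (m : ℕ) : Set where
    field
      verifier : ℕ → Verifier m queryOnly
      honest   : ℕ → Prover m queryOnly

  ‖_‖ : ∀ {m} → (Fin m → Bool) → ℕ
  ‖ Y ‖ = Vec.sum (Vec.tabulate λ j → if Y j then 1 else 0)

  record IsExactHamming {m : ℕ} (π : HammingProtocol m) (γ δ : ℝ) : Set where
    open HammingProtocol π
    field
      complete : ∀ Y W → W ℕ.≤ m → ‖ Y ‖ ≡ W →
        1# - δ ≤ ℙ[accept] (run _ Y (verifier W) (honest W))
      sound    : ∀ Y W → W ℕ.≤ m →
        γ < ∣ fromℕ ‖ Y ‖ ÷ fromℕ m - fromℕ W ÷ fromℕ m ∣ →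
        ∀ P → ℙ[accept] (run _ Y (verifier W) P) ≤ δ

  -- Elements of Fin N as ℓ-bit strings.
  record Encoding (N ℓ : ℕ) : Set where
    field
      encode        : Fin N → Vec Bool ℓ
      decode        : Vec Bool ℓ → Fin N
      decode-encode : ∀ x → decode (encode x) ≡ x

-- Little-endian binary.
toBits : ℕ → ℕ → List Bool
toBits zero    n = []
toBits (suc k) n = does (n % 2 ℕ.≟ 1) ∷ toBits k (n / 2)

fromBits : List Bool → ℕ
fromBits []       = 0
fromBits (b ∷ bs) = (if b then 1 else 0) ℕ.+ 2 ℕ.* fromBits bs

module WeightVerification
  (F : CompleteOrderedField) (logarithm : Reals.Logarithm F) where

  open Reals F public
  open Reals.Logarithm logarithm public
  open Protocols F public

  sampleSize : (δ g : ℝ) → ℕ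
  sampleSize δ g = ⌈ fromℕ 8 * ln (fromℕ 2 ÷ δ) ÷ (g * g) ⌉

  drawMany : ∀ {N} m → (Vec (Fin N) m → Verifier N blackBox) → Verifier N blackBox
  drawMany zero    v = v []
  drawMany (suc m) v = draw λ x → drawMany m λ xs → v (x ∷ xs)

  onSample : ∀ {N m} → Vec (Fin N) m → Verifier m queryOnly → Verifier N blackBox
  onSample xs (output b)  = output b
  onSample xs (query j v) = query (lookup xs j) λ b → onSample xs (v b)
  onSample xs (toss c v)  = toss c λ i → onSample xs (v i)
  onSample xs (send w v)  = send w (onSample xs v)
  onSample xs (recv b v)  = recv b λ w → onSample xs (v w)

  answering : ∀ {N m} → (Fin m → Bool) → Prover m queryOnly → Prover N blackBox
  answering Y stop        = stop
  answering Y (query j p) = answering Y (p (Y j))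
  answering Y (toss c p)  = toss c λ i → answering Y (p i)
  answering Y (send w p)  = send w (answering Y p)
  answering Y (recv p)    = recv λ w → answering Y (p w)

  queryAll : ∀ {N} → List (Fin N) → (cache : Fin N → Bool) →
             ((Fin N → Bool) → Prover N blackBox) → Prover N blackBox
  queryAll []       cache p = p cache
  queryAll (x ∷ xs) cache p =
    query x λ b → queryAll xs (updateAt cache x (const b)) p

  module _ {N ℓ : ℕ} (enc : Encoding N ℓ) where
    open Encoding enc

    encodeSample : ∀ {m} → Vec (Fin N) m → List Bool
    encodeSample []       = []
    encodeSample (x ∷ xs) = Vec.toList (encode x) List.++ encodeSample xs

    -- Missing bits are read as false.
    word : (k : ℕ) → List Bool → Vec Bool k
    word zero    bs       = []
    word (suc k) []       = false ∷ word k []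
    word (suc k) (b ∷ bs) = b ∷ word k bs

    decodeSample : ∀ m → List Bool → Vec (Fin N) m
    decodeSample zero    bs = []
    decodeSample (suc m) bs = decode (word ℓ bs) ∷ decodeSample m (List.drop ℓ bs)

    Π : (εc εf δ : ℝ) → HammingProtocol (sampleSize δ (εf - εc)) → Protocol N
    Π εc εf δ sub = record { verifier = verifier ; honest = λ _ → honest }
      where
      module Sub = HammingProtocol sub

      g : ℝ
      g = εf - εc

      m width : ℕ
      m     = sampleSize δ g
      width = ⌈log₂ suc m ⌉

      verifier : ℝ → Verifier N blackBox
      verifier σ =
        drawMany m λ xs →
        send (encodeSample xs) (
        recv width λ w →
        let W = fromBits w in
        if does (W ℕ.≤? m) ∧
           does (∣ fromℕ W ÷ fromℕ m - σ ∣ ≤? εc + g ÷ fromℕ 2)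
        then onSample xs (Sub.verifier W)
        else output false)

      honest : Prover N blackBox
      honest =
        recv λ msg →
        let xs = decodeSample m msg in
        queryAll (List.deduplicate Fin._≟_ (Vec.toList xs)) (const false) λ cache →
        let Y = λ j → cache (lookup xs j) in
        send (toBits width ‖ Y ‖) (answering Y (Sub.honest ‖ Y ‖))

  Admissible : (εc εf δ : ℝ) → Set
  Admissible εc εf δ =
    0# ≤ εc × εc < εf × εf ≤ 1# × 0# < δ × δ < 1# ÷ fromℕ 4

  -- Asymptotics as g tends to 0 from above, in terms of 1/g.
  _∈O[_] : (ℝ → ℕ) → (ℝ → ℝ) → Set
  h ∈O[ b ] = ∃ λ C → ∃ λ g₀ → 0# < g₀ ×
    (∀ g → 0# < g → g ≤ g₀ → fromℕ (h g) ≤ C * b g)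

  _∈Õ[_] : (ℝ → ℕ) → (ℝ → ℝ) → Set
  h ∈Õ[ b ] = ∃ λ k → h ∈O[ (λ g → b g * ln (1# ÷ g) ^ k) ]

  Family : Set
  Family = (δ g : ℝ) → HammingProtocol (sampleSize δ g)

  record IsLogarithmicRound (sub : Family) : Set where
    field
      exact : ∀ δ g → 0# < δ → δ < 1# ÷ fromℕ 4 → 0# < g → g ≤ 1# →
        IsExactHamming (sub δ g) (g ÷ fromℕ 4) δ
      roundBound queryBound bitBound : (δ g : ℝ) → ℕ
      roundBound-O : ∀ δ → 0# < δ → δ < 1# ÷ fromℕ 4 →
        roundBound δ ∈O[ (λ g → ln (1# ÷ g)) ]
      queryBound-Õ : ∀ δ → 0# < δ → δ < 1# ÷ fromℕ 4 →
        queryBound δ ∈Õ[ (λ g → 1# ÷ g) ]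
      bitBound-Õ   : ∀ δ → 0# < δ → δ < 1# ÷ fromℕ 4 →
        bitBound δ ∈Õ[ (λ g → 1# ÷ g) ]
      bounded : ∀ δ g → 0# < δ → δ < 1# ÷ fromℕ 4 → 0# < g → g ≤ 1# →
        ∀ Y W → W ℕ.≤ sampleSize δ g → ∀ P →
        Always (λ es → rounds es ℕ.≤ roundBound δ g
                     × length (verifierQueries es) ℕ.≤ queryBound δ g
                     × communication es ℕ.≤ bitBound δ g)
               (run _ Y (HammingProtocol.verifier (sub δ g) W) P)

  Property : Set₁
  Property = (N ℓ : ℕ) (δ g : ℝ) → List (Event N) → Set

  InEveryRun : Family → Property → Set
  InEveryRun sub Q =
    ∀ {N ℓ} (enc : Encoding N ℓ) εc εf δ → Admissible εc εf δ → ∀ D f σ P →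
    let π = Π enc εc εf δ (sub δ (εf - εc)) in
    Always (Q N ℓ δ (εf - εc)) (run D f (Protocol.verifier π σ) P)

  InEveryHonestRun : Family → Property → Set
  InEveryHonestRun sub Q =
    ∀ {N ℓ} (enc : Encoding N ℓ) εc εf δ → Admissible εc εf δ → ∀ D f σ →
    let π = Π enc εc εf δ (sub δ (εf - εc)) in
    Always (Q N ℓ δ (εf - εc))
           (run D f (Protocol.verifier π σ) (Protocol.honest π σ))

{-# OPTIONS --safe #-}
module Submission where

open import Defs
open import Level using (0ℓ)
open import Algebra.Bundles using (CommutativeRing)
import Algebra.Properties.Group as GroupProperties
import Algebra.Properties.Monoid.Mult as Mult
import Algebra.Properties.Monoid.Sum as MonoidSum
import Algebra.Properties.Ring as RingProperties
import Algebra.Properties.Semiring.Exp as Exp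
import Algebra.Properties.Semiring.Mult as SemiringMult
import Algebra.Solver.Ring as RingSolver
open import Algebra.Solver.Ring.AlmostCommutativeRing
  using (fromCommutativeRing; _-Raw-AlmostCommutative⟶_)
open import Data.Bool.Base using (Bool; true; false; not; if_then_else_; _∧_)
open import Data.Fin.Base using (Fin; zero; suc; toℕ)
import Data.Fin.Properties as Fin
open import Data.Integer.Base as ℤ using (ℤ; -[1+_])
import Data.Integer.Properties as ℤ
open import Data.List.Base as List using (List; []; _∷_; length; _++_)
open import Data.List.Membership.Propositional using (_∈_)
open import Data.List.Membership.Propositional.Properties using (∈-lookup; ∈-deduplicate⁺)
import Data.List.Properties as List
open import Data.List.Relation.Unary.All as All using ()
open import Data.List.Relation.Unary.AllPairs using ([]; _∷_)
open import Data.List.Relation.Unary.Any using (here; there)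
open import Data.List.Relation.Unary.Unique.Propositional using (Unique)
import Data.List.Relation.Unary.Unique.DecPropositional.Properties as Unique
open import Data.Maybe.Base using (Maybe; just; nothing)
open import Data.Nat.Base as ℕ using (ℕ; zero; suc; _!; _⊓_; ⌈_/2⌉)
open import Data.Nat.DivMod using (_/_; _%_; m≡m%n+[m/n]*n; m%n<n; m<n*o⇒m/o<n)
open import Data.Nat.Induction using (Acc; acc)
open import Data.Nat.Logarithm using (⌈log₂_⌉; ⌈log₂⌉-mono-≤; ⌈log₂2^n⌉≡n)
open import Data.Nat.Logarithm.Core using (⌈log2⌉)
import Data.Nat.Properties as ℕ
open import Data.Product.Base using (∃; _×_; _,_; proj₁; proj₂)
open import Data.Sum.Base using (_⊎_; inj₁; inj₂)
open import Data.Unit.Base using (tt)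
open import Data.Vec.Base as Vec using (Vec; []; _∷_; lookup)
open import Data.Vec.Functional using (updateAt)
open import Data.Vec.Functional.Properties using (updateAt-updates; updateAt-minimal)
import Data.Vec.Membership.Propositional.Properties as Vec-∈
import Data.Vec.Properties as Vec
open import Function.Base using (_∘_; const)
open import Relation.Binary.Bundles using (Poset)
import Relation.Binary.Construct.NonStrictToStrict as Strict
open import Relation.Binary.PropositionalEquality
import Relation.Binary.Reasoning.PartialOrder as PartialOrderReasoning
open import Relation.Binary.Structures using (IsDecTotalOrder)
open import Relation.Nullary using (¬_; Dec; yes; no; does; contradiction)

-- The honest claim W = ‖Y‖₁ survives the threshold test, and a false claim is
-- caught by the subprotocol, as soon as the sample mean is close to wt_D(f);
-- this is Hoeffding's bound with the sharp constant 2 m t², needed two-sided at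
-- t = g/2 for completeness and one-sided at t = g/4 for soundness.
--
-- No exponential function is available at a general point, only the partial
-- sums of its series, so everything is phrased through two bounds on them:
-- (1 + h) e(x) ≤ e(x + h) and (1 - h) e(x + h) ≤ e(x).  Chernoff's tilt e^s is
-- replaced by q^n with q = 1 + s/n.  For G_j = 1 - p + p q^j and r = (q - 1)²/4
-- one has the algebraic inequality G_{j+2} G_j ≤ (1 + r) G_{j+1}², the discrete
-- form of (log G)″ ≤ 1/4; it telescopes to
-- G_n ≤ (1 + p s/n)^n (1 + r)^{n(n-1)/2}, which replaces Hoeffding's lemma
-- 1 - p + p e^s ≤ e^{ps + s²/8}.  The loss is a factor at most 2 for large n,
-- and the union bound has room for it.
--
-- A prover against the composed protocol is a prover against the subprotocol
-- that knows D and f, hence can answer its own queries and toss its samples.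

-- The tail estimate loses a factor 2, so the exponent `L = ln (2/δ)` yields probability
-- `2 · δ/2 = δ`. Since `m ≥ 8 L / g²`, the exponent `2 m (g/4)²` is at least `L`: at distance g/4
-- the budget δ pays for one tail only. Soundness gets by with one, because the sign of wt_D(f) - σ
-- is fixed before sampling and only a deviation towards σ helps the prover. Completeness needs both
-- tails, but at distance g/2, where the exponent is at least `4 L ≥ L + 1`, and `e ≥ 2` halves each
-- tail.
--
-- Probabilities of events are not introduced. A tail is a nonnegative function of the sample that
-- is at least 1 on the bad samples and has small expectation, so acceptance and rejection are
-- bounded pointwise and averaged afterwards.
--
-- The logarithm is given only through the limit of the series at its values; neither its sign nor
-- its monotonicity is part of the data. Bounding it from below therefore also requires control of
-- the series at negative arguments, where the terms alternate.

-- Ordered fields: ring solver, order, powers and finite sums.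

module OrderedFieldProperties (K : OrderedField) where
  open OrderedField K
  open CommutativeRing commutativeRing public
    using (+-assoc; +-comm; +-identityˡ; +-identityʳ; *-assoc; *-comm;
           *-identityˡ; *-identityʳ; zeroˡ; zeroʳ; distribˡ; distribʳ;
           -‿inverseʳ; +-group; ring)
  open RingProperties ring using (-‿distribˡ-*; -0#≈0#; -‿+-comm)
  open IsDecTotalOrder isDecTotalOrder public
    using () renaming (refl to ≤-refl; reflexive to ≤-reflexive;
                       trans to ≤-trans; antisym to ≤-antisym; isPartialOrder to ≤-isPartialOrder)

  fromℕ-+ : ∀ a b → fromℕ (a ℕ.+ b) ≡ fromℕ a + fromℕ b
  fromℕ-+ = Mult.×-homo-+ +-monoid 1#

  fromℕ-* : ∀ a b → fromℕ (a ℕ.* b) ≡ fromℕ a * fromℕ b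
  fromℕ-* = SemiringMult.×1-homo-* semiring

  private
    -- Integers serve as the coefficients of the ring solver because their arithmetic and equality
    -- compute; closed terms of an abstract field would not reduce.
    fromℤ : ℤ → ℝ
    fromℤ (ℤ.+ n)  = fromℕ n
    fromℤ -[1+ n ] = - fromℕ (suc n)

    open ≡-Reasoning

    cancelˡ : ∀ x y z → (x + y) + - (x + z) ≡ y + - z
    cancelˡ x y z = begin
      (x + y) + - (x + z)    ≡⟨ cong ((x + y) +_) (sym (-‿+-comm x z)) ⟩
      (x + y) + (- x + - z)  ≡⟨ cong (_+ (- x + - z)) (+-comm x y) ⟩
      (y + x) + (- x + - z)  ≡⟨ +-assoc y x _ ⟩
      y + (x + (- x + - z))  ≡⟨ cong (y +_) (sym (+-assoc x (- x) (- z))) ⟩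
      y + ((x + - x) + - z)  ≡⟨ cong (λ w → y + (w + - z)) (-‿inverseʳ x) ⟩
      y + (0# + - z)         ≡⟨ cong (y +_) (+-identityˡ (- z)) ⟩
      y + - z                ∎

    fromℤ-⊖ : ∀ a b → fromℤ (a ℤ.⊖ b) ≡ fromℕ a + - fromℕ b
    fromℤ-⊖ zero    zero    = sym (trans (cong (0# +_) -0#≈0#) (+-identityˡ 0#))
    fromℤ-⊖ zero    (suc b) = sym (+-identityˡ _)
    fromℤ-⊖ (suc a) zero    = sym (trans (cong (fromℕ (suc a) +_) -0#≈0#) (+-identityʳ _))
    fromℤ-⊖ (suc a) (suc b) = begin
      fromℤ (suc a ℤ.⊖ suc b)      ≡⟨ cong fromℤ (ℤ.[1+m]⊖[1+n]≡m⊖n a b) ⟩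
      fromℤ (a ℤ.⊖ b)              ≡⟨ fromℤ-⊖ a b ⟩
      fromℕ a + - fromℕ b          ≡⟨ sym (cancelˡ 1# (fromℕ a) (fromℕ b)) ⟩
      fromℕ (suc a) + - fromℕ (suc b) ∎

    fromℤ-+ : ∀ a b → fromℤ (a ℤ.+ b) ≡ fromℤ a + fromℤ b
    fromℤ-+ (ℤ.+ a)    (ℤ.+ b)    = fromℕ-+ a b
    fromℤ-+ (ℤ.+ a)    -[1+ b ] = fromℤ-⊖ a (suc b)
    fromℤ-+ -[1+ a ] (ℤ.+ b)    = trans (fromℤ-⊖ b (suc a)) (+-comm _ _)
    fromℤ-+ -[1+ a ] -[1+ b ] = begin
      - fromℕ (suc (suc (a ℕ.+ b)))        ≡⟨ cong (λ n → - fromℕ (suc n)) (sym (ℕ.+-suc a b)) ⟩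
      - fromℕ (suc a ℕ.+ suc b)            ≡⟨ cong -_ (fromℕ-+ (suc a) (suc b)) ⟩
      - (fromℕ (suc a) + fromℕ (suc b))    ≡⟨ sym (-‿+-comm _ _) ⟩
      - fromℕ (suc a) + - fromℕ (suc b)    ∎

    fromℤ-neg : ∀ a → fromℤ (ℤ.- a) ≡ - fromℤ a
    fromℤ-neg (ℤ.+ zero)    = sym -0#≈0#
    fromℤ-neg (ℤ.+ suc a) = refl
    fromℤ-neg -[1+ a ]    = sym (GroupProperties.⁻¹-involutive +-group _)

    fromℤ-*ℕ : ∀ a b → fromℤ (ℤ.+ a ℤ.* b) ≡ fromℕ a * fromℤ b
    fromℤ-*ℕ zero    b = sym (zeroˡ (fromℤ b))
    fromℤ-*ℕ (suc a) b = begin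
      fromℤ (ℤ.+ suc a ℤ.* b)             ≡⟨ cong fromℤ (ℤ.suc-* (ℤ.+ a) b) ⟩
      fromℤ (b ℤ.+ ℤ.+ a ℤ.* b)           ≡⟨ fromℤ-+ b _ ⟩
      fromℤ b + fromℤ (ℤ.+ a ℤ.* b)       ≡⟨ cong₂ _+_ (sym (*-identityˡ _)) (fromℤ-*ℕ a b) ⟩
      1# * fromℤ b + fromℕ a * fromℤ b  ≡⟨ sym (distribʳ _ _ _) ⟩
      (1# + fromℕ a) * fromℤ b          ∎

    fromℤ-* : ∀ a b → fromℤ (a ℤ.* b) ≡ fromℤ a * fromℤ b
    fromℤ-* (ℤ.+ a)    b = fromℤ-*ℕ a b
    fromℤ-* -[1+ a ] b = begin
      fromℤ (-[1+ a ] ℤ.* b)      ≡⟨ cong fromℤ (sym (ℤ.neg-distribˡ-* (ℤ.+ suc a) b)) ⟩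
      fromℤ (ℤ.- (ℤ.+ suc a ℤ.* b)) ≡⟨ fromℤ-neg (ℤ.+ suc a ℤ.* b) ⟩
      - fromℤ (ℤ.+ suc a ℤ.* b)     ≡⟨ cong -_ (fromℤ-*ℕ (suc a) b) ⟩
      - (fromℕ (suc a) * fromℤ b) ≡⟨ -‿distribˡ-* _ _ ⟩
      - fromℕ (suc a) * fromℤ b   ∎

    morphism : ℤ.+-*-rawRing -Raw-AlmostCommutative⟶ fromCommutativeRing commutativeRing
    morphism = record
      { ⟦_⟧ = fromℤ ; +-homo = fromℤ-+ ; *-homo = fromℤ-* ; -‿homo = fromℤ-neg
      ; 0-homo = refl ; 1-homo = +-identityʳ 1# }

    coeff≟ : ∀ a b → Maybe (fromℤ a ≡ fromℤ b)
    coeff≟ a b with a ℤ.≟ b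
    ... | yes a≡b = just (cong fromℤ a≡b)
    ... | no  _   = nothing

  open RingSolver ℤ.+-*-rawRing (fromCommutativeRing commutativeRing) morphism coeff≟ public
    using (Polynomial; solve; _:=_; _:+_; _:*_; _:-_; :-_; con; _:^_)

  nat : ∀ {n} → ℕ → Polynomial n
  nat k = con (ℤ.+ k)

  -- nat 1 denotes 1# + 0#, which is not definitionally 1#.
  one : ∀ {n} → Polynomial n
  one = nat 0 :^ 0

  ≤-poset : Poset 0ℓ 0ℓ 0ℓ
  ≤-poset = record { isPartialOrder = ≤-isPartialOrder }

  module ≤-Reasoning = PartialOrderReasoning ≤-poset

  <⇒≤ : ∀ {x y} → x < y → x ≤ y
  <⇒≤ = proj₁

  <⇒≱ : ∀ {x y} → x < y → ¬ (y ≤ x)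
  <⇒≱ = Strict.<⇒≱ _≡_ _≤_ ≤-antisym

  ≰⇒> : ∀ {x y} → ¬ (x ≤ y) → y < x
  ≰⇒> = Strict.≰⇒> _≡_ _≤_ sym ≤-reflexive ≤-total

  <-≤-trans : ∀ {x y z} → x < y → y ≤ z → x < z
  <-≤-trans x<y y≤z = Strict.<-≤-trans _≡_ _≤_ sym ≤-trans ≤-antisym (subst (_ ≤_)) x<y y≤z

  ≤-<-trans : ∀ {x y z} → x ≤ y → y < z → x < z
  ≤-<-trans x≤y y<z = Strict.≤-<-trans _≡_ _≤_ ≤-trans ≤-antisym (subst (_≤ _)) x≤y y<z

  ≤-or-> : ∀ x y → x ≤ y ⊎ y < x
  ≤-or-> x y with x ≤? y
  ... | yes x≤y = inj₁ x≤y
  ... | no  x≰y = inj₂ (≰⇒> x≰y)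

  +-mono-≤ : ∀ {x y u v} → x ≤ y → u ≤ v → x + u ≤ y + v
  +-mono-≤ {x} {y} {u} {v} x≤y u≤v =
    ≤-trans (+-monoˡ-≤ u x≤y) (subst₂ _≤_ (+-comm u y) (+-comm v y) (+-monoˡ-≤ y u≤v))

  +-monoʳ-≤ : ∀ x {u v} → u ≤ v → x + u ≤ x + v
  +-monoʳ-≤ x = +-mono-≤ ≤-refl

  -- A linear inequality follows from another one with the same difference of
  -- sides; the equality is left to the ring solver.
  ≤-via : ∀ {x y u v} → u ≤ v → y - x ≡ v - u → x ≤ y
  ≤-via {x} {y} {u} {v} u≤v eq = subst₂ _≤_
    (solve 2 (λ u x → u :+ (x :- u) := x) refl u x)
    (trans (solve 3 (λ u v x → v :+ (x :- u) := (v :- u) :+ x) refl u v x)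
      (trans (cong (_+ x) (sym eq)) (solve 2 (λ x y → (y :- x) :+ x := y) refl x y)))
    (+-monoˡ-≤ (x - u) u≤v)

  0≤y-x⇒x≤y : ∀ {x y} → 0# ≤ y - x → x ≤ y
  0≤y-x⇒x≤y {x} {y} h = ≤-via h (solve 2 (λ x y → y :- x := (y :- x) :- nat 0) refl x y)

  x≤y⇒0≤y-x : ∀ {x y} → x ≤ y → 0# ≤ y - x
  x≤y⇒0≤y-x {x} {y} h = ≤-via h (solve 2 (λ x y → (y :- x) :- nat 0 := y :- x) refl x y)

  <-via : ∀ {x y u v} → u < v → y - x ≡ v - u → x < y
  <-via {x} {y} {u} {v} (u≤v , u≢v) eq = ≤-via u≤v eq , λ x≡y → u≢v (sym (begin
    v             ≡⟨ solve 2 (λ u v → v := (v :- u) :+ u) refl u v ⟩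
    (v - u) + u   ≡⟨ cong (_+ u) (sym eq) ⟩
    (y - x) + u   ≡⟨ cong (λ w → (y - w) + u) x≡y ⟩
    (y - y) + u   ≡⟨ solve 2 (λ u y → (y :- y) :+ u := u) refl u y ⟩
    u             ∎))

  x<y⇒0<y-x : ∀ {x y} → x < y → 0# < y - x
  x<y⇒0<y-x {x} {y} h = <-via h (solve 2 (λ x y → (y :- x) :- nat 0 := y :- x) refl x y)

  +-nonNeg : ∀ {x y} → 0# ≤ x → 0# ≤ y → 0# ≤ x + y
  +-nonNeg 0≤x 0≤y = ≤-trans (≤-reflexive (sym (+-identityʳ 0#))) (+-mono-≤ 0≤x 0≤y)

  *-monoʳ-≤ : ∀ {x y z} → 0# ≤ z → x ≤ y → z * x ≤ z * y
  *-monoʳ-≤ {x} {y} {z} 0≤z x≤y = ≤-via (*-nonNeg 0≤z (x≤y⇒0≤y-x x≤y))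
    (solve 3 (λ x y z → z :* y :- z :* x := z :* (y :- x) :- nat 0) refl x y z)

  *-monoˡ-≤ : ∀ {x y z} → 0# ≤ z → x ≤ y → x * z ≤ y * z
  *-monoˡ-≤ {x} {y} {z} 0≤z x≤y = subst₂ _≤_ (*-comm z x) (*-comm z y) (*-monoʳ-≤ 0≤z x≤y)

  *-mono-≤ : ∀ {x y u v} → 0# ≤ y → 0# ≤ u → x ≤ y → u ≤ v → x * u ≤ y * v
  *-mono-≤ 0≤y 0≤u x≤y u≤v = ≤-trans (*-monoˡ-≤ 0≤u x≤y) (*-monoʳ-≤ 0≤y u≤v)

  square-nonNeg : ∀ x → 0# ≤ x * x
  square-nonNeg x with ≤-total 0# x
  ... | inj₁ 0≤x = *-nonNeg 0≤x 0≤x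
  ... | inj₂ x≤0 = subst (0# ≤_) (solve 1 (λ x → (:- x) :* (:- x) := x :* x) refl x) (*-nonNeg 0≤-x 0≤-x)
    where
    0≤-x : 0# ≤ - x
    0≤-x = ≤-via x≤0 (solve 1 (λ x → (:- x) :- nat 0 := nat 0 :- x) refl x)

  0≤1 : 0# ≤ 1#
  0≤1 = subst (0# ≤_) (*-identityˡ 1#) (square-nonNeg 1#)

  0<1 : 0# < 1#
  0<1 = 0≤1 , 0≢1

  fromℕ-nonNeg : ∀ n → 0# ≤ fromℕ n
  fromℕ-nonNeg zero    = ≤-refl
  fromℕ-nonNeg (suc n) = +-nonNeg 0≤1 (fromℕ-nonNeg n)

  fromℕ-mono-≤ : ∀ {a b} → a ℕ.≤ b → fromℕ a ≤ fromℕ b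
  fromℕ-mono-≤ {b = b} ℕ.z≤n = fromℕ-nonNeg b
  fromℕ-mono-≤ (ℕ.s≤s a≤b) = +-monoʳ-≤ 1# (fromℕ-mono-≤ a≤b)

  fromℕ-pos : ∀ n → 0# < fromℕ (suc n)
  fromℕ-pos n = <-≤-trans 0<1 (≤-trans (≤-reflexive (sym (+-identityʳ 1#))) (fromℕ-mono-≤ {1} {suc n} (ℕ.s≤s ℕ.z≤n)))

  fromℕ-mono-< : ∀ {a b} → a ℕ.< b → fromℕ a < fromℕ b
  fromℕ-mono-< {a} {b} a<b = <-≤-trans
    (<-via 0<1 (solve 1 (λ x → (one :+ x) :- x := one :- nat 0) refl (fromℕ a)))
    (fromℕ-mono-≤ {suc a} {b} a<b)

  fromℕ-cancel-≤ : ∀ {a b} → fromℕ a ≤ fromℕ b → a ℕ.≤ b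
  fromℕ-cancel-≤ {a} {b} h with a ℕ.≤? b
  ... | yes a≤b = a≤b
  ... | no  a≰b = contradiction h (<⇒≱ (fromℕ-mono-< (ℕ.≰⇒> a≰b)))

  fromℕ-nonZero : ∀ n → fromℕ (suc n) ≢ 0#
  fromℕ-nonZero n eq = proj₂ (fromℕ-pos n) (sym eq)

  >⇒≢0 : ∀ {x} → 0# < x → x ≢ 0#
  >⇒≢0 (_ , 0≢x) x≡0 = 0≢x (sym x≡0)

  *-cancelʳ : ∀ {x} → x ≢ 0# → ∀ y → (y * x) * x ⁻¹ ≡ y
  *-cancelʳ {x} x≢0 y = begin
    (y * x) * x ⁻¹  ≡⟨ *-assoc y x (x ⁻¹) ⟩
    y * (x * x ⁻¹)  ≡⟨ cong (y *_) (*-inverseʳ x x≢0) ⟩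
    y * 1#          ≡⟨ *-identityʳ y ⟩
    y               ∎

  ÷-cancelʳ : ∀ {x} → x ≢ 0# → ∀ y → (y * x ⁻¹) * x ≡ y
  ÷-cancelʳ {x} x≢0 y = trans (solve 3 (λ x y z → (y :* z) :* x := (y :* x) :* z) refl x y (x ⁻¹)) (*-cancelʳ x≢0 y)

  *-pos : ∀ {x y} → 0# < x → 0# < y → 0# < x * y
  *-pos {x} {y} 0<x 0<y = *-nonNeg (<⇒≤ 0<x) (<⇒≤ 0<y) , λ 0≡xy → proj₂ 0<x (begin
    0#              ≡⟨ sym (zeroˡ (y ⁻¹)) ⟩
    0# * y ⁻¹       ≡⟨ cong (_* y ⁻¹) 0≡xy ⟩
    (x * y) * y ⁻¹  ≡⟨ *-cancelʳ (>⇒≢0 0<y) x ⟩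
    x               ∎)

  ⁻¹-pos : ∀ {x} → 0# < x → 0# < x ⁻¹
  ⁻¹-pos {x} 0<x with ≤-or-> (x ⁻¹) 0#
  ... | inj₂ 0<x⁻¹ = 0<x⁻¹
  ... | inj₁ x⁻¹≤0 = contradiction
    (subst₂ _≤_ (*-inverseʳ x (>⇒≢0 0<x)) (zeroʳ x) (*-monoʳ-≤ (<⇒≤ 0<x) x⁻¹≤0))
    (<⇒≱ 0<1)

  *-cancelʳ-≤ : ∀ {x y z} → 0# < z → x * z ≤ y * z → x ≤ y
  *-cancelʳ-≤ {x} {y} {z} 0<z h = subst₂ _≤_ (*-cancelʳ (>⇒≢0 0<z) x) (*-cancelʳ (>⇒≢0 0<z) y)
    (*-monoˡ-≤ (<⇒≤ (⁻¹-pos 0<z)) h)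

  *-cancelˡ-≤ : ∀ {x y z} → 0# < z → z * x ≤ z * y → x ≤ y
  *-cancelˡ-≤ {x} {y} {z} 0<z h = *-cancelʳ-≤ 0<z (subst₂ _≤_ (*-comm z x) (*-comm z y) h)

  ≤-÷ : ∀ {x y z} → 0# < z → x * z ≤ y → x ≤ y * z ⁻¹
  ≤-÷ {x} {y} {z} 0<z h = *-cancelʳ-≤ 0<z (≤-trans h (≤-reflexive (sym (÷-cancelʳ (>⇒≢0 0<z) y))))

  ÷-≤ : ∀ {x y z} → 0# < z → x ≤ y * z → x * z ⁻¹ ≤ y
  ÷-≤ {x} {y} {z} 0<z h = *-cancelʳ-≤ 0<z (≤-trans (≤-reflexive (÷-cancelʳ (>⇒≢0 0<z) x)) h)

  ÷-nonNeg : ∀ {x z} → 0# ≤ x → 0# < z → 0# ≤ x * z ⁻¹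
  ÷-nonNeg 0≤x 0<z = *-nonNeg 0≤x (<⇒≤ (⁻¹-pos 0<z))

  ÷-pos : ∀ {x z} → 0# < x → 0# < z → 0# < x * z ⁻¹
  ÷-pos 0<x 0<z = *-pos 0<x (⁻¹-pos 0<z)

  ^-nonNeg : ∀ {x} n → 0# ≤ x → 0# ≤ x ^ n
  ^-nonNeg zero    0≤x = 0≤1
  ^-nonNeg (suc n) 0≤x = *-nonNeg 0≤x (^-nonNeg n 0≤x)

  ^-pos : ∀ {x} n → 0# < x → 0# < x ^ n
  ^-pos zero    0<x = 0<1
  ^-pos (suc n) 0<x = *-pos 0<x (^-pos n 0<x)

  ^-mono-≤ : ∀ {x y} n → 0# ≤ x → x ≤ y → x ^ n ≤ y ^ n
  ^-mono-≤ zero    0≤x x≤y = ≤-refl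
  ^-mono-≤ (suc n) 0≤x x≤y = *-mono-≤ (≤-trans 0≤x x≤y) (^-nonNeg n 0≤x) x≤y (^-mono-≤ n 0≤x x≤y)

  1≤x^n : ∀ {x} n → 1# ≤ x → 1# ≤ x ^ n
  1≤x^n zero    1≤x = ≤-refl
  1≤x^n (suc n) 1≤x = ≤-trans (≤-reflexive (sym (*-identityˡ 1#)))
    (*-mono-≤ (≤-trans 0≤1 1≤x) 0≤1 1≤x (1≤x^n n 1≤x))

  ^-monoʳ-≤ : ∀ {x a b} → 1# ≤ x → a ℕ.≤ b → x ^ a ≤ x ^ b
  ^-monoʳ-≤ {b = b} 1≤x ℕ.z≤n   = 1≤x^n b 1≤x
  ^-monoʳ-≤ 1≤x (ℕ.s≤s a≤b) = *-monoʳ-≤ (≤-trans 0≤1 1≤x) (^-monoʳ-≤ 1≤x a≤b)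

  open Exp semiring public using (^-homo-*; ^-assocʳ)

  ^-distrib-* : ∀ x y n → (x * y) ^ n ≡ x ^ n * y ^ n
  ^-distrib-* x y zero    = sym (*-identityˡ 1#)
  ^-distrib-* x y (suc n) = trans (cong ((x * y) *_) (^-distrib-* x y n))
    (solve 4 (λ x y u v → (x :* y) :* (u :* v) := (x :* u) :* (y :* v)) refl x y (x ^ n) (y ^ n))

  -- Induction on the exponent: multiplying the bound for n by `1# - x` leaves the slack `n x²`.
  bernoulli : ∀ {x} n → 0# ≤ x → x ≤ 1# → 1# - fromℕ n * x ≤ (1# - x) ^ n
  bernoulli {x} zero    0≤x x≤1 = ≤-reflexive (solve 1 (λ x → one :- nat 0 :* x := one) refl x)
  bernoulli {x} (suc n) 0≤x x≤1 = ≤-trans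
    (≤-via (*-nonNeg (fromℕ-nonNeg n) (square-nonNeg x))
      (solve 2 (λ x k → (one :- x) :* (one :- k :* x) :- (one :- (one :+ k) :* x)
                      := k :* (x :* x) :- nat 0) refl x (fromℕ n)))
    (*-monoʳ-≤ (x≤y⇒0≤y-x x≤1) (bernoulli n 0≤x x≤1))

  sum-cong : ∀ {n} {a b : Fin n → ℝ} → (∀ i → a i ≡ b i) → sum a ≡ sum b
  sum-cong {zero}  a≗b = refl
  sum-cong {suc n} a≗b = cong₂ _+_ (a≗b zero) (sum-cong λ i → a≗b (suc i))

  sum-mono-≤ : ∀ {n} {a b : Fin n → ℝ} → (∀ i → a i ≤ b i) → sum a ≤ sum b
  sum-mono-≤ {zero}  a≤b = ≤-refl
  sum-mono-≤ {suc n} a≤b = +-mono-≤ (a≤b zero) (sum-mono-≤ λ i → a≤b (suc i))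

  sum-distribʳ : ∀ {n} (a : Fin n → ℝ) c → sum (λ i → a i * c) ≡ sum a * c
  sum-distribʳ {zero}  a c = sym (zeroˡ c)
  sum-distribʳ {suc n} a c = trans (cong (a zero * c +_) (sum-distribʳ (λ i → a (suc i)) c)) (sym (distribʳ c _ _))

  sum-distrib-+ : ∀ {n} (a b : Fin n → ℝ) → sum (λ i → a i + b i) ≡ sum a + sum b
  sum-distrib-+ {zero}  a b = sym (+-identityʳ 0#)
  sum-distrib-+ {suc n} a b = trans (cong (a zero + b zero +_) (sum-distrib-+ (λ i → a (suc i)) (λ i → b (suc i))))
    (solve 4 (λ x y u v → (x :+ y) :+ (u :+ v) := (x :+ u) :+ (y :+ v)) refl (a zero) (b zero) _ _)

  x≤x+y : ∀ {x y} → 0# ≤ y → x ≤ x + y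
  x≤x+y {x} {y} 0≤y = ≤-via 0≤y (solve 2 (λ x y → (x :+ y) :- x := y :- nat 0) refl x y)

  x+[y-x]≡y : ∀ x y → x + (y - x) ≡ y
  x+[y-x]≡y = solve 2 (λ x y → x :+ (y :- x) := y) refl

  x+[y-y]≡x : ∀ x y → x + (y - y) ≡ x
  x+[y-y]≡x = solve 2 (λ x y → x :+ (y :- y) := x) refl

  <-÷ : ∀ {x y z} → 0# < z → x * z < y → x < y * z ⁻¹
  <-÷ {x} {y} {z} 0<z xz<y = ≰⇒> λ y÷z≤x → <⇒≱ xz<y
    (≤-trans (≤-reflexive (sym (÷-cancelʳ (>⇒≢0 0<z) y))) (*-monoˡ-≤ (<⇒≤ 0<z) y÷z≤x))

  ÷-< : ∀ {x y z} → 0# < z → y < x * z → y * z ⁻¹ < x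
  ÷-< {x} {y} {z} 0<z y<xz = ≰⇒> λ x≤y÷z → <⇒≱ y<xz
    (≤-trans (*-monoˡ-≤ (<⇒≤ 0<z) x≤y÷z) (≤-reflexive (÷-cancelʳ (>⇒≢0 0<z) y)))

  <-÷⁻¹ : ∀ {x y z} → 0# < z → x < y * z ⁻¹ → x * z < y
  <-÷⁻¹ 0<z x<y÷z = ≰⇒> λ y≤xz → <⇒≱ x<y÷z (÷-≤ 0<z y≤xz)

  ÷-≤⁻¹ : ∀ {x y z} → 0# < z → x * z ⁻¹ ≤ y → x ≤ y * z
  ÷-≤⁻¹ {x} 0<z h = ≤-trans (≤-reflexive (sym (÷-cancelʳ (>⇒≢0 0<z) x))) (*-monoˡ-≤ (<⇒≤ 0<z) h)

-- Absolute value, ceiling and limits.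

module RealProperties (F : CompleteOrderedField) where
  open Reals F
  open OrderedFieldProperties orderedField

  x≤∣x∣ : ∀ x → x ≤ ∣ x ∣
  x≤∣x∣ x with ≤-total 0# x
  ... | inj₁ 0≤x = ≤-refl
  ... | inj₂ x≤0 = ≤-trans x≤0 (≤-via x≤0 (solve 1 (λ x → (:- x) :- nat 0 := nat 0 :- x) refl x))

  -x≤∣x∣ : ∀ x → - x ≤ ∣ x ∣
  -x≤∣x∣ x with ≤-total 0# x
  ... | inj₁ 0≤x = ≤-trans (≤-via 0≤x (solve 1 (λ x → nat 0 :- :- x := x :- nat 0) refl x)) 0≤x
  ... | inj₂ x≤0 = ≤-refl

  ∣∣-split : ∀ x → ∣ x ∣ ≡ x ⊎ ∣ x ∣ ≡ - x
  ∣∣-split x with ≤-total 0# x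
  ... | inj₁ _ = inj₁ refl
  ... | inj₂ _ = inj₂ refl

  ∣∣-≤ : ∀ {x b} → x ≤ b → - x ≤ b → ∣ x ∣ ≤ b
  ∣∣-≤ {x} x≤b -x≤b with ≤-total 0# x
  ... | inj₁ _ = x≤b
  ... | inj₂ _ = -x≤b

  IsCeiling : ℝ → ℕ → Set
  IsCeiling x c = x ≤ fromℕ c × (∀ k → x ≤ fromℕ k → c ℕ.≤ k)

  private
    -- The underscore is the search inside ⌈_⌉, which has no name outside its
    -- definition.
    search-isCeiling : ∀ x n → x ≤ fromℕ n → IsCeiling x _

  -- Abstracting `archimedean x` exposes the search as a function of its starting point, and this
  -- use is what determines the underscore above.
  ⌈⌉-isCeiling : ∀ x → IsCeiling x ⌈ x ⌉
  ⌈⌉-isCeiling x with archimedean x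
  ... | n , x≤n = search-isCeiling x n x≤n

  search-isCeiling x zero    h = h , λ _ _ → ℕ.z≤n
  search-isCeiling x (suc n) h with x ≤? fromℕ n
  ... | yes p = search-isCeiling x n p
  ... | no ¬p = h , λ k x≤k → ℕ.≰⇒> λ k≤n → ¬p (≤-trans x≤k (fromℕ-mono-≤ k≤n))

  x≤⌈x⌉ : ∀ x → x ≤ fromℕ ⌈ x ⌉
  x≤⌈x⌉ x = proj₁ (⌈⌉-isCeiling x)

  ⌈⌉-least : ∀ x k → x ≤ fromℕ k → ⌈ x ⌉ ℕ.≤ k
  ⌈⌉-least x = proj₂ (⌈⌉-isCeiling x)

  ⌈x⌉≤1+x : ∀ {x} → 0# ≤ x → fromℕ ⌈ x ⌉ ≤ 1# + x
  ⌈x⌉≤1+x {x} 0≤x with ⌈ x ⌉ in eq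
  ... | zero  = +-nonNeg 0≤1 0≤x
  ... | suc c = +-monoʳ-≤ 1# (<⇒≤ (≰⇒> λ x≤c →
    ℕ.1+n≰n (subst (ℕ._≤ c) eq (⌈⌉-least x c x≤c))))

  -- If L exceeded B, closeness within `L - B` would fail. The starting index matters for the
  -- alternating series, which is bounded only eventually.
  limit-≤ : ∀ {a L B} n₁ → a ⟶ L → (∀ n → n₁ ℕ.≤ n → a n ≤ B) → L ≤ B
  limit-≤ {a} {L} {B} n₁ a⟶L a≤B with ≤-or-> L B
  ... | inj₁ L≤B = L≤B
  ... | inj₂ B<L with a⟶L (L - B) (x<y⇒0<y-x B<L)
  ...   | n₀ , close = contradiction
    (≤-trans (≤-via (a≤B n (ℕ.m≤n⊔m n₀ n₁))
               (solve 3 (λ a L B → (:- (a :- L)) :- (L :- B) := B :- a) refl (a n) L B))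
             (-x≤∣x∣ (a n - L)))
    (<⇒≱ (close n (ℕ.m≤m⊔n n₀ n₁)))
    where n = n₀ ℕ.⊔ n₁

  limit-≥ : ∀ {a L B} n₁ → a ⟶ L → (∀ n → n₁ ℕ.≤ n → B ≤ a n) → B ≤ L
  limit-≥ {a} {L} {B} n₁ a⟶L B≤a with ≤-or-> B L
  ... | inj₁ B≤L = B≤L
  ... | inj₂ L<B with a⟶L (B - L) (x<y⇒0<y-x L<B)
  ...   | n₀ , close = contradiction
    (≤-trans (≤-via (B≤a n (ℕ.m≤n⊔m n₀ n₁))
               (solve 3 (λ a L B → (a :- L) :- (B :- L) := a :- B) refl (a n) L B))
             (x≤∣x∣ (a n - L)))
    (<⇒≱ (close n (ℕ.m≤m⊔n n₀ n₁)))
    where n = n₀ ℕ.⊔ n₁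

-- Partial sums of the exponential series.

module Exponential (F : CompleteOrderedField) where
  open Reals F
  open OrderedFieldProperties orderedField
  open RealProperties F

  term : ℕ → ℝ → ℝ
  term k x = x ^ k ÷ fromℕ (k !)

  -- The sum of the first n terms of the exponential series, hence
  -- expSum x n ≡ partial x (suc n).
  partial : ℝ → ℕ → ℝ
  partial x zero    = 0#
  partial x (suc n) = partial x n + term n x

  expSum≡partial : ∀ x n → expSum x n ≡ partial x (suc n)
  expSum≡partial x n = go (suc n)
    where
    go : ∀ n → sum {n} (λ k → x ^ toℕ k ÷ fromℕ (toℕ k !)) ≡ partial x n
    go zero    = refl
    go (suc n) = trans (MonoidSum.sum-init-last +-monoid {n} (λ k → term (toℕ k) x))
      (cong₂ _+_
        (trans (sum-cong {n} (λ k → cong (λ j → term j x) (Fin.toℕ-inject₁ k))) (go n))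
        (cong (λ j → term j x) (Fin.toℕ-fromℕ n)))

  !-pos : ∀ k → 0# < fromℕ (k !)
  !-pos zero    = fromℕ-pos 0
  !-pos (suc k) = subst (0# <_) (sym (fromℕ-* (suc k) (k !))) (*-pos (fromℕ-pos k) (!-pos k))

  term-zero : ∀ x → term 0 x ≡ 1#
  term-zero x = trans (cong (_* fromℕ 1 ⁻¹) (sym (+-identityʳ 1#))) (*-inverseʳ (fromℕ 1) (fromℕ-nonZero 0))

  -- The recursion of the terms with the division cleared; the mean value bounds are proved after
  -- multiplication by `fromℕ (suc k)` so that it applies directly.
  term-suc : ∀ k x → fromℕ (suc k) * term (suc k) x ≡ x * term k x
  term-suc k x = begin
    A * ((x * y) * C ⁻¹)                    ≡⟨ sym (*-cancelʳ B≢0 _) ⟩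
    (A * ((x * y) * C ⁻¹)) * B * B ⁻¹       ≡⟨ solve 6 (λ A B c b x y →
        (A :* ((x :* y) :* c)) :* B :* b := ((x :* (y :* b)) :* (A :* B)) :* c)
        refl A B (C ⁻¹) (B ⁻¹) x y ⟩
    ((x * (y * B ⁻¹)) * (A * B)) * C ⁻¹     ≡⟨ cong (λ z → ((x * (y * B ⁻¹)) * z) * C ⁻¹) (sym (fromℕ-* (suc k) (k !))) ⟩
    ((x * (y * B ⁻¹)) * C) * C ⁻¹           ≡⟨ *-cancelʳ (>⇒≢0 (!-pos (suc k))) _ ⟩
    x * (y * B ⁻¹)                          ∎
    where
    open ≡-Reasoning
    A B C y : ℝ
    A = fromℕ (suc k)
    B = fromℕ (k !)
    C = fromℕ (suc k !)
    y = x ^ k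
    B≢0 : B ≢ 0#
    B≢0 = >⇒≢0 (!-pos k)

  term-nonNeg : ∀ k {x} → 0# ≤ x → 0# ≤ term k x
  term-nonNeg k 0≤x = ÷-nonNeg (^-nonNeg k 0≤x) (!-pos k)

  partial-nonNeg : ∀ n {x} → 0# ≤ x → 0# ≤ partial x n
  partial-nonNeg zero    0≤x = ≤-refl
  partial-nonNeg (suc n) 0≤x = +-nonNeg (partial-nonNeg n 0≤x) (term-nonNeg n 0≤x)

  partial-step : ∀ n {x} → 0# ≤ x → partial x n ≤ partial x (suc n)
  partial-step n 0≤x = x≤x+y (term-nonNeg n 0≤x)

  partial-monoⁿ : ∀ {x a b} → 0# ≤ x → a ℕ.≤′ b → partial x a ≤ partial x b
  partial-monoⁿ 0≤x ℕ.≤′-refl              = ≤-refl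
  partial-monoⁿ 0≤x (ℕ.≤′-step {n = n} a≤b) = ≤-trans (partial-monoⁿ 0≤x a≤b) (partial-step n 0≤x)

  module _ {a h : ℝ} (0≤a : 0# ≤ a) (0≤h : 0# ≤ h) where
    private
      b : ℝ
      b = a + h
      0≤b : 0# ≤ b
      0≤b = +-nonNeg 0≤a 0≤h

      drop-cancelled : ∀ x {u v} → u ≡ v → x + h * (u - v) ≡ x
      drop-cancelled x {u} refl = solve 3 (λ x u h → x :+ h :* (u :- u) := x) refl x u h

      increment : ∀ k → fromℕ (suc k) * (term (suc k) b - term (suc k) a) ≡ b * term k b - a * term k a
      increment k = trans (solve 3 (λ A x y → A :* (x :- y) := A :* x :- A :* y) refl (fromℕ (suc k)) _ _)
                          (cong₂ _-_ (term-suc k b) (term-suc k a))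

    -- Mean value bounds: term k is the derivative of term (suc k).
    term-increment-≥ : ∀ k → h * term k a ≤ term (suc k) b - term (suc k) a
    term-increment-≤ : ∀ k → term (suc k) b - term (suc k) a ≤ h * term k b

    term-increment-≥ k = *-cancelˡ-≤ (fromℕ-pos k) (go k)
      where
      go : ∀ k → fromℕ (suc k) * (h * term k a) ≤ fromℕ (suc k) * (term (suc k) b - term (suc k) a)
      go zero = ≤-reflexive (trans (cong (λ t → fromℕ 1 * (h * t)) (term-zero a)) (sym (trans (increment 0)
        (trans (cong₂ (λ s t → b * s - a * t) (term-zero b) (term-zero a))
          (solve 2 (λ a h → (a :+ h) :* one :- a :* one := nat 1 :* (h :* one)) refl a h)))))
      -- The excess of the right side is `a * ((D′ - D) - h * E) + h * (D′ - D)`, nonnegative by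
      -- induction, plus `h * (a * E - k′ * D)`, which vanishes by `term-suc`.
      go (suc k) = subst (fromℕ (suc (suc k)) * (h * term (suc k) a) ≤_) (sym (increment (suc k)))
        (≤-via (+-nonNeg (*-nonNeg 0≤a (x≤y⇒0≤y-x ih))
                         (*-nonNeg 0≤h (≤-trans (*-nonNeg 0≤h (term-nonNeg k 0≤a)) ih)))
          (trans (solve 6 (λ a h D D′ E k′ →
                    ((a :+ h) :* D′ :- a :* D) :- (one :+ k′) :* (h :* D)
                      := ((a :* ((D′ :- D) :- h :* E) :+ h :* (D′ :- D)) :- nat 0) :+ h :* (a :* E :- k′ :* D))
                    refl a h D D′ E k′)
            (drop-cancelled _ (sym (term-suc k a)))))
        where
        D D′ E k′ : ℝ
        D  = term (suc k) a
        D′ = term (suc k) b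
        E  = term k a
        k′ = fromℕ (suc k)
        ih : h * E ≤ D′ - D
        ih = *-cancelˡ-≤ (fromℕ-pos k) (go k)

    term-increment-≤ k = *-cancelˡ-≤ (fromℕ-pos k) (go k)
      where
      go : ∀ k → fromℕ (suc k) * (term (suc k) b - term (suc k) a) ≤ fromℕ (suc k) * (h * term k b)
      go zero = ≤-reflexive (trans (increment 0)
        (trans (cong₂ (λ s t → b * s - a * t) (term-zero b) (term-zero a))
          (trans (solve 2 (λ a h → (a :+ h) :* one :- a :* one := nat 1 :* (h :* one)) refl a h)
            (cong (λ t → fromℕ 1 * (h * t)) (sym (term-zero b))))))
      go (suc k) = subst (_≤ fromℕ (suc (suc k)) * (h * term (suc k) b)) (sym (increment (suc k)))
        (≤-via (+-nonNeg (*-nonNeg 0≤b (x≤y⇒0≤y-x ih))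
                         (*-nonNeg 0≤h (≤-trans (*-nonNeg 0≤h (term-nonNeg k 0≤a)) (term-increment-≥ k))))
          (trans (solve 6 (λ a h D D′ E′ k′ →
                    (one :+ k′) :* (h :* D′) :- ((a :+ h) :* D′ :- a :* D)
                      := (((a :+ h) :* (h :* E′ :- (D′ :- D)) :+ h :* (D′ :- D)) :- nat 0) :+ h :* (k′ :* D′ :- (a :+ h) :* E′))
                    refl a h D D′ E′ k′)
            (drop-cancelled _ (term-suc k b))))
        where
        D D′ E′ k′ : ℝ
        D  = term (suc k) a
        D′ = term (suc k) b
        E′ = term k b
        k′ = fromℕ (suc k)
        ih : D′ - D ≤ h * E′
        ih = *-cancelˡ-≤ (fromℕ-pos k) (go k)

    term-mono-≤ : ∀ k → term k a ≤ term k b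
    term-mono-≤ zero    = ≤-reflexive (trans (term-zero a) (sym (term-zero b)))
    term-mono-≤ (suc k) = 0≤y-x⇒x≤y (≤-trans (*-nonNeg 0≤h (term-nonNeg k 0≤a)) (term-increment-≥ k))

    partial-mono-≤ : ∀ n → partial a n ≤ partial b n
    partial-mono-≤ zero    = ≤-refl
    partial-mono-≤ (suc n) = +-mono-≤ (partial-mono-≤ n) (term-mono-≤ n)

    -- The mean value bounds added up. Differentiation shifts the index, so n + 1 terms of the
    -- series face n terms of its derivative.
    partial-increment-≥ : ∀ n → partial a (suc n) + h * partial a n ≤ partial b (suc n)
    partial-increment-≥ zero    = ≤-reflexive (trans
      (cong (λ t → 0# + t + h * 0#) (trans (term-zero a) (sym (term-zero b))))
      (solve 2 (λ h t → nat 0 :+ t :+ h :* nat 0 := nat 0 :+ t) refl h (term 0 b)))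
    partial-increment-≥ (suc n) = ≤-via (+-mono-≤ (partial-increment-≥ n) (term-increment-≥ n))
      (solve 7 (λ h S D S′ D′ T E →
          (S′ :+ D′) :- ((S :+ D) :+ h :* (T :+ E))
          := (S′ :+ (D′ :- D)) :- ((S :+ h :* T) :+ h :* E))
        refl h (partial a (suc n)) (term (suc n) a) (partial b (suc n)) (term (suc n) b) (partial a n) (term n a))

    partial-increment-≤ : ∀ n → partial b (suc n) ≤ partial a (suc n) + h * partial b n
    partial-increment-≤ zero    = ≤-reflexive (sym (trans
      (cong (λ t → 0# + t + h * 0#) (trans (term-zero a) (sym (term-zero b))))
      (solve 2 (λ h t → nat 0 :+ t :+ h :* nat 0 := nat 0 :+ t) refl h (term 0 b))))
    partial-increment-≤ (suc n) = ≤-via (+-mono-≤ (partial-increment-≤ n) (term-increment-≤ n))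
      (solve 7 (λ h S D S′ D′ T E →
          ((S :+ D) :+ h :* (T :+ E)) :- (S′ :+ D′)
          := ((S :+ h :* T) :+ h :* E) :- (S′ :+ (D′ :- D)))
        refl h (partial a (suc n)) (term (suc n) a) (partial b (suc n)) (term (suc n) b) (partial b n) (term n b))

    -- The truncated form of `1 + h ≤ e^h`. Each use costs one more term on the right, which is
    -- harmless where the right side is bounded for every number of terms.
    partial-grow : ∀ n → (1# + h) * partial a n ≤ partial b (suc n)
    partial-grow n = ≤-trans (≤-via (partial-step n 0≤a)
      (solve 3 (λ h S S′ → (S′ :+ h :* S) :- (one :+ h) :* S := S′ :- S) refl h (partial a n) (partial a (suc n))))
      (partial-increment-≥ n)

    -- The truncated form of `1 - h ≤ e^(-h)`. The number of terms stays the same, because the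
    -- shorter sum at b in the increment bound is at most the longer one.
    partial-shrink : ∀ n → (1# - h) * partial b n ≤ partial a n
    partial-shrink zero    = ≤-reflexive (zeroʳ _)
    partial-shrink (suc n) = ≤-via
      (+-mono-≤ (partial-increment-≤ n) (*-monoʳ-≤ 0≤h (partial-step n 0≤b)))
      (solve 4 (λ h S S′ T → S :- (one :- h) :* S′ := ((S :+ h :* T) :+ h :* S′) :- (S′ :+ h :* T))
        refl h (partial a (suc n)) (partial b (suc n)) (partial b n))

  term-mono : ∀ k {x y} → 0# ≤ x → x ≤ y → term k x ≤ term k y
  term-mono k {x} {y} 0≤x x≤y = subst (λ z → term k x ≤ term k z) (x+[y-x]≡y x y)
    (term-mono-≤ 0≤x (x≤y⇒0≤y-x x≤y) k)

  partial-mono : ∀ n {x y} → 0# ≤ x → x ≤ y → partial x n ≤ partial y n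
  partial-mono n {x} {y} 0≤x x≤y = subst (λ z → partial x n ≤ partial z n) (x+[y-x]≡y x y)
    (partial-mono-≤ 0≤x (x≤y⇒0≤y-x x≤y) n)

  partial-growⁿ : ∀ {x h} → 0# ≤ x → 0# ≤ h → ∀ j n →
    (1# + h) ^ j * partial x n ≤ partial (x + fromℕ j * h) (j ℕ.+ n)
  partial-growⁿ {x} {h} 0≤x 0≤h zero n = ≤-reflexive (trans (*-identityˡ _)
    (cong (λ z → partial z n) (solve 2 (λ x h → x := x :+ nat 0 :* h) refl x h)))
  partial-growⁿ {x} {h} 0≤x 0≤h (suc j) n = begin
    (1# + h) ^ suc j * partial x n                    ≡⟨ *-assoc (1# + h) _ _ ⟩
    (1# + h) * ((1# + h) ^ j * partial x n)           ≤⟨ *-monoʳ-≤ (+-nonNeg 0≤1 0≤h) (partial-growⁿ 0≤x 0≤h j n) ⟩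
    (1# + h) * partial (x + fromℕ j * h) (j ℕ.+ n)    ≤⟨ partial-grow (+-nonNeg 0≤x (*-nonNeg (fromℕ-nonNeg j) 0≤h)) 0≤h (j ℕ.+ n) ⟩
    partial (x + fromℕ j * h + h) (suc j ℕ.+ n)       ≡⟨ cong (λ z → partial z (suc j ℕ.+ n))
        (solve 3 (λ x h k → x :+ k :* h :+ h := x :+ (one :+ k) :* h) refl x h (fromℕ j)) ⟩
    partial (x + fromℕ (suc j) * h) (suc j ℕ.+ n)     ∎
    where open ≤-Reasoning

  partial-0 : ∀ n → partial 0# (suc n) ≡ 1#
  partial-0 zero    = trans (+-identityˡ _) (term-zero 0#)
  partial-0 (suc n) = trans (cong₂ _+_ (partial-0 n)
    (solve 2 (λ z y → (nat 0 :* z) :* y := nat 0) refl (0# ^ n) (fromℕ (suc n !) ⁻¹))) (+-identityʳ 1#)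

  partial-0≤1 : ∀ n → partial 0# n ≤ 1#
  partial-0≤1 zero    = 0≤1
  partial-0≤1 (suc n) = ≤-reflexive (partial-0 n)

  -- Walking back to 0 in j steps of length h, where every partial sum is at most 1. For h < 1 this
  -- is an upper bound on the series that is uniform in n: `e^(jh) ≤ (1 - h)^(-j)`.
  partial-shrinkⁿ : ∀ {h} → 0# ≤ h → h ≤ 1# → ∀ j n → (1# - h) ^ j * partial (fromℕ j * h) n ≤ 1#
  partial-shrinkⁿ {h} 0≤h h≤1 zero n = ≤-trans (≤-reflexive (trans (*-identityˡ _)
    (cong (λ z → partial z n) (zeroˡ h)))) (partial-0≤1 n)
  partial-shrinkⁿ {h} 0≤h h≤1 (suc j) n = begin
    (1# - h) ^ suc j * partial (fromℕ (suc j) * h) n         ≡⟨ cong (λ z → (1# - h) ^ suc j * partial z n)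
        (solve 2 (λ h k → (one :+ k) :* h := k :* h :+ h) refl h (fromℕ j)) ⟩
    (1# - h) ^ suc j * partial (fromℕ j * h + h) n           ≡⟨ solve 3 (λ x y z → (x :* y) :* z := y :* (x :* z)) refl _ _ _ ⟩
    (1# - h) ^ j * ((1# - h) * partial (fromℕ j * h + h) n)  ≤⟨ *-monoʳ-≤ (^-nonNeg j (x≤y⇒0≤y-x h≤1))
                                                                 (partial-shrink (*-nonNeg (fromℕ-nonNeg j) 0≤h) 0≤h n) ⟩
    (1# - h) ^ j * partial (fromℕ j * h) n                   ≤⟨ partial-shrinkⁿ 0≤h h≤1 j n ⟩
    1#                                                       ∎
    where open ≤-Reasoning

  -- Cutting into `suc n` pieces although x is at most n keeps h strictly below 1, so that powers of
  -- `1# - h` are positive; it also covers n = 0.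
  subdivide : ∀ x n → 0# ≤ x → x ≤ fromℕ n → ∃ λ h →
    0# ≤ h × h < 1# × fromℕ (suc n) * h ≡ x
  subdivide x n 0≤x x≤n = x ÷ fromℕ (suc n) , ÷-nonNeg 0≤x (fromℕ-pos n) , h<1 ,
    trans (*-comm _ _) (÷-cancelʳ (fromℕ-nonZero n) x)
    where
    h<1 : x ÷ fromℕ (suc n) < 1#
    h<1 with ≤-or-> 1# (x ÷ fromℕ (suc n))
    ... | inj₂ h<1 = h<1
    ... | inj₁ 1≤h = contradiction
      (≤-trans (subst₂ _≤_ (*-identityˡ _) (÷-cancelʳ (fromℕ-nonZero n) x)
        (*-monoˡ-≤ (fromℕ-nonNeg (suc n)) 1≤h)) x≤n)
      (<⇒≱ (fromℕ-mono-< (ℕ.n<1+n n)))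

  partial-bounded : ∀ x → 0# ≤ x → ∃ λ M → 0# ≤ M × (∀ n → partial x n ≤ M)
  partial-bounded x 0≤x with archimedean x
  ... | N , x≤N with subdivide x N 0≤x x≤N
  ...   | h , 0≤h , h<1 , eq = 1# ÷ P , ÷-nonNeg 0≤1 0<P , λ n → ≤-÷ 0<P
    (≤-trans (≤-reflexive (trans (*-comm _ P) (cong (λ z → P * partial z n) (sym eq))))
      (partial-shrinkⁿ 0≤h (<⇒≤ h<1) (suc N) n))
    where
    P : ℝ
    P = (1# - h) ^ suc N
    0<P : 0# < P
    0<P = ^-pos (suc N) (x<y⇒0<y-x h<1)

  -- The series at negative arguments.

  private
    sign : ℕ → ℝ
    sign zero    = 1#
    sign (suc k) = - sign k

    sign-±1 : ∀ k → sign k ≡ 1# ⊎ sign k ≡ - 1#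
    sign-±1 zero = inj₁ refl
    sign-±1 (suc k) with sign-±1 k
    ... | inj₁ eq = inj₂ (cong -_ eq)
    ... | inj₂ eq = inj₁ (trans (cong -_ eq) (GroupProperties.⁻¹-involutive +-group 1#))

    term-neg : ∀ k x → term k (- x) ≡ sign k * term k x
    term-neg zero x = trans (term-zero (- x)) (sym (trans (*-identityˡ _) (term-zero x)))
    term-neg (suc k) x = begin
      term (suc k) (- x)                    ≡⟨ sym (÷-cancelʳ A≢0 _) ⟩
      (term (suc k) (- x) * A ⁻¹) * A       ≡⟨ solve 3 (λ t i a → (t :* i) :* a := (a :* t) :* i) refl _ (A ⁻¹) A ⟩
      (A * term (suc k) (- x)) * A ⁻¹       ≡⟨ cong (_* A ⁻¹) (trans (term-suc k (- x)) (cong (- x *_) (term-neg k x))) ⟩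
      (- x * (sign k * term k x)) * A ⁻¹    ≡⟨ solve 4 (λ x s t i → ((:- x) :* (s :* t)) :* i := (:- s) :* ((x :* t) :* i)) refl x (sign k) (term k x) (A ⁻¹) ⟩
      - sign k * ((x * term k x) * A ⁻¹)    ≡⟨ cong (λ z → - sign k * (z * A ⁻¹)) (sym (term-suc k x)) ⟩
      - sign k * ((A * term (suc k) x) * A ⁻¹) ≡⟨ cong (- sign k *_) (trans (cong (_* A ⁻¹) (*-comm A _)) (*-cancelʳ A≢0 _)) ⟩
      - sign k * term (suc k) x             ∎
      where
      open ≡-Reasoning
      A : ℝ
      A = fromℕ (suc k)
      A≢0 : A ≢ 0#
      A≢0 = fromℕ-nonZero k

    term-neg-≤ : ∀ k {x} → 0# ≤ x → term k (- x) ≤ term k x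
    term-neg-≤ k {x} 0≤x with sign-±1 k | term-neg k x
    ... | inj₁ s≡ | eq = ≤-reflexive (trans eq (trans (cong (_* term k x) s≡) (*-identityˡ _)))
    ... | inj₂ s≡ | eq = ≤-trans (≤-reflexive (trans eq (cong (_* term k x) s≡)))
      (≤-via (+-nonNeg (term-nonNeg k 0≤x) (term-nonNeg k 0≤x))
        (solve 1 (λ t → t :- (:- one) :* t := (t :+ t) :- nat 0) refl (term k x)))

    module _ {a h : ℝ} (0≤a : 0# ≤ a) (0≤h : 0# ≤ h) where
      private
        b : ℝ
        b = a + h

      -- A first-order expansion at `- a` whose error is h times the variation of `term k` between a
      -- and b. The sign of the derivative alternates with k, so the two cases rest on the two
      -- opposite mean value bounds.
      signed-step : ∀ k s → s ≡ 1# ⊎ s ≡ - 1# →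
        - s * term (suc k) b ≤ - s * term (suc k) a - h * (s * term k a) + h * (term k b - term k a)
      signed-step k _ (inj₁ refl) = ≤-via (+-mono-≤ (term-increment-≥ 0≤a 0≤h k) (*-monoʳ-≤ 0≤h (term-mono-≤ 0≤a 0≤h k)))
        (solve 5 (λ h u v s t →
          ((:- one) :* u :- h :* (one :* s) :+ h :* (t :- s)) :- (:- one) :* v
          := ((v :- u) :+ h :* t) :- (h :* s :+ h :* s)) refl h (term (suc k) a) (term (suc k) b) (term k a) (term k b))
      signed-step k _ (inj₂ refl) = ≤-via (term-increment-≤ 0≤a 0≤h k)
        (solve 5 (λ h u v s t →
          ((:- (:- one)) :* u :- h :* ((:- one) :* s) :+ h :* (t :- s)) :- (:- (:- one)) :* v
          := h :* t :- (v :- u)) refl h (term (suc k) a) (term (suc k) b) (term k a) (term k b))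

      term-neg-step : ∀ k →
        term (suc k) (- b) ≤ term (suc k) (- a) - h * term k (- a) + h * (term k b - term k a)
      term-neg-step k = subst₂ _≤_ (sym (term-neg (suc k) b))
        (cong₂ (λ x y → x - h * y + h * (term k b - term k a)) (sym (term-neg (suc k) a)) (sym (term-neg k a)))
        (signed-step k (sign k) (sign-±1 k))

  module _ {a h : ℝ} (0≤a : 0# ≤ a) (0≤h : 0# ≤ h) where
    private
      c : ℝ
      c = a + h

    partial-neg-step : ∀ n →
      partial (- c) (suc n) ≤ partial (- a) (suc n) - h * partial (- a) n + h * (partial c n - partial a n)
    partial-neg-step zero = ≤-reflexive (trans
      (cong (0# +_) (trans (term-zero (- c)) (sym (term-zero (- a)))))
      (solve 2 (λ h t → nat 0 :+ t := (nat 0 :+ t) :- h :* nat 0 :+ h :* (nat 0 :- nat 0)) refl h (term 0 (- a))))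
    partial-neg-step (suc n) = ≤-via (+-mono-≤ (partial-neg-step n) (term-neg-step 0≤a 0≤h n))
      (shuffle h (partial (- c) (suc n)) (term (suc n) (- c)) (partial (- a) (suc n)) (term (suc n) (- a))
               (partial (- a) n) (term n (- a)) (partial c n - partial a n) (term n c - term n a)
               (solve 4 (λ x y u v → (x :+ y) :- (u :+ v) := (x :- u) :+ (y :- v)) refl (partial c n) (term n c) (partial a n) (term n a)))
      where
      shuffle : ∀ h s t u v p q d e {w} → w ≡ d + e →
        (u + v) - h * (p + q) + h * w - (s + t)
          ≡ ((u - h * p + h * d) + (v - h * q + h * e)) - (s + t)
      shuffle h s t u v p q d e refl = cong (_- (s + t))
        (solve 7 (λ h u v p q d e → (u :+ v) :- h :* (p :+ q) :+ h :* (d :+ e)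
          := (u :- h :* p :+ h :* d) :+ (v :- h :* q :+ h :* e)) refl h u v p q d e)

    -- Both sides now have `suc n` terms, so the step can be iterated. The price is `term n a`; the
    -- differences of partial sums will telescope.
    partial-neg-step′ : ∀ n → partial (- c) (suc n) ≤
      (1# - h) * partial (- a) (suc n) + h * (term n a + (partial c (suc n) - partial a (suc n)))
    partial-neg-step′ n = ≤-trans (partial-neg-step n) (≤-via
      (*-monoʳ-≤ 0≤h (+-mono-≤ (term-neg-≤ n 0≤a) (term-mono-≤ 0≤a 0≤h n)))
      (solve 7 (λ h p q d t f u →
          ((one :- h) :* (p :+ q) :+ h :* (t :+ ((d :+ f) :- (u :+ t)))) :- ((p :+ q) :- h :* p :+ h :* (d :- u))
          := h :* (t :+ f) :- h :* (q :+ t)) refl h (partial (- a) n) (term n (- a)) (partial c n) (term n a) (term n c) (partial a n)))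

  module _ {x h : ℝ} (0≤h : 0# ≤ h) (h≤1 : h ≤ 1#) where
    -- The value 1 at the origin, plus two errors: the telescoped differences, small for small h,
    -- and the accumulated last terms, small for large n.
    partial-negⁿ : ∀ n j → fromℕ j * h ≤ x →
      partial (- (fromℕ j * h)) (suc n) ≤ 1# + h * partial (fromℕ j * h) (suc n) + (fromℕ j * h) * term n x
    partial-negⁿ n zero jh≤x = begin
      partial (- (0# * h)) (suc n)  ≡⟨ cong (λ z → partial z (suc n)) (solve 1 (λ h → :- (nat 0 :* h) := nat 0) refl h) ⟩
      partial 0# (suc n)            ≡⟨ partial-0 n ⟩
      1#                            ≤⟨ x≤x+y (*-nonNeg 0≤h (partial-nonNeg (suc n) (≤-reflexive (sym (zeroˡ h))))) ⟩
      1# + h * partial (0# * h) (suc n) ≤⟨ x≤x+y (≤-reflexive (solve 2 (λ h t → nat 0 := (nat 0 :* h) :* t) refl h (term n x))) ⟩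
      1# + h * partial (0# * h) (suc n) + (0# * h) * term n x ∎
      where open ≤-Reasoning
    partial-negⁿ n (suc j) jh≤x = subst
      (λ z → partial (- z) (suc n) ≤ 1# + h * partial z (suc n) + z * term n x)
      (solve 2 (λ h k → k :* h :+ h := (one :+ k) :* h) refl h (fromℕ j))
      (begin
        partial (- c) (suc n)
          ≤⟨ partial-neg-step′ 0≤a 0≤h n ⟩
        (1# - h) * partial (- a) (suc n) + h * (term n a + (C - A))
          ≤⟨ +-mono-≤ (*-monoʳ-≤ (x≤y⇒0≤y-x h≤1) (partial-negⁿ n j a≤x))
                      (*-monoʳ-≤ 0≤h (+-monoˡ-≤ (C - A) (term-mono n 0≤a a≤x))) ⟩
        (1# - h) * U + h * (T + (C - A))
          -- The decay factor `1# - h` is given away as 1, with slack `h * U`; boundedness is all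
          -- that is wanted, not decay.
          ≤⟨ ≤-via (*-nonNeg 0≤h 0≤U) (solve 5 (λ h a A T C →
               (one :+ h :* C :+ (a :+ h) :* T) :- ((one :- h) :* (one :+ h :* A :+ a :* T) :+ h :* (T :+ (C :- A)))
               := h :* (one :+ h :* A :+ a :* T) :- nat 0) refl h a A T C) ⟩
        1# + h * C + c * T ∎)
      where
      open ≤-Reasoning
      a c A C T U : ℝ
      a = fromℕ j * h
      c = a + h
      A = partial a (suc n)
      C = partial c (suc n)
      T = term n x
      U = 1# + h * A + a * T
      0≤a : 0# ≤ a
      0≤a = *-nonNeg (fromℕ-nonNeg j) 0≤h
      a≤x : a ≤ x
      a≤x = ≤-trans (*-monoˡ-≤ 0≤h (fromℕ-mono-≤ (ℕ.n≤1+n j))) jh≤x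
      0≤U : 0# ≤ U
      0≤U = +-nonNeg (+-nonNeg 0≤1 (*-nonNeg 0≤h (partial-nonNeg (suc n) 0≤a)))
                     (*-nonNeg 0≤a (term-nonNeg n (≤-trans 0≤a a≤x)))

  -- The series alternates at - x, so its partial sums are only bounded
  -- eventually; any bound up to 4 serves for 1≤ln.
  partial-neg-≤3 : ∀ x → 0# ≤ x → ∃ λ n₀ → ∀ n → n₀ ℕ.≤ n → partial (- x) (suc n) ≤ fromℕ 3
  partial-neg-≤3 x 0≤x = suc N₁ , bound
    where
    M : ℝ
    M = proj₁ (partial-bounded x 0≤x)
    0≤M : 0# ≤ M
    0≤M = proj₁ (proj₂ (partial-bounded x 0≤x))
    S≤M : ∀ n → partial x n ≤ M
    S≤M = proj₂ (proj₂ (partial-bounded x 0≤x))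
    0≤xM : 0# ≤ x * M
    0≤xM = *-nonNeg 0≤x 0≤M
    -- Beyond `N₁` the last-term error `x * term n x` is at most 1, and `N₂` makes the step fine
    -- enough for `h * M ≤ 1`; together with the initial 1 this gives the 3. The summand x under
    -- `N₂` is there for `subdivide`.
    N₁ N₂ : ℕ
    N₁ = proj₁ (archimedean (x * (x * M)))
    N₂ = proj₁ (archimedean (x + x * M))
    small : x + x * M ≤ fromℕ N₂
    small = proj₂ (archimedean (x + x * M))
    subdivision : ∃ λ h → 0# ≤ h × h < 1# × fromℕ (suc N₂) * h ≡ x
    subdivision = subdivide x N₂ 0≤x (≤-trans (x≤x+y 0≤xM) small)
    h : ℝ
    h = proj₁ subdivision
    0≤h : 0# ≤ h
    0≤h = proj₁ (proj₂ subdivision)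
    h<1 : h < 1#
    h<1 = proj₁ (proj₂ (proj₂ subdivision))
    kh≡x : fromℕ (suc N₂) * h ≡ x
    kh≡x = proj₂ (proj₂ (proj₂ subdivision))

    hM≤1 : h * M ≤ 1#
    hM≤1 = *-cancelˡ-≤ (fromℕ-pos N₂) (begin
      fromℕ (suc N₂) * (h * M)  ≡⟨ sym (*-assoc _ h M) ⟩
      fromℕ (suc N₂) * h * M    ≡⟨ cong (_* M) kh≡x ⟩
      x * M                     ≤⟨ ≤-trans (x≤x+y 0≤x) (≤-reflexive (+-comm (x * M) x)) ⟩
      x + x * M                 ≤⟨ small ⟩
      fromℕ N₂                  ≤⟨ fromℕ-mono-≤ (ℕ.n≤1+n N₂) ⟩
      fromℕ (suc N₂)            ≡⟨ sym (*-identityʳ _) ⟩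
      fromℕ (suc N₂) * 1#       ∎)
      where open ≤-Reasoning

    xT≤1 : ∀ n → suc N₁ ℕ.≤ n → x * term n x ≤ 1#
    xT≤1 (suc n) N₁<n = *-cancelˡ-≤ (fromℕ-pos n) (begin
      fromℕ (suc n) * (x * term (suc n) x)   ≡⟨ solve 3 (λ x y z → x :* (y :* z) := y :* (x :* z)) refl _ x _ ⟩
      x * (fromℕ (suc n) * term (suc n) x)   ≡⟨ cong (x *_) (term-suc n x) ⟩
      x * (x * term n x)                     ≤⟨ *-monoʳ-≤ 0≤x (*-monoʳ-≤ 0≤x (≤-trans term≤partial (S≤M (suc n)))) ⟩
      x * (x * M)                            ≤⟨ proj₂ (archimedean (x * (x * M))) ⟩
      fromℕ N₁                               ≤⟨ fromℕ-mono-≤ (ℕ.≤-trans (ℕ.n≤1+n N₁) N₁<n) ⟩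
      fromℕ (suc n)                          ≡⟨ sym (*-identityʳ _) ⟩
      fromℕ (suc n) * 1#                     ∎)
      where
      open ≤-Reasoning
      term≤partial : term n x ≤ partial x (suc n)
      term≤partial = ≤-trans (x≤x+y (partial-nonNeg n 0≤x)) (≤-reflexive (+-comm _ _))

    bound : ∀ n → suc N₁ ℕ.≤ n → partial (- x) (suc n) ≤ fromℕ 3
    bound n N₁<n = begin
      partial (- x) (suc n)
        ≤⟨ subst (λ z → partial (- z) (suc n) ≤ 1# + h * partial z (suc n) + z * term n x) kh≡x
             (partial-negⁿ 0≤h (<⇒≤ h<1) n (suc N₂) (≤-reflexive kh≡x)) ⟩
      1# + h * partial x (suc n) + x * term n x
        ≤⟨ +-mono-≤ (+-monoʳ-≤ 1# (≤-trans (*-monoʳ-≤ 0≤h (S≤M (suc n))) hM≤1)) (xT≤1 n N₁<n) ⟩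
      1# + 1# + 1#
        ≡⟨ solve 0 (one :+ one :+ one := nat 3) refl ⟩
      fromℕ 3 ∎
      where open ≤-Reasoning

  -- e^x ≥ v, stated for the exponential series.
  ExpAtLeast : ℝ → ℝ → Set
  ExpAtLeast x v = ∀ B → (∀ n → partial x n ≤ B) → v ≤ B

  limit⇒ExpAtLeast : ∀ {x y} → expSum x ⟶ y → ExpAtLeast x y
  limit⇒ExpAtLeast {x} e⟶y B bound = limit-≤ 0 e⟶y λ n _ →
    ≤-trans (≤-reflexive (expSum≡partial x n)) (bound (suc n))

  partial≤limit : ∀ {x y} → 0# ≤ x → expSum x ⟶ y → ∀ n → partial x n ≤ y
  partial≤limit {x} 0≤x e⟶y n = limit-≥ n e⟶y λ k n≤k →
    ≤-trans (partial-monoⁿ 0≤x (ℕ.≤⇒≤′ (ℕ.≤-trans n≤k (ℕ.n≤1+n k))))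
            (≤-reflexive (sym (expSum≡partial x k)))

  -- By `partial-grow`, a bound B on the series at `x + h` gives the bound `B ÷ (1# + h)` at x.
  ExpAtLeast-grow : ∀ {x v h} → 0# ≤ x → 0# ≤ h → ExpAtLeast x v → ExpAtLeast (x + h) ((1# + h) * v)
  ExpAtLeast-grow {x} {v} {h} 0≤x 0≤h e≥v B bound =
    ≤-trans (*-monoʳ-≤ (<⇒≤ 0<1+h) (e≥v (B ÷ (1# + h)) λ n → ≤-÷ 0<1+h
      (≤-trans (≤-reflexive (*-comm _ _)) (≤-trans (partial-grow 0≤x 0≤h n) (bound (suc n))))))
      (≤-reflexive (trans (*-comm _ _) (÷-cancelʳ (>⇒≢0 0<1+h) B)))
    where
    0<1+h : 0# < 1# + h
    0<1+h = <-≤-trans 0<1 (x≤x+y 0≤h)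

  -- Bounds on the logarithm.

  module LogarithmProperties (logarithm : Logarithm) where
    open Logarithm logarithm

    -- Two shrinking steps of length 1/2 give `(1/2)² e ≤ 1`. The crude 4 in place of e suffices,
    -- since δ < 1/4 means 1/δ > 4.
    partial-1≤4 : ∀ n → partial 1# n ≤ fromℕ 4
    partial-1≤4 n = begin
      partial 1# n                                             ≡⟨ cong (λ z → partial z n) (sym 2h≡1) ⟩
      S                                                        ≡⟨ solve 1 (λ s → s := (nat 2 :- one) :* (nat 2 :- one) :* s) refl S ⟩
      (fromℕ 2 - 1#) * (fromℕ 2 - 1#) * S                      ≡⟨ cong (λ z → (fromℕ 2 - z) * (fromℕ 2 - z) * S) (sym 2h≡1) ⟩
      (fromℕ 2 - fromℕ 2 * h) * (fromℕ 2 - fromℕ 2 * h) * S    ≡⟨ solve 2 (λ h s → (nat 2 :- nat 2 :* h) :* (nat 2 :- nat 2 :* h) :* s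
                                                                    := nat 4 :* (((one :- h) :* ((one :- h) :* one)) :* s)) refl h S ⟩
      fromℕ 4 * ((1# - h) ^ 2 * S)                             ≤⟨ *-monoʳ-≤ (fromℕ-nonNeg 4) (partial-shrinkⁿ 0≤h h≤1 2 n) ⟩
      fromℕ 4 * 1#                                             ≡⟨ *-identityʳ _ ⟩
      fromℕ 4                                                  ∎
      where
      open ≤-Reasoning
      h S : ℝ
      h = 1# ÷ fromℕ 2
      S = partial (fromℕ 2 * h) n
      2h≡1 : fromℕ 2 * h ≡ 1#
      2h≡1 = trans (*-comm _ _) (÷-cancelʳ (fromℕ-nonZero 1) 1#)
      0≤h : 0# ≤ h
      0≤h = ÷-nonNeg 0≤1 (fromℕ-pos 1)
      h≤1 : h ≤ 1#
      h≤1 = ≤-trans (≤-trans (x≤x+y 0≤h)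
        (≤-reflexive (solve 1 (λ h → h :+ h := nat 2 :* h) refl h))) (≤-reflexive 2h≡1)

    -- A smaller value of `ln y` would keep the series there eventually below 4, and with it the
    -- limit y. A nonnegative value is compared with 1; a negative one needs the bound for the
    -- alternating series.
    1≤ln : ∀ {y} → fromℕ 4 < y → 1# ≤ ln y
    1≤ln {y} 4<y with ≤-or-> 1# (ln y)
    ... | inj₁ 1≤ln = 1≤ln
    ... | inj₂ ln<1 = contradiction y≤4 (<⇒≱ 4<y)
      where
      exp-ln-y : expSum (ln y) ⟶ y
      exp-ln-y = exp-ln y (≤-<-trans (fromℕ-nonNeg 4) 4<y)
      y≤4 : y ≤ fromℕ 4
      y≤4 with ≤-total 0# (ln y)
      ... | inj₁ 0≤ln = limit-≤ 0 exp-ln-y λ n _ → ≤-trans (≤-reflexive (expSum≡partial (ln y) n))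
        (≤-trans (partial-mono (suc n) 0≤ln (<⇒≤ ln<1)) (partial-1≤4 (suc n)))
      ... | inj₂ ln≤0 = eventually (partial-neg-≤3 (- ln y) (≤-via ln≤0 (solve 1 (λ x → (:- x) :- nat 0 := nat 0 :- x) refl (ln y))))
        where
        eventually : (∃ λ n₀ → ∀ n → n₀ ℕ.≤ n → partial (- (- ln y)) (suc n) ≤ fromℕ 3) → y ≤ fromℕ 4
        eventually (n₀ , bound) = limit-≤ n₀ exp-ln-y λ n n₀≤n → ≤-trans (≤-reflexive (trans (expSum≡partial (ln y) n)
          (cong (λ z → partial z (suc n)) (sym (GroupProperties.⁻¹-involutive +-group (ln y))))))
          (≤-trans (bound n n₀≤n) (fromℕ-mono-≤ {3} {4} (ℕ.n≤1+n 3)))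

    -- If the two logarithms differed by h > 1, growth would give `(1 + h) y ≤ 2 y`. This reduces
    -- ln(2/δ) to ln(1/δ) in the sample size.
    ln-double : ∀ {y} → fromℕ 4 < y → ln (fromℕ 2 * y) ≤ ln y + 1#
    ln-double {y} 4<y with ≤-or-> (ln (fromℕ 2 * y)) (ln y + 1#)
    ... | inj₁ b≤a+1 = b≤a+1
    ... | inj₂ a+1<b = contradiction
      (*-cancelʳ-≤ 0<y 
        (ExpAtLeast-grow 0≤a 0≤b-a (limit⇒ExpAtLeast (exp-ln y 0<y)) (fromℕ 2 * y)
          (subst (λ z → ∀ n → partial z n ≤ fromℕ 2 * y) (sym (x+[y-x]≡y a b))
            (partial≤limit 0≤b (exp-ln (fromℕ 2 * y) (*-pos (fromℕ-pos 1) 0<y))))))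
      (<⇒≱ (<-via a+1<b (solve 2 (λ a b → (one :+ (b :- a)) :- nat 2 := b :- (a :+ one)) refl a b)))
      where
      a b : ℝ
      a = ln y
      b = ln (fromℕ 2 * y)
      0<y : 0# < y
      0<y = ≤-<-trans (fromℕ-nonNeg 4) 4<y
      0≤a : 0# ≤ a
      0≤a = ≤-trans 0≤1 (1≤ln 4<y)
      0≤b-a : 0# ≤ b - a
      0≤b-a = x≤y⇒0≤y-x (≤-trans (x≤x+y 0≤1) (<⇒≤ a+1<b))
      0≤b : 0# ≤ b
      0≤b = ≤-trans (+-nonNeg 0≤a 0≤1) (<⇒≤ a+1<b)

-- Hoeffding's exponent without an exponential function.

module Hoeffding (F : CompleteOrderedField) where
  open Reals F
  open OrderedFieldProperties orderedField
  open RealProperties F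
  open Exponential F

  -- Shifted against the usual indexing: the value is `0 + 1 + ... + (n - 1)`, the exponent
  -- collected from the ratio bounds below n.
  triangular : ℕ → ℕ
  triangular zero    = 0
  triangular (suc n) = n ℕ.+ triangular n

  2triangular≤n² : ∀ n → fromℕ 2 * fromℕ (triangular n) ≤ fromℕ n * fromℕ n
  2triangular≤n² zero    = ≤-reflexive (solve 0 (nat 2 :* nat 0 := nat 0 :* nat 0) refl)
  2triangular≤n² (suc n) = begin
    fromℕ 2 * fromℕ (n ℕ.+ triangular n)              ≡⟨ cong (fromℕ 2 *_) (fromℕ-+ n (triangular n)) ⟩
    fromℕ 2 * (fromℕ n + fromℕ (triangular n))        ≤⟨ ≤-via (+-mono-≤ (2triangular≤n² n) 0≤1)
        (solve 2 (λ n t → (one :+ n) :* (one :+ n) :- nat 2 :* (n :+ t) := (n :* n :+ one) :- (nat 2 :* t :+ nat 0))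
          refl (fromℕ n) (fromℕ (triangular n))) ⟩
    fromℕ (suc n) * fromℕ (suc n)                     ∎
    where open ≤-Reasoning

  module _ {p h r : ℝ} (0≤p : 0# ≤ p) (p≤1 : p ≤ 1#) (0≤h : 0# ≤ h) (4r≡h² : fromℕ 4 * r ≡ h * h) where
    private
      0≤1-p : 0# ≤ 1# - p
      0≤1-p = x≤y⇒0≤y-x p≤1

      1≤1+h : 1# ≤ 1# + h
      1≤1+h = x≤x+y 0≤h

      0≤r : 0# ≤ r
      0≤r = *-cancelˡ-≤ (fromℕ-pos 3) (≤-trans (≤-reflexive (zeroʳ _))
        (≤-trans (square-nonNeg h) (≤-reflexive (sym 4r≡h²))))

    mgf : ℕ → ℝ
    mgf j = (1# - p) + p * (1# + h) ^ j

    1≤mgf : ∀ j → 1# ≤ mgf j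
    1≤mgf j = ≤-via (*-monoʳ-≤ 0≤p (1≤x^n j 1≤1+h))
      (solve 2 (λ p q → ((one :- p) :+ p :* q) :- one := p :* q :- p :* one) refl p ((1# + h) ^ j))

    0<mgf : ∀ j → 0# < mgf j
    0<mgf j = <-≤-trans 0<1 (1≤mgf j)

    -- The discrete form of (log mgf)″ ≤ 1/4.
    mgf-log-convexity : ∀ j → mgf (suc (suc j)) * mgf j ≤ (1# + r) * (mgf (suc j) * mgf (suc j))
    mgf-log-convexity j = ≤-via
      -- With `b = p (1 + h) w` the defect is `r (a + b)² - a p w h²`. Since
      -- `(a + b)² = (a - b)² + 4 a b`, the choice `4 r = h²` cancels the negative term and leaves
      -- the two summands here.
      (+-nonNeg (*-nonNeg 0≤r (square-nonNeg (a - p * ((1# + h) * w))))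
                (*-nonNeg 0≤r (*-nonNeg (fromℕ-nonNeg 4) (*-nonNeg (*-nonNeg 0≤1-p (*-nonNeg 0≤p 0≤w)) 0≤h))))
      (trans (solve 5 (λ a p w h r →
          (one :+ r) :* ((a :+ p :* ((one :+ h) :* w)) :* (a :+ p :* ((one :+ h) :* w)))
            :- (a :+ p :* ((one :+ h) :* ((one :+ h) :* w))) :* (a :+ p :* w)
          := (r :* ((a :- p :* ((one :+ h) :* w)) :* (a :- p :* ((one :+ h) :* w)))
               :+ r :* (nat 4 :* ((a :* (p :* w)) :* h)))
             :- nat 0 :+ (a :* (p :* w)) :* (nat 4 :* r :- h :* h)) refl a p w h r)
        (drop _ (a * (p * w)) 4r≡h²))
      where
      a w : ℝ
      a = 1# - p
      w = (1# + h) ^ j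
      0≤w : 0# ≤ w
      0≤w = ≤-trans 0≤1 (1≤x^n j 1≤1+h)
      drop : ∀ x c {u v} → u ≡ v → x + c * (u - v) ≡ x
      drop x c {u} refl = solve 3 (λ x c u → x :+ c :* (u :- u) := x) refl x c u

    -- Log-convexity lets the ratio of neighbours grow by at most `1# + r` per step, and the initial
    -- ratio is `1# + p * h`.
    mgf-ratio : ∀ j → mgf (suc j) ≤ (1# + r) ^ j * (1# + p * h) * mgf j
    mgf-ratio zero = ≤-reflexive (solve 2 (λ p h →
      (one :- p) :+ p :* ((one :+ h) :* one) := one :* (one :+ p :* h) :* ((one :- p) :+ p :* one)) refl p h)
    mgf-ratio (suc j) = *-cancelʳ-≤ (0<mgf j) (begin
      mgf (suc (suc j)) * mgf j                                  ≤⟨ mgf-log-convexity j ⟩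
      (1# + r) * (G * G)                                         ≤⟨ *-monoʳ-≤ (+-nonNeg 0≤1 0≤r)
                                                                      (*-monoʳ-≤ (<⇒≤ (0<mgf (suc j))) (mgf-ratio j)) ⟩
      (1# + r) * (G * ((1# + r) ^ j * (1# + p * h) * mgf j))     ≡⟨ solve 5 (λ ρ G x c g → ρ :* (G :* (x :* c :* g)) := (ρ :* x) :* c :* G :* g)
                                                                      refl (1# + r) G ((1# + r) ^ j) (1# + p * h) (mgf j) ⟩
      (1# + r) ^ suc j * (1# + p * h) * G * mgf j                ∎)
      where
      open ≤-Reasoning
      G : ℝ
      G = mgf (suc j)

    mgf-≤ : ∀ n → mgf n ≤ (1# + p * h) ^ n * (1# + r) ^ triangular n
    mgf-≤ zero = ≤-reflexive (solve 1 (λ p → (one :- p) :+ p :* one := one :* one) refl p)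
    mgf-≤ (suc n) = begin
      mgf (suc n)                                        ≤⟨ mgf-ratio n ⟩
      ρ ^ n * c * mgf n                                  ≤⟨ *-monoʳ-≤ (*-nonNeg (^-nonNeg n (+-nonNeg 0≤1 0≤r))
                                                              (+-nonNeg 0≤1 (*-nonNeg 0≤p 0≤h))) (mgf-≤ n) ⟩
      ρ ^ n * c * (c ^ n * ρ ^ triangular n)             ≡⟨ solve 4 (λ x c y z → x :* c :* (y :* z) := (c :* y) :* (x :* z)) refl (ρ ^ n) c (c ^ n) _ ⟩
      c ^ suc n * (ρ ^ n * ρ ^ triangular n)             ≡⟨ cong (c ^ suc n *_) (sym (^-homo-* ρ n (triangular n))) ⟩
      c ^ suc n * ρ ^ triangular (suc n)                 ∎
      where
      open ≤-Reasoning
      ρ c : ℝ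
      ρ = 1# + r
      c = 1# + p * h

  -- Chernoff's method with the tilt e^(4t) replaced by z = (1 + 4t/n)^n.
  chernoff : ∀ {p t X v} m → 0# ≤ p → p ≤ 1# → 0# ≤ t → 0# ≤ X → X ≤ fromℕ 2 * (fromℕ m * (t * t)) →
    ExpAtLeast X v → ∃ λ z → 1# ≤ z ×
      v * ((1# - p) + p * z) ^ m ≤ fromℕ 2 * z ^ ⌈ fromℕ m * (p + t) ⌉
  chernoff {p} {t} {X} {v} m 0≤p p≤1 0≤t 0≤X X≤ X≥v =
    (1# + h) ^ n , 1≤x^n n (x≤x+y 0≤h) , (begin
      v * G ^ m                     ≤⟨ *-monoˡ-≤ (<⇒≤ 0<G^m) (X≥v (fromℕ 2 * Q ÷ G ^ m) λ N → ≤-÷ 0<G^m (bound N)) ⟩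
      (fromℕ 2 * Q ÷ G ^ m) * G ^ m ≡⟨ ÷-cancelʳ (>⇒≢0 0<G^m) _ ⟩
      fromℕ 2 * Q                   ≡⟨ cong (fromℕ 2 *_) (sym (^-assocʳ (1# + h) n k)) ⟩
      fromℕ 2 * ((1# + h) ^ n) ^ k  ∎)
    where
    open ≤-Reasoning
    s : ℝ
    s = fromℕ 4 * t
    0≤s : 0# ≤ s
    0≤s = *-nonNeg (fromℕ-nonNeg 4) 0≤t
    -- The event "at least m (p + t) ones" means at least k ones. In `N₀` the summand s serves
    -- `subdivide`, and the other forces `2 k s² ≤ n`, that is `2 n k h² ≤ 1`; this limits the loss
    -- to the factor 2.
    k N₀ n : ℕ
    k  = ⌈ fromℕ m * (p + t) ⌉
    N₀ = proj₁ (archimedean (s + fromℕ 2 * (s * (fromℕ k * s))))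
    n  = suc N₀
    0≤2sks : 0# ≤ fromℕ 2 * (s * (fromℕ k * s))
    0≤2sks = *-nonNeg (fromℕ-nonNeg 2) (*-nonNeg 0≤s (*-nonNeg (fromℕ-nonNeg k) 0≤s))
    s+2sks≤N₀ : s + fromℕ 2 * (s * (fromℕ k * s)) ≤ fromℕ N₀
    s+2sks≤N₀ = proj₂ (archimedean (s + fromℕ 2 * (s * (fromℕ k * s))))
    2sks≤n : fromℕ 2 * (s * (fromℕ k * s)) ≤ fromℕ n
    2sks≤n = ≤-trans (≤-trans (x≤x+y 0≤s) (≤-reflexive (+-comm _ s)))
      (≤-trans s+2sks≤N₀ (fromℕ-mono-≤ (ℕ.n≤1+n N₀)))
    subdivision : ∃ λ h → 0# ≤ h × h < 1# × fromℕ n * h ≡ s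
    subdivision = subdivide s N₀ 0≤s (≤-trans (x≤x+y 0≤2sks) s+2sks≤N₀)
    h r : ℝ
    h = proj₁ subdivision
    r = h * h ÷ fromℕ 4
    0≤h : 0# ≤ h
    0≤h = proj₁ (proj₂ subdivision)
    h<1 : h < 1#
    h<1 = proj₁ (proj₂ (proj₂ subdivision))
    nh≡s : fromℕ n * h ≡ s
    nh≡s = proj₂ (proj₂ (proj₂ subdivision))
    4r≡h² : fromℕ 4 * r ≡ h * h
    4r≡h² = trans (*-comm _ r) (÷-cancelʳ (fromℕ-nonZero 3) (h * h))
    0≤r : 0# ≤ r
    0≤r = ÷-nonNeg (square-nonNeg h) (fromℕ-pos 3)
    G P Q : ℝ
    G = mgf 0≤p p≤1 0≤h 4r≡h² n
    P = (1# - h) ^ (n ℕ.* k)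
    Q = (1# + h) ^ (n ℕ.* k)
    0<P : 0# < P
    0<P = ^-pos (n ℕ.* k) (x<y⇒0<y-x h<1)
    0<G^m : 0# < G ^ m
    0<G^m = ^-pos m (0<mgf 0≤p p≤1 0≤h 4r≡h² n)
    T : ℕ
    T = triangular n

    -- `Q` bounds the exponential at `n k h` from below and `1 / P` from above; by Bernoulli's
    -- inequality for `(1 - h²)^(nk)` they differ by at most the factor 2.
    1≤2PQ : 1# ≤ fromℕ 2 * (P * Q)
    1≤2PQ = begin
      1#                                              ≤⟨ ≤-via 2nkh²≤1 (solve 2 (λ c x → nat 2 :* (one :- c :* x) :- one := one :- nat 2 :* (c :* x))
                                                           refl (fromℕ (n ℕ.* k)) (h * h)) ⟩
      fromℕ 2 * (1# - fromℕ (n ℕ.* k) * (h * h))      ≤⟨ *-monoʳ-≤ (fromℕ-nonNeg 2) (bernoulli (n ℕ.* k) (square-nonNeg h)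
                                                           (≤-trans (*-mono-≤ 0≤1 0≤h (<⇒≤ h<1) (<⇒≤ h<1)) (≤-reflexive (*-identityˡ 1#)))) ⟩
      fromℕ 2 * (1# - h * h) ^ (n ℕ.* k)              ≡⟨ cong (λ x → fromℕ 2 * x ^ (n ℕ.* k)) (solve 1 (λ h → one :- h :* h := (one :- h) :* (one :+ h)) refl h) ⟩
      fromℕ 2 * ((1# - h) * (1# + h)) ^ (n ℕ.* k)     ≡⟨ cong (fromℕ 2 *_) (^-distrib-* (1# - h) (1# + h) (n ℕ.* k)) ⟩
      fromℕ 2 * (P * Q)                               ∎
      where
      2nkh²≤1 : fromℕ 2 * (fromℕ (n ℕ.* k) * (h * h)) ≤ 1#
      2nkh²≤1 = *-cancelˡ-≤ (fromℕ-pos N₀) (begin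
        fromℕ n * (fromℕ 2 * (fromℕ (n ℕ.* k) * (h * h)))           ≡⟨ cong (λ x → fromℕ n * (fromℕ 2 * (x * (h * h)))) (fromℕ-* n k) ⟩
        fromℕ n * (fromℕ 2 * ((fromℕ n * fromℕ k) * (h * h)))       ≡⟨ solve 3 (λ n k h → n :* (nat 2 :* ((n :* k) :* (h :* h)))
                                                                         := nat 2 :* ((n :* h) :* (k :* (n :* h)))) refl (fromℕ n) (fromℕ k) h ⟩
        fromℕ 2 * ((fromℕ n * h) * (fromℕ k * (fromℕ n * h)))       ≡⟨ cong (λ x → fromℕ 2 * (x * (fromℕ k * x))) nh≡s ⟩
        fromℕ 2 * (s * (fromℕ k * s))                               ≤⟨ 2sks≤n ⟩
        fromℕ n                                                     ≡⟨ sym (*-identityʳ _) ⟩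
        fromℕ n * 1#                                                ∎)

    exponent : ℝ
    exponent = X + fromℕ (n ℕ.* m) * (p * h) + fromℕ (T ℕ.* m) * r

    -- The tilt `s = 4 t` is the one that balances Hoeffding's exponent:
    -- `2 m t² + m p s + m s² / 8 = s m (p + t)`. Rounding up to k only enlarges the right side.
    exponent≤ : exponent ≤ fromℕ (n ℕ.* k) * h
    exponent≤ = begin
      X + fromℕ (n ℕ.* m) * (p * h) + fromℕ (T ℕ.* m) * r
        ≡⟨ cong₂ (λ x y → X + x * (p * h) + y * r) (fromℕ-* n m) (fromℕ-* T m) ⟩
      X + (fromℕ n * fromℕ m) * (p * h) + (fromℕ T * fromℕ m) * r
        ≡⟨ solve 7 (λ X n m p h T r → X :+ (n :* m) :* (p :* h) :+ (T :* m) :* r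
             := X :+ m :* (p :* (n :* h)) :+ m :* (T :* r)) refl X (fromℕ n) (fromℕ m) p h (fromℕ T) r ⟩
      X + fromℕ m * (p * (fromℕ n * h)) + fromℕ m * (fromℕ T * r)
        ≤⟨ +-mono-≤ (+-mono-≤ X≤ (≤-reflexive (cong (λ x → fromℕ m * (p * x)) nh≡s))) (*-monoʳ-≤ (fromℕ-nonNeg m) Tr≤2t²) ⟩
      fromℕ 2 * (fromℕ m * (t * t)) + fromℕ m * (p * s) + fromℕ m * (fromℕ 2 * (t * t))
        ≡⟨ solve 3 (λ m p t → nat 2 :* (m :* (t :* t)) :+ m :* (p :* (nat 4 :* t)) :+ m :* (nat 2 :* (t :* t))
             := (nat 4 :* t) :* (m :* (p :+ t))) refl (fromℕ m) p t ⟩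
      s * (fromℕ m * (p + t))
        ≤⟨ *-monoʳ-≤ 0≤s (x≤⌈x⌉ (fromℕ m * (p + t))) ⟩
      s * fromℕ k
        ≡⟨ cong (_* fromℕ k) (sym nh≡s) ⟩
      fromℕ n * h * fromℕ k
        ≡⟨ solve 3 (λ n h k → n :* h :* k := (n :* k) :* h) refl (fromℕ n) h (fromℕ k) ⟩
      fromℕ n * fromℕ k * h
        ≡⟨ cong (_* h) (sym (fromℕ-* n k)) ⟩
      fromℕ (n ℕ.* k) * h ∎
      where
      Tr≤2t² : fromℕ T * r ≤ fromℕ 2 * (t * t)
      Tr≤2t² = *-cancelˡ-≤ (fromℕ-pos 7) (begin
        fromℕ 8 * (fromℕ T * r)                  ≡⟨ solve 2 (λ T r → nat 8 :* (T :* r) := (nat 2 :* T) :* (nat 4 :* r)) refl (fromℕ T) r ⟩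
        (fromℕ 2 * fromℕ T) * (fromℕ 4 * r)      ≡⟨ cong (fromℕ 2 * fromℕ T *_) 4r≡h² ⟩
        (fromℕ 2 * fromℕ T) * (h * h)            ≤⟨ *-monoˡ-≤ (square-nonNeg h) (2triangular≤n² n) ⟩
        (fromℕ n * fromℕ n) * (h * h)            ≡⟨ solve 2 (λ n h → (n :* n) :* (h :* h) := (n :* h) :* (n :* h)) refl (fromℕ n) h ⟩
        (fromℕ n * h) * (fromℕ n * h)            ≡⟨ cong (λ x → x * x) nh≡s ⟩
        s * s                                    ≡⟨ solve 1 (λ t → (nat 4 :* t) :* (nat 4 :* t) := nat 8 :* (nat 2 :* (t :* t))) refl t ⟩
        fromℕ 8 * (fromℕ 2 * (t * t))            ∎)

    -- Every factor `1 + p h` and `1 + r` is absorbed into the argument of the series, so a single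
    -- partial sum remains; `P` then trades it for `Q`.
    bound : ∀ N → partial X N * G ^ m ≤ fromℕ 2 * Q
    bound N = begin
      partial X N * G ^ m
        ≤⟨ *-monoʳ-≤ (partial-nonNeg N 0≤X) (^-mono-≤ m (<⇒≤ (0<mgf 0≤p p≤1 0≤h 4r≡h² n)) (mgf-≤ 0≤p p≤1 0≤h 4r≡h² n)) ⟩
      partial X N * (c ^ n * ρ ^ T) ^ m
        ≡⟨ cong (partial X N *_) (trans (^-distrib-* (c ^ n) (ρ ^ T) m) (cong₂ _*_ (^-assocʳ c n m) (^-assocʳ ρ T m))) ⟩
      partial X N * (c ^ (n ℕ.* m) * ρ ^ (T ℕ.* m))
        ≡⟨ solve 3 (λ x y z → x :* (y :* z) := z :* (y :* x)) refl (partial X N) _ _ ⟩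
      ρ ^ (T ℕ.* m) * (c ^ (n ℕ.* m) * partial X N)
        ≤⟨ *-monoʳ-≤ (^-nonNeg (T ℕ.* m) (+-nonNeg 0≤1 0≤r)) (partial-growⁿ 0≤X 0≤ph (n ℕ.* m) N) ⟩
      ρ ^ (T ℕ.* m) * partial (X + fromℕ (n ℕ.* m) * (p * h)) (n ℕ.* m ℕ.+ N)
        ≤⟨ partial-growⁿ (+-nonNeg 0≤X (*-nonNeg (fromℕ-nonNeg (n ℕ.* m)) 0≤ph)) 0≤r (T ℕ.* m) (n ℕ.* m ℕ.+ N) ⟩
      partial exponent N′
        ≤⟨ partial-mono N′ (+-nonNeg (+-nonNeg 0≤X (*-nonNeg (fromℕ-nonNeg (n ℕ.* m)) 0≤ph))
             (*-nonNeg (fromℕ-nonNeg (T ℕ.* m)) 0≤r)) exponent≤ ⟩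
      partial (fromℕ (n ℕ.* k) * h) N′
        ≤⟨ *-cancelˡ-≤ 0<P (≤-trans (≤-trans (partial-shrinkⁿ 0≤h (<⇒≤ h<1) (n ℕ.* k) N′) 1≤2PQ)
             (≤-reflexive (solve 2 (λ P Q → nat 2 :* (P :* Q) := P :* (nat 2 :* Q)) refl P Q))) ⟩
      fromℕ 2 * Q ∎
      where
      c ρ : ℝ
      c = 1# + p * h
      ρ = 1# + r
      N′ : ℕ
      N′ = T ℕ.* m ℕ.+ (n ℕ.* m ℕ.+ N)
      0≤ph : 0# ≤ p * h
      0≤ph = *-nonNeg 0≤p 0≤h

-- Independent samples and their tail bounds.

module Sampling (F : CompleteOrderedField) where
  open Reals F
  open Protocols F
  open OrderedFieldProperties orderedField
  open RealProperties F
  open Exponential F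
  open Hoeffding F

  module _ {n : ℕ} (D : Distribution n) where
    open Distribution D

    𝔼-cong : ∀ {h k : Fin n → ℝ} → (∀ i → h i ≡ k i) → 𝔼 D h ≡ 𝔼 D k
    𝔼-cong h≗k = sum-cong λ i → cong (weight i *_) (h≗k i)

    𝔼-mono-≤ : ∀ {h k : Fin n → ℝ} → (∀ i → h i ≤ k i) → 𝔼 D h ≤ 𝔼 D k
    𝔼-mono-≤ h≤k = sum-mono-≤ λ i → *-monoʳ-≤ (weight-nonNeg i) (h≤k i)

    𝔼-const : ∀ c → 𝔼 D (λ _ → c) ≡ c
    𝔼-const c = trans (sum-distribʳ weight c) (trans (cong (_* c) weight-total) (*-identityˡ c))

    𝔼-+ : ∀ (h k : Fin n → ℝ) → 𝔼 D (λ i → h i + k i) ≡ 𝔼 D h + 𝔼 D k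
    𝔼-+ h k = trans (sum-cong λ i → distribˡ (weight i) (h i) (k i)) (sum-distrib-+ (λ i → weight i * h i) (λ i → weight i * k i))

    𝔼-*ʳ : ∀ (h : Fin n → ℝ) c → 𝔼 D (λ i → h i * c) ≡ 𝔼 D h * c
    𝔼-*ʳ h c = trans (sum-cong λ i → sym (*-assoc (weight i) (h i) c)) (sum-distribʳ (λ i → weight i * h i) c)

    𝔼-nonNeg : ∀ {h : Fin n → ℝ} → (∀ i → 0# ≤ h i) → 0# ≤ 𝔼 D h
    𝔼-nonNeg 0≤h = ≤-trans (≤-reflexive (sym (𝔼-const 0#))) (𝔼-mono-≤ 0≤h)

    wt-nonNeg : ∀ b → 0# ≤ wt D b
    wt-nonNeg b = 𝔼-nonNeg (λ i → 𝟙-nonNeg (b i))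
      where
      𝟙-nonNeg : ∀ b → 0# ≤ 𝟙 b
      𝟙-nonNeg true  = 0≤1
      𝟙-nonNeg false = ≤-refl

    wt-not : ∀ b → wt D b + wt D (not ∘ b) ≡ 1#
    wt-not b = trans (sym (𝔼-+ (𝟙 ∘ b) (𝟙 ∘ not ∘ b))) (trans (𝔼-cong λ i → 𝟙-not (b i)) (𝔼-const 1#))
      where
      𝟙-not : ∀ b → 𝟙 b + 𝟙 (not b) ≡ 1#
      𝟙-not true  = +-identityʳ 1#
      𝟙-not false = +-identityˡ 1#

    wt≤1 : ∀ b → wt D b ≤ 1#
    wt≤1 b = ≤-trans (x≤x+y (wt-nonNeg (not ∘ b))) (≤-reflexive (wt-not b))

    𝔼ⁿ : ∀ m → (Vec (Fin n) m → ℝ) → ℝ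
    𝔼ⁿ zero    h = h []
    𝔼ⁿ (suc m) h = 𝔼 D λ x → 𝔼ⁿ m λ xs → h (x ∷ xs)

    𝔼ⁿ-cong : ∀ m {h k : Vec (Fin n) m → ℝ} → (∀ xs → h xs ≡ k xs) → 𝔼ⁿ m h ≡ 𝔼ⁿ m k
    𝔼ⁿ-cong zero    h≗k = h≗k []
    𝔼ⁿ-cong (suc m) h≗k = 𝔼-cong λ x → 𝔼ⁿ-cong m λ xs → h≗k (x ∷ xs)

    𝔼ⁿ-mono-≤ : ∀ m {h k : Vec (Fin n) m → ℝ} → (∀ xs → h xs ≤ k xs) → 𝔼ⁿ m h ≤ 𝔼ⁿ m k
    𝔼ⁿ-mono-≤ zero    h≤k = h≤k []
    𝔼ⁿ-mono-≤ (suc m) h≤k = 𝔼-mono-≤ λ x → 𝔼ⁿ-mono-≤ m λ xs → h≤k (x ∷ xs)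

    𝔼ⁿ-const : ∀ m c → 𝔼ⁿ m (λ _ → c) ≡ c
    𝔼ⁿ-const zero    c = refl
    𝔼ⁿ-const (suc m) c = trans (𝔼-cong λ _ → 𝔼ⁿ-const m c) (𝔼-const c)

    𝔼ⁿ-+ : ∀ m (h k : Vec (Fin n) m → ℝ) → 𝔼ⁿ m (λ xs → h xs + k xs) ≡ 𝔼ⁿ m h + 𝔼ⁿ m k
    𝔼ⁿ-+ zero    h k = refl
    𝔼ⁿ-+ (suc m) h k = trans (𝔼-cong λ x → 𝔼ⁿ-+ m (λ xs → h (x ∷ xs)) (λ xs → k (x ∷ xs))) (𝔼-+ (λ x → 𝔼ⁿ m λ xs → h (x ∷ xs)) (λ x → 𝔼ⁿ m λ xs → k (x ∷ xs)))

    𝔼ⁿ-*ʳ : ∀ m (h : Vec (Fin n) m → ℝ) c → 𝔼ⁿ m (λ xs → h xs * c) ≡ 𝔼ⁿ m h * c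
    𝔼ⁿ-*ʳ zero    h c = refl
    𝔼ⁿ-*ʳ (suc m) h c = trans (𝔼-cong λ x → 𝔼ⁿ-*ʳ m (λ xs → h (x ∷ xs)) c) (𝔼-*ʳ (λ x → 𝔼ⁿ m λ xs → h (x ∷ xs)) c)

    private
      count : Bool → ℕ
      count b = if b then 1 else 0

    𝔼-z^ : ∀ b z → 𝔼 D (λ x → z ^ count (b x)) ≡ (1# - wt D b) + wt D b * z
    𝔼-z^ b z = begin
      𝔼 D (λ x → z ^ count (b x))              ≡⟨ 𝔼-cong (λ x → z^count (b x)) ⟩
      𝔼 D (λ x → 𝟙 (b x) * (z - 1#) + 1#)      ≡⟨ 𝔼-+ (λ x → 𝟙 (b x) * (z - 1#)) (λ _ → 1#) ⟩
      𝔼 D (λ x → 𝟙 (b x) * (z - 1#)) + 𝔼 D (λ _ → 1#) ≡⟨ cong₂ _+_ (𝔼-*ʳ (𝟙 ∘ b) (z - 1#)) (𝔼-const 1#) ⟩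
      wt D b * (z - 1#) + 1#                   ≡⟨ solve 2 (λ p z → p :* (z :- one) :+ one := (one :- p) :+ p :* z) refl (wt D b) z ⟩
      (1# - wt D b) + wt D b * z               ∎
      where
      open ≡-Reasoning
      z^count : ∀ b → z ^ count b ≡ 𝟙 b * (z - 1#) + 1#
      z^count true  = solve 1 (λ z → z :* one := one :* (z :- one) :+ one) refl z
      z^count false = solve 1 (λ z → one := nat 0 :* (z :- one) :+ one) refl z

    -- Independence: the power splits into one factor per draw, and each factor leaves the
    -- expectations over the other draws.
    𝔼ⁿ-z^ : ∀ b z m → 𝔼ⁿ m (λ xs → z ^ ‖ b ∘ lookup xs ‖) ≡ ((1# - wt D b) + wt D b * z) ^ m
    𝔼ⁿ-z^ b z zero    = refl
    𝔼ⁿ-z^ b z (suc m) = begin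
      𝔼 D (λ x → 𝔼ⁿ m (λ xs → z ^ (count (b x) ℕ.+ ‖ b ∘ lookup xs ‖)))
        ≡⟨ 𝔼-cong (λ x → trans (𝔼ⁿ-cong m λ xs → trans (^-homo-* z (count (b x)) ‖ b ∘ lookup xs ‖) (*-comm _ _))
             (trans (𝔼ⁿ-*ʳ m (λ xs → z ^ ‖ b ∘ lookup xs ‖) (z ^ count (b x))) (trans (cong (_* z ^ count (b x)) (𝔼ⁿ-z^ b z m)) (*-comm _ _)))) ⟩
      𝔼 D (λ x → z ^ count (b x) * Gᵐ)   ≡⟨ 𝔼-*ʳ (λ x → z ^ count (b x)) Gᵐ ⟩
      𝔼 D (λ x → z ^ count (b x)) * Gᵐ   ≡⟨ cong (_* Gᵐ) (𝔼-z^ b z) ⟩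
      ((1# - wt D b) + wt D b * z) * Gᵐ  ∎
      where
      open ≡-Reasoning
      Gᵐ : ℝ
      Gᵐ = ((1# - wt D b) + wt D b * z) ^ m

    -- A function whose expectation bounds the probability of B by 2 / v.
    TailBound : ∀ m → (Vec (Fin n) m → Set) → ℝ → Set
    TailBound m B v = ∃ λ u → (∀ xs → 0# ≤ u xs) × (∀ xs → B xs → 1# ≤ u xs) × v * 𝔼ⁿ m u ≤ fromℕ 2

    -- Markov's inequality with the witness `z ^ ‖ Y ‖ ÷ z ^ k`. Since the count is an integer, the
    -- event already gives `k ≤ ‖ Y ‖` for the ceiling k.
    upper-tail : ∀ m b {t X v} → 0# ≤ t → 0# ≤ X → X ≤ fromℕ 2 * (fromℕ m * (t * t)) → ExpAtLeast X v →
      TailBound m (λ xs → fromℕ m * (wt D b + t) ≤ fromℕ ‖ b ∘ lookup xs ‖) v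
    upper-tail m b {t} {X} {v} 0≤t 0≤X X≤ X≥v = certificate (chernoff m (wt-nonNeg b) (wt≤1 b) 0≤t 0≤X X≤ X≥v)
      where
      k : ℕ
      k = ⌈ fromℕ m * (wt D b + t) ⌉
      certificate : (∃ λ z → 1# ≤ z × v * ((1# - wt D b) + wt D b * z) ^ m ≤ fromℕ 2 * z ^ k) →
        TailBound m (λ xs → fromℕ m * (wt D b + t) ≤ fromℕ ‖ b ∘ lookup xs ‖) v
      certificate (z , 1≤z , bound) =
        (λ xs → z ^ ‖ b ∘ lookup xs ‖ ÷ z ^ k) ,
        (λ xs → ÷-nonNeg (^-nonNeg ‖ b ∘ lookup xs ‖ 0≤z) 0<z^k) ,
        (λ xs far → ≤-÷ 0<z^k (≤-trans (≤-reflexive (*-identityˡ _))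
          (^-monoʳ-≤ {b = ‖ b ∘ lookup xs ‖} 1≤z (⌈⌉-least (fromℕ m * (wt D b + t)) ‖ b ∘ lookup xs ‖ far)))) ,
        ≤-trans (≤-reflexive (trans (cong (v *_) (trans (𝔼ⁿ-*ʳ m (λ xs → z ^ ‖ b ∘ lookup xs ‖) ((z ^ k) ⁻¹)) (cong (_* (z ^ k) ⁻¹) (𝔼ⁿ-z^ b z m))))
          (sym (*-assoc v (((1# - wt D b) + wt D b * z) ^ m) ((z ^ k) ⁻¹))))) (÷-≤ 0<z^k bound)
        where
        0≤z : 0# ≤ z
        0≤z = ≤-trans 0≤1 1≤z
        0<z^k : 0# < z ^ k
        0<z^k = ^-pos k (<-≤-trans 0<1 1≤z)

    ‖not‖ : ∀ {m} (Y : Fin m → Bool) → fromℕ ‖ Y ‖ + fromℕ ‖ not ∘ Y ‖ ≡ fromℕ m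
    ‖not‖ {zero}  Y = +-identityʳ 0#
    ‖not‖ {suc m} Y with Y zero
    ... | true  = trans (+-assoc 1# (fromℕ ‖ Y ∘ suc ‖) (fromℕ ‖ not ∘ Y ∘ suc ‖)) (cong (1# +_) (‖not‖ (Y ∘ suc)))
    ... | false = trans (solve 2 (λ x y → x :+ (one :+ y) := one :+ (x :+ y)) refl (fromℕ ‖ Y ∘ suc ‖) (fromℕ ‖ not ∘ Y ∘ suc ‖)) (cong (1# +_) (‖not‖ (Y ∘ suc)))

    -- Negating b complements both the weight and the count, which turns the lower tail into an
    -- upper one.
    lower-tail : ∀ m b {t X v} → 0# ≤ t → 0# ≤ X → X ≤ fromℕ 2 * (fromℕ m * (t * t)) → ExpAtLeast X v →
      TailBound m (λ xs → fromℕ ‖ b ∘ lookup xs ‖ ≤ fromℕ m * (wt D b - t)) v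
    lower-tail m b {t} {X} {v} 0≤t 0≤X X≤ X≥v =
      proj₁ upper , proj₁ (proj₂ upper) ,
      (λ xs far → proj₁ (proj₂ (proj₂ upper)) xs (complement xs far)) ,
      proj₂ (proj₂ (proj₂ upper))
      where
      upper = upper-tail m (not ∘ b) 0≤t 0≤X X≤ X≥v
      complement : ∀ xs → fromℕ ‖ b ∘ lookup xs ‖ ≤ fromℕ m * (wt D b - t) →
                   fromℕ m * (wt D (not ∘ b) + t) ≤ fromℕ ‖ not ∘ b ∘ lookup xs ‖
      complement xs far = ≤-via far (trans
        (swap (fromℕ m) (wt D b) (wt D (not ∘ b)) t (fromℕ ‖ b ∘ lookup xs ‖) (fromℕ ‖ not ∘ b ∘ lookup xs ‖) (wt-not b) (‖not‖ (b ∘ lookup xs))) refl)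
        where
        swap : ∀ m p q t y y′ → p + q ≡ 1# → y + y′ ≡ m → y′ - m * (q + t) ≡ m * (p - t) - y
        swap m p q t y y′ p+q≡1 y+y′≡m = begin
          y′ - m * (q + t)                       ≡⟨ solve 6 (λ m p q t y y′ → y′ :- m :* (q :+ t)
                                                     := (m :* (p :- t) :- y) :+ ((y :+ y′) :- m :* (p :+ q))) refl m p q t y y′ ⟩
          (m * (p - t) - y) + ((y + y′) - m * (p + q)) ≡⟨ cong₂ (λ u w → (m * (p - t) - y) + (u - m * w)) y+y′≡m p+q≡1 ⟩
          (m * (p - t) - y) + (m - m * 1#)       ≡⟨ solve 2 (λ x m → x :+ (m :- m :* one) := x) refl (m * (p - t) - y) m ⟩
          m * (p - t) - y                        ∎
          where open ≡-Reasoning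

  ℙ-nonNeg : ∀ {N} b (t : Execution N) → 0# ≤ ℙ[decision b ] t
  ℙ-nonNeg true  (halt true)  = 0≤1
  ℙ-nonNeg true  (halt false) = ≤-refl
  ℙ-nonNeg false (halt true)  = ≤-refl
  ℙ-nonNeg false (halt false) = 0≤1
  ℙ-nonNeg b (event _ t)  = ℙ-nonNeg b t
  ℙ-nonNeg b (choose D t) = 𝔼-nonNeg D λ i → ℙ-nonNeg b (t i)

  ℙ-total : ∀ {N} (t : Execution N) → ℙ[accept] t + ℙ[reject] t ≡ 1#
  ℙ-total (halt true)  = +-identityʳ 1#
  ℙ-total (halt false) = +-identityˡ 1#
  ℙ-total (event _ t)  = ℙ-total t
  ℙ-total (choose D t) = trans (sym (𝔼-+ D (λ i → ℙ[accept] (t i)) (λ i → ℙ[reject] (t i)))) (trans (𝔼-cong D λ i → ℙ-total (t i)) (𝔼-const D 1#))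

  ℙ[accept]≤1 : ∀ {N} (t : Execution N) → ℙ[accept] t ≤ 1#
  ℙ[accept]≤1 t = ≤-trans (x≤x+y (ℙ-nonNeg false t)) (≤-reflexive (ℙ-total t))

  ℙ[reject]≤1 : ∀ {N} (t : Execution N) → ℙ[reject] t ≤ 1#
  ℙ[reject]≤1 t = ≤-trans (x≤x+y (ℙ-nonNeg true t)) (≤-reflexive (trans (+-comm _ _) (ℙ-total t)))

  ‖‖-cong : ∀ {m} {Y Z : Fin m → Bool} → (∀ j → Y j ≡ Z j) → ‖ Y ‖ ≡ ‖ Z ‖
  ‖‖-cong {zero}  Y≗Z = refl
  ‖‖-cong {suc m} Y≗Z = cong₂ (λ b k → (if b then 1 else 0) ℕ.+ k) (Y≗Z zero) (‖‖-cong (λ j → Y≗Z (suc j)))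

  ‖‖-≤ : ∀ {m} (Y : Fin m → Bool) → ‖ Y ‖ ℕ.≤ m
  ‖‖-≤ {zero}  Y = ℕ.z≤n
  ‖‖-≤ {suc m} Y with Y zero
  ... | true  = ℕ.s≤s (‖‖-≤ (Y ∘ suc))
  ... | false = ℕ.m≤n⇒m≤1+n (‖‖-≤ (Y ∘ suc))

-- Binary logarithms and encodings, duplicate-free lists, decisions.

-- The accessibility proof is a parameter because `⌈log2⌉` recurses on it, passing from
-- `suc (suc n)` to `suc ⌈ n /2⌉`.
2^-≥ : ∀ n (a : Acc ℕ._<_ n) → n ℕ.≤ 2 ℕ.^ ⌈log2⌉ n a
2^-≥ 0             _        = ℕ.z≤n
2^-≥ 1             _        = ℕ.≤-refl
2^-≥ (suc (suc n)) (acc rs) = begin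
  suc (suc n)                                   ≤⟨ ℕ.s≤s (ℕ.s≤s n≤) ⟩
  suc (suc (⌈ n /2⌉ ℕ.+ ⌈ n /2⌉))               ≡⟨ cong suc (sym (ℕ.+-suc ⌈ n /2⌉ ⌈ n /2⌉)) ⟩
  suc ⌈ n /2⌉ ℕ.+ suc ⌈ n /2⌉                   ≤⟨ ℕ.+-mono-≤ ih ih ⟩
  P ℕ.+ P                                       ≡⟨ cong (P ℕ.+_) (sym (ℕ.+-identityʳ P)) ⟩
  2 ℕ.* P                                       ∎
  where
  open ℕ.≤-Reasoning
  P : ℕ
  P = 2 ℕ.^ ⌈log2⌉ (suc ⌈ n /2⌉) (rs (ℕ.⌈n/2⌉<n n))
  ih : suc ⌈ n /2⌉ ℕ.≤ P
  ih = 2^-≥ (suc ⌈ n /2⌉) (rs (ℕ.⌈n/2⌉<n n))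
  n≤ : n ℕ.≤ ⌈ n /2⌉ ℕ.+ ⌈ n /2⌉
  n≤ = subst (ℕ._≤ ⌈ n /2⌉ ℕ.+ ⌈ n /2⌉) (ℕ.⌊n/2⌋+⌈n/2⌉≡n n) (ℕ.+-monoˡ-≤ ⌈ n /2⌉ (ℕ.⌊n/2⌋≤⌈n/2⌉ n))

n≤2^⌈log₂n⌉ : ∀ n → n ℕ.≤ 2 ℕ.^ ⌈log₂ n ⌉
n≤2^⌈log₂n⌉ n = 2^-≥ n _

n≤2^n : ∀ n → n ℕ.≤ 2 ℕ.^ n
n≤2^n zero    = ℕ.z≤n
n≤2^n (suc n) = subst (suc n ℕ.≤_) (cong (2 ℕ.^ n ℕ.+_) (sym (ℕ.+-identityʳ (2 ℕ.^ n))))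
  (ℕ.+-mono-≤ (ℕ.m^n>0 2 n) (n≤2^n n))

-- From `k ≤ 2^k`. Far from sharp, but m has order 1/g², so a square root already brings the claim's
-- width down to order 1/g.
⌈log₂⌉-≤-√ : ∀ n k → n ℕ.≤ k ℕ.* k → ⌈log₂ n ⌉ ℕ.≤ k ℕ.+ k
⌈log₂⌉-≤-√ n k n≤k² = begin
  ⌈log₂ n ⌉                  ≤⟨ ⌈log₂⌉-mono-≤ (ℕ.≤-trans n≤k² (ℕ.*-mono-≤ (n≤2^n k) (n≤2^n k))) ⟩
  ⌈log₂ 2 ℕ.^ k ℕ.* 2 ℕ.^ k ⌉ ≡⟨ cong ⌈log₂_⌉ (sym (ℕ.^-distribˡ-+-* 2 k k)) ⟩
  ⌈log₂ 2 ℕ.^ (k ℕ.+ k) ⌉    ≡⟨ ⌈log₂2^n⌉≡n (k ℕ.+ k) ⟩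
  k ℕ.+ k                    ∎
  where open ℕ.≤-Reasoning

length-toBits : ∀ k n → length (toBits k n) ≡ k
length-toBits zero    n = refl
length-toBits (suc k) n = cong suc (length-toBits k (n / 2))

fromBits-toBits : ∀ k n → n ℕ.< 2 ℕ.^ k → fromBits (toBits k n) ≡ n
fromBits-toBits zero    zero    _ = refl
fromBits-toBits zero    (suc n) (ℕ.s≤s ())
fromBits-toBits (suc k) n n<2^k = begin
  parity ℕ.+ 2 ℕ.* fromBits (toBits k (n / 2)) ≡⟨ cong (λ x → parity ℕ.+ 2 ℕ.* x) (fromBits-toBits k (n / 2)
      (m<n*o⇒m/o<n (subst (n ℕ.<_) (ℕ.*-comm 2 (2 ℕ.^ k)) n<2^k))) ⟩
  parity ℕ.+ 2 ℕ.* (n / 2)                     ≡⟨ cong₂ ℕ._+_ (parity≡ (n % 2) (m%n<n n 2)) (ℕ.*-comm 2 (n / 2)) ⟩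
  n % 2 ℕ.+ (n / 2) ℕ.* 2                      ≡⟨ sym (m≡m%n+[m/n]*n n 2) ⟩
  n                                            ∎
  where
  open ≡-Reasoning
  parity : ℕ
  parity = if does (n % 2 ℕ.≟ 1) then 1 else 0
  parity≡ : ∀ r → r ℕ.< 2 → (if does (r ℕ.≟ 1) then 1 else 0) ≡ r
  parity≡ 0 _ = refl
  parity≡ 1 _ = refl
  parity≡ (suc (suc _)) (ℕ.s≤s (ℕ.s≤s ()))

Unique⇒lookup-injective : ∀ {A : Set} {xs : List A} → Unique xs →
  ∀ {i j} → List.lookup xs i ≡ List.lookup xs j → i ≡ j
Unique⇒lookup-injective (x∉ ∷ u) {zero}  {zero}  eq = refl
Unique⇒lookup-injective (x∉ ∷ u) {zero}  {suc j} eq = contradiction eq (All.lookup x∉ (∈-lookup j))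
Unique⇒lookup-injective (x∉ ∷ u) {suc i} {zero}  eq = contradiction (sym eq) (All.lookup x∉ (∈-lookup i))
Unique⇒lookup-injective (x∉ ∷ u) {suc i} {suc j} eq = cong suc (Unique⇒lookup-injective u eq)

Unique⇒length≤ : ∀ {n} {xs : List (Fin n)} → Unique xs → length xs ℕ.≤ n
Unique⇒length≤ u = Fin.injective⇒≤ (Unique⇒lookup-injective u)

-- Case analysis on the verifier's test of a claim; the arbitrary Q lets it serve both for
-- probabilities and for `Always`.
if-both : ∀ {A B V : Set} (d₁ : Dec A) (d₂ : Dec B) (Q : V → Set) {x y : V} →
  (A → B → Q x) → Q y → Q (if does d₁ ∧ does d₂ then x else y)
if-both (yes a) (yes b) Q h _ = h a b
if-both (yes _) (no _)  Q _ h = h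
if-both (no _)  _       Q _ h = h

if-both-yes : ∀ {A B V : Set} (d₁ : Dec A) (d₂ : Dec B) {x y : V} → A → B →
  (if does d₁ ∧ does d₂ then x else y) ≡ x
if-both-yes (yes _)  (yes _)  a b = refl
if-both-yes (yes _)  (no ¬b)  a b = contradiction b ¬b
if-both-yes (no ¬a)  _        a b = contradiction a ¬a

if-yes : ∀ {A V : Set} (d : Dec A) {x y : V} → A → (if does d then x else y) ≡ x
if-yes (yes _)  a = refl
if-yes (no ¬a)  a = contradiction a ¬a

-- Composition of interactions: probabilities and event counts.

module Interaction (F : CompleteOrderedField) (logarithm : Reals.Logarithm F) where
  open WeightVerification F logarithm
  open OrderedFieldProperties orderedField
  open RealProperties F
  open Sampling F

  Always-map : ∀ {N} {Q R : List (Event N) → Set} → (∀ es → Q es → R es) →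
               ∀ t → Always Q t → Always R t
  Always-map Q⇒R (halt _)     q = Q⇒R [] q
  Always-map Q⇒R (event e t)  q = Always-map (λ es → Q⇒R (e ∷ es)) t q
  Always-map Q⇒R (choose _ t) q = λ i → Always-map Q⇒R (t i) (q i)

  -- A predicate on bare counters can be carried over from the subprotocol, whose events mention
  -- positions in the sample, to the composed protocol, whose events mention points of the domain.
  Stats : ∀ {N} → (ℕ → ℕ → ℕ → Set) → List (Event N) → Set
  Stats Q es = Q (rounds es) (length (verifierQueries es)) (communication es)

  NoSampleStats : ∀ {N} → (ℕ → ℕ → ℕ → Set) → List (Event N) → Set
  NoSampleStats Q es = verifierSamples es ≡ 0 × Stats Q es

  -- The obligation left for the rest of a run once a verifier query is charged; it agrees
  -- definitionally with what `Always` unfolds to. `afterMessage` plays this part for messages.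
  afterQuery : (ℕ → ℕ → ℕ → Set) → ℕ → ℕ → ℕ → Set
  afterQuery Q r q c = Q r (suc q) c

  afterMessage : List Bool → (ℕ → ℕ → ℕ → Set) → ℕ → ℕ → ℕ → Set
  afterMessage w Q r q c = Q (suc r) q (length w ℕ.+ c)

  Always-if : ∀ {N} {Q : List (Event N) → Set} (c : Bool) {t} →
    Always Q t → Q [] → Always Q (if c then t else halt false)
  Always-if true  q _ = q
  Always-if false _ q = q

  private
    ℙ-if : ∀ {N M} b (c : Bool) {t : Execution N} {t′ : Execution M} →
      ℙ[decision b ] t ≡ ℙ[decision b ] t′ →
      ℙ[decision b ] (if c then t else halt false) ≡ ℙ[decision b ] (if c then t′ else halt false)
    ℙ-if b true  eq = eq
    ℙ-if b false eq = refl

    Always-if-map : ∀ {N M} {Q : List (Event N) → Set} {R : List (Event M) → Set} (c : Bool) {t t′} →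
      (Always Q t → Always R t′) → (Q [] → R []) →
      Always Q (if c then t else halt false) → Always R (if c then t′ else halt false)
    Always-if-map true  f _ = f
    Always-if-map false _ g = g

  module _ {N m : ℕ} (D : Distribution N) (f : Fin N → Bool) where

    -- A prover against the composed verifier, read as a prover in the
    -- subprotocol: it knows D and f, so its samples become coin tosses.
    embed : Prover N blackBox → Prover m queryOnly
    embed stop        = stop
    embed (query q p) = embed (p (f q))
    embed (draw p)    = toss D λ x → embed (p x)
    embed (toss c p)  = toss c λ i → embed (p i)
    embed (send w p)  = send w (embed p)
    embed (recv p)    = recv λ w → embed (p w)

    module _ (xs : Vec (Fin N) m) where

      -- The two trees differ only in their event labels, a draw by the prover being a toss with the
      -- same D. Soundness of the subprotocol thereby reaches every prover of the composition.
      ℙ-onSample : ∀ b v P →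
        ℙ[decision b ] (run D f (onSample xs v) P) ≡ ℙ[decision b ] (run tt (f ∘ lookup xs) v (embed P))
      ℙ-onSample b (output _)  P           = refl
      ℙ-onSample b (query j v) P           = ℙ-onSample b (v (f (lookup xs j))) P
      ℙ-onSample b (toss c v)  P           = 𝔼-cong c λ i → ℙ-onSample b (v i) P
      ℙ-onSample b (send w v)  stop        = refl
      ℙ-onSample b (send w v)  (query q p) = ℙ-onSample b (send w v) (p (f q))
      ℙ-onSample b (send w v)  (draw p)    = 𝔼-cong D λ x → ℙ-onSample b (send w v) (p x)
      ℙ-onSample b (send w v)  (toss c p)  = 𝔼-cong c λ i → ℙ-onSample b (send w v) (p i)
      ℙ-onSample b (send w v)  (send _ p)  = refl
      ℙ-onSample b (send w v)  (recv p)    = ℙ-onSample b v (p w)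
      ℙ-onSample b (recv k v)  stop        = refl
      ℙ-onSample b (recv k v)  (query q p) = ℙ-onSample b (recv k v) (p (f q))
      ℙ-onSample b (recv k v)  (draw p)    = 𝔼-cong D λ x → ℙ-onSample b (recv k v) (p x)
      ℙ-onSample b (recv k v)  (toss c p)  = 𝔼-cong c λ i → ℙ-onSample b (recv k v) (p i)
      ℙ-onSample b (recv k v)  (send w p)  = ℙ-if b (does (length w ℕ.≤? k)) (ℙ-onSample b (v w) p)
      ℙ-onSample b (recv k v)  (recv p)    = refl

      Always-onSample : ∀ Q v P → Always (Stats Q) (run tt (f ∘ lookup xs) v (embed P)) →
        Always (NoSampleStats Q) (run D f (onSample xs v) P)
      Always-onSample Q (output _)  P           a = refl , a
      Always-onSample Q (query j v) P           a = Always-onSample (afterQuery Q) (v (f (lookup xs j))) P a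
      Always-onSample Q (toss c v)  P           a = λ i → Always-onSample Q (v i) P (a i)
      Always-onSample Q (send w v)  stop        a = refl , a
      Always-onSample Q (send w v)  (query q p) a = Always-onSample Q (send w v) (p (f q)) a
      Always-onSample Q (send w v)  (draw p)    a = λ x → Always-onSample Q (send w v) (p x) (a x)
      Always-onSample Q (send w v)  (toss c p)  a = λ i → Always-onSample Q (send w v) (p i) (a i)
      Always-onSample Q (send w v)  (send _ p)  a = refl , a
      Always-onSample Q (send w v)  (recv p)    a = Always-onSample (afterMessage w Q) v (p w) a
      Always-onSample Q (recv k v)  stop        a = refl , a
      Always-onSample Q (recv k v)  (query q p) a = Always-onSample Q (recv k v) (p (f q)) a
      Always-onSample Q (recv k v)  (draw p)    a = λ x → Always-onSample Q (recv k v) (p x) (a x)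
      Always-onSample Q (recv k v)  (toss c p)  a = λ i → Always-onSample Q (recv k v) (p i) (a i)
      Always-onSample Q (recv k v)  (send w p)  a =
        Always-if-map (does (length w ℕ.≤? k)) (Always-onSample (afterMessage w Q) (v w) p) (λ q → refl , q) a
      Always-onSample Q (recv k v)  (recv p)    a = refl , a

      module _ {Y : Fin m → Bool} (Y≗ : ∀ j → Y j ≡ f (lookup xs j)) where

        -- The cache agrees with f only at the sampled points, so Y is compared with f position by
        -- position instead of by an equation between functions.
        ℙ-answering : ∀ b v p →
          ℙ[decision b ] (run D f (onSample xs v) (answering Y p)) ≡ ℙ[decision b ] (run tt Y v p)
        ℙ-answering b (output _)  p           = refl
        ℙ-answering b (query j v) p           = subst
          (λ c → ℙ[decision b ] (run D f (onSample xs (v c)) (answering Y p)) ≡ ℙ[decision b ] (run tt Y (v (Y j)) p))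
          (Y≗ j) (ℙ-answering b (v (Y j)) p)
        ℙ-answering b (toss c v)  p           = 𝔼-cong c λ i → ℙ-answering b (v i) p
        ℙ-answering b (send w v)  stop        = refl
        ℙ-answering b (send w v)  (query q p) = ℙ-answering b (send w v) (p (Y q))
        ℙ-answering b (send w v)  (toss c p)  = 𝔼-cong c λ i → ℙ-answering b (send w v) (p i)
        ℙ-answering b (send w v)  (send _ p)  = refl
        ℙ-answering b (send w v)  (recv p)    = ℙ-answering b v (p w)
        ℙ-answering b (recv k v)  stop        = refl
        ℙ-answering b (recv k v)  (query q p) = ℙ-answering b (recv k v) (p (Y q))
        ℙ-answering b (recv k v)  (toss c p)  = 𝔼-cong c λ i → ℙ-answering b (recv k v) (p i)
        ℙ-answering b (recv k v)  (send w p)  = ℙ-if b (does (length w ℕ.≤? k)) (ℙ-answering b (v w) p)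
        ℙ-answering b (recv k v)  (recv p)    = refl

      ProverIdle : List (Event N) → Set
      ProverIdle es = proverSamples es ≡ 0 × proverQueries es ≡ []

      Always-answering : ∀ (Y : Fin m → Bool) v p → Always ProverIdle (run D f (onSample xs v) (answering Y p))
      Always-answering Y (output _)  p           = refl , refl
      Always-answering Y (query j v) p           = Always-answering Y (v (f (lookup xs j))) p
      Always-answering Y (toss c v)  p           = λ i → Always-answering Y (v i) p
      Always-answering Y (send w v)  stop        = refl , refl
      Always-answering Y (send w v)  (query q p) = Always-answering Y (send w v) (p (Y q))
      Always-answering Y (send w v)  (toss c p)  = λ i → Always-answering Y (send w v) (p i)
      Always-answering Y (send w v)  (send _ p)  = refl , refl
      Always-answering Y (send w v)  (recv p)    = Always-answering Y v (p w)
      Always-answering Y (recv k v)  stop        = refl , refl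
      Always-answering Y (recv k v)  (query q p) = Always-answering Y (recv k v) (p (Y q))
      Always-answering Y (recv k v)  (toss c p)  = λ i → Always-answering Y (recv k v) (p i)
      Always-answering Y (recv k v)  (send w p)  =
        Always-if (does (length w ℕ.≤? k)) (Always-answering Y (v w) p) (refl , refl)
      Always-answering Y (recv k v)  (recv p)    = refl , refl

  module _ {N : ℕ} (D : Distribution N) (f : Fin N → Bool) where

    ℙ-drawMany : ∀ b m v P → ℙ[decision b ] (run D f (drawMany m v) P) ≡
      𝔼ⁿ D m (λ xs → ℙ[decision b ] (run D f (v xs) P))
    ℙ-drawMany b zero    v P = refl
    ℙ-drawMany b (suc m) v P = 𝔼-cong D λ x → ℙ-drawMany b m (λ xs → v (x ∷ xs)) P

    Always-drawMany : ∀ (R : List (Event N) → Set) → (∀ es → R es → R (verifierDraws ∷ es)) →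
      ∀ m v P → (∀ xs → Always R (run D f (v xs) P)) → Always R (run D f (drawMany m v) P)
    Always-drawMany R R-draws zero    v P a = a []
    Always-drawMany R R-draws (suc m) v P a = λ x → Always-map R-draws (run D f (drawMany m λ xs → v (x ∷ xs)) P)
      (Always-drawMany R R-draws m (λ xs → v (x ∷ xs)) P λ xs → a (x ∷ xs))

    Always-drawMany-samples : ∀ Q m v P → (∀ xs → Always (NoSampleStats Q) (run D f (v xs) P)) →
      Always (λ es → verifierSamples es ≡ m × Stats Q es) (run D f (drawMany m v) P)
    Always-drawMany-samples Q zero    v P a = a []
    Always-drawMany-samples Q (suc m) v P a = λ x → Always-map (λ _ (s , q) → cong suc s , q)
      (run D f (drawMany m λ xs → v (x ∷ xs)) P)
      (Always-drawMany-samples Q m (λ xs → v (x ∷ xs)) P λ xs → a (x ∷ xs))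

    -- Before receiving, the prover may query, draw and toss at will: averaging preserves a uniform
    -- bound, and a breach of the message order is rejected.
    ℙ[accept]-send : ∀ {e} → 0# ≤ e → ∀ w v → (∀ P → ℙ[accept] (run D f v P) ≤ e) →
      ∀ P → ℙ[accept] (run D f (send w v) P) ≤ e
    ℙ[accept]-send 0≤e w v h stop        = 0≤e
    ℙ[accept]-send 0≤e w v h (query q p) = ℙ[accept]-send 0≤e w v h (p (f q))
    ℙ[accept]-send 0≤e w v h (draw p)    = ≤-trans (𝔼-mono-≤ D λ x → ℙ[accept]-send 0≤e w v h (p x)) (≤-reflexive (𝔼-const D _))
    ℙ[accept]-send 0≤e w v h (toss c p)  = ≤-trans (𝔼-mono-≤ c λ i → ℙ[accept]-send 0≤e w v h (p i)) (≤-reflexive (𝔼-const c _))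
    ℙ[accept]-send 0≤e w v h (send _ p)  = 0≤e
    ℙ[accept]-send 0≤e w v h (recv p)    = h (p w)

    ℙ[accept]-recv : ∀ {e} → 0# ≤ e → ∀ k v → (∀ w P → ℙ[accept] (run D f (v w) P) ≤ e) →
      ∀ P → ℙ[accept] (run D f (recv k v) P) ≤ e
    ℙ[accept]-recv 0≤e k v h stop        = 0≤e
    ℙ[accept]-recv 0≤e k v h (query q p) = ℙ[accept]-recv 0≤e k v h (p (f q))
    ℙ[accept]-recv 0≤e k v h (draw p)    = ≤-trans (𝔼-mono-≤ D λ x → ℙ[accept]-recv 0≤e k v h (p x)) (≤-reflexive (𝔼-const D _))
    ℙ[accept]-recv 0≤e k v h (toss c p)  = ≤-trans (𝔼-mono-≤ c λ i → ℙ[accept]-recv 0≤e k v h (p i)) (≤-reflexive (𝔼-const c _))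
    ℙ[accept]-recv {e} 0≤e k v h (send w p) = go (does (length w ℕ.≤? k))
      where
      go : ∀ c → ℙ[accept] (if c then event (toVerifier w) (run D f (v w) p) else halt false) ≤ e
      go true  = h w p
      go false = 0≤e
    ℙ[accept]-recv 0≤e k v h (recv p)    = 0≤e

    Always-send : ∀ Q w v → Q 0 0 0 → (∀ P → Always (NoSampleStats (afterMessage w Q)) (run D f v P)) →
      ∀ P → Always (NoSampleStats Q) (run D f (send w v) P)
    Always-send Q w v q h stop        = refl , q
    Always-send Q w v q h (query _ p) = Always-send Q w v q h (p (f _))
    Always-send Q w v q h (draw p)    = λ x → Always-send Q w v q h (p x)
    Always-send Q w v q h (toss c p)  = λ i → Always-send Q w v q h (p i)
    Always-send Q w v q h (send _ p)  = refl , q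
    Always-send Q w v q h (recv p)    = h (p w)

    Always-recv : ∀ Q k v → Q 0 0 0 →
      (∀ w P → length w ℕ.≤ k → Always (NoSampleStats (afterMessage w Q)) (run D f (v w) P)) →
      ∀ P → Always (NoSampleStats Q) (run D f (recv k v) P)
    Always-recv Q k v q h stop        = refl , q
    Always-recv Q k v q h (query _ p) = Always-recv Q k v q h (p (f _))
    Always-recv Q k v q h (draw p)    = λ x → Always-recv Q k v q h (p x)
    Always-recv Q k v q h (toss c p)  = λ i → Always-recv Q k v q h (p i)
    Always-recv Q k v q h (send w p)  = go (length w ℕ.≤? k)
      where
      go : (d : Dec (length w ℕ.≤ k)) → Always (NoSampleStats Q)
        (if does d then event (toVerifier w) (run D f (v w) p) else halt false)
      go (yes w≤k) = h w p w≤k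
      go (no _)    = refl , q
    Always-recv Q k v q h (recv p)    = refl , q

    fill : List (Fin N) → (Fin N → Bool) → Fin N → Bool
    fill []       cache = cache
    fill (x ∷ xs) cache = fill xs (updateAt cache x (const (f x)))

    -- A later query either misses x or writes `f x` once more.
    fill-keeps : ∀ xs cache x → cache x ≡ f x → fill xs cache x ≡ f x
    fill-keeps []       cache x eq = eq
    fill-keeps (y ∷ xs) cache x eq = fill-keeps xs _ x (updated (x Fin.≟ y))
      where
      updated : Dec (x ≡ y) → updateAt cache y (const (f y)) x ≡ f x
      updated (yes refl) = updateAt-updates y cache
      updated (no  x≢y)  = trans (updateAt-minimal x y cache x≢y) eq

    fill-correct : ∀ {xs} cache {x} → x ∈ xs → fill xs cache x ≡ f x
    fill-correct {y ∷ xs} cache (here refl)  = fill-keeps xs _ y (updateAt-updates y cache)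
    fill-correct {y ∷ xs} cache (there x∈xs) = fill-correct _ x∈xs

    ℙ-queryAll : ∀ b k v xs cache p →
      ℙ[decision b ] (run D f (recv k v) (queryAll xs cache p)) ≡
      ℙ[decision b ] (run D f (recv k v) (p (fill xs cache)))
    ℙ-queryAll b k v []       cache p = refl
    ℙ-queryAll b k v (x ∷ xs) cache p = ℙ-queryAll b k v xs _ p

    Always-queryAll : ∀ k v xs cache p →
      Always (λ es → proverSamples es ≡ 0 × proverQueries es ≡ []) (run D f (recv k v) (p (fill xs cache))) →
      Always (λ es → proverSamples es ≡ 0 × proverQueries es ≡ xs) (run D f (recv k v) (queryAll xs cache p))
    Always-queryAll k v []       cache p a = a
    Always-queryAll k v (x ∷ xs) cache p a = Always-map
      (λ _ (s , q) → s , cong (x List.∷_) q)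
      (run D f (recv k v) (queryAll xs (updateAt cache x (const (f x))) p))
      (Always-queryAll k v xs _ p a)

  module _ {N ℓ : ℕ} (enc : Encoding N ℓ) where
    open Encoding enc

    word-toList : ∀ {k} (v : Vec Bool k) rest → word enc k (Vec.toList v ++ rest) ≡ v
    word-toList []      rest = refl
    word-toList (b ∷ v) rest = cong (b ∷_) (word-toList v rest)

    drop-toList : ∀ {k} (v : Vec Bool k) rest → List.drop k (Vec.toList v ++ rest) ≡ rest
    drop-toList []      rest = refl
    drop-toList (b ∷ v) rest = drop-toList v rest

    decodeSample-encodeSample : ∀ {m} (xs : Vec (Fin N) m) → decodeSample enc m (encodeSample enc xs) ≡ xs
    decodeSample-encodeSample []       = refl
    decodeSample-encodeSample (x ∷ xs) = cong₂ _∷_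
      (trans (cong decode (word-toList (encode x) (encodeSample enc xs))) (decode-encode x))
      (trans (cong (decodeSample enc _) (drop-toList (encode x) (encodeSample enc xs))) (decodeSample-encodeSample xs))

    length-encodeSample : ∀ {m} (xs : Vec (Fin N) m) → length (encodeSample enc xs) ≡ m ℕ.* ℓ
    length-encodeSample []       = refl
    length-encodeSample (x ∷ xs) = trans (List.length-++ (Vec.toList (encode x)))
      (cong₂ ℕ._+_ (Vec.length-toList (encode x)) (length-encodeSample xs))

-- Completeness and soundness errors.

module Protocol-Π (F : CompleteOrderedField) (logarithm : Reals.Logarithm F) where
  open WeightVerification F logarithm
  open OrderedFieldProperties orderedField
  open RealProperties F
  open Exponential F
  open LogarithmProperties logarithm
  open Hoeffding F
  open Sampling F
  open Interaction F logarithm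

  4<1÷δ : ∀ {δ} → 0# < δ → δ < 1# ÷ fromℕ 4 → fromℕ 4 < 1# ÷ δ
  4<1÷δ {δ} 0<δ δ<¼ = <-÷ 0<δ (subst (_< 1#) (*-comm δ (fromℕ 4)) (<-÷⁻¹ (fromℕ-pos 3) δ<¼))

  2÷δ≡2*[1÷δ] : ∀ δ → fromℕ 2 ÷ δ ≡ fromℕ 2 * (1# ÷ δ)
  2÷δ≡2*[1÷δ] δ = cong (fromℕ 2 *_) (sym (*-identityˡ (δ ⁻¹)))

  4<2÷δ : ∀ {δ} → 0# < δ → δ < 1# ÷ fromℕ 4 → fromℕ 4 < fromℕ 2 ÷ δ
  4<2÷δ {δ} 0<δ δ<¼ = <-≤-trans (4<1÷δ 0<δ δ<¼) (≤-trans
    (≤-via (÷-nonNeg 0≤1 0<δ) (solve 1 (λ x → nat 2 :* x :- x := x :- nat 0) refl (1# ÷ δ)))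
    (≤-reflexive (sym (2÷δ≡2*[1÷δ] δ))))

  8ln≤mg² : ∀ δ g → 0# < g → fromℕ 8 * ln (fromℕ 2 ÷ δ) ≤ fromℕ (sampleSize δ g) * (g * g)
  8ln≤mg² δ g 0<g = ÷-≤⁻¹ (*-pos 0<g 0<g) (x≤⌈x⌉ _)

  module _ {N ℓ : ℕ} (enc : Encoding N ℓ) (εc εf δ : ℝ)
           (sub : HammingProtocol (sampleSize δ (εf - εc))) where
    private
      module Sub = HammingProtocol sub
      g : ℝ
      g = εf - εc
      m width : ℕ
      m = sampleSize δ g
      width = ⌈log₂ suc m ⌉

    -- The parts of Π, which are local to its definition.
    afterClaim : ℝ → Vec (Fin N) m → ℕ → Verifier N blackBox
    afterClaim σ xs W =
      if does (W ℕ.≤? m) ∧ does (∣ fromℕ W ÷ fromℕ m - σ ∣ ≤? εc + g ÷ fromℕ 2)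
      then onSample xs (Sub.verifier W)
      else output false

    afterSampling : ℝ → Vec (Fin N) m → Verifier N blackBox
    afterSampling σ xs = send (encodeSample enc xs) (recv width λ w → afterClaim σ xs (fromBits w))

    withCache : Vec (Fin N) m → (Fin N → Bool) → Prover N blackBox
    withCache xs cache = send (toBits width ‖ cache ∘ lookup xs ‖) (answering (cache ∘ lookup xs) (Sub.honest ‖ cache ∘ lookup xs ‖))

    distinct : Vec (Fin N) m → List (Fin N)
    distinct xs = List.deduplicate Fin._≟_ (Vec.toList xs)

    respond : Vec (Fin N) m → Prover N blackBox
    respond xs = queryAll (distinct xs) (const false) (withCache xs)

    module _ (D : Distribution N) (f : Fin N → Bool) where

      cached : Vec (Fin N) m → Fin m → Bool
      cached xs = fill D f (distinct xs) (const false) ∘ lookup xs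

      cached-correct : ∀ xs j → cached xs j ≡ f (lookup xs j)
      cached-correct xs j = fill-correct D f (const false)
        (∈-deduplicate⁺ Fin._≟_ (Vec-∈.∈-toList⁺ (Vec-∈.∈-lookup j xs)))

      ‖cached‖ : ∀ xs → ‖ cached xs ‖ ≡ ‖ f ∘ lookup xs ‖
      ‖cached‖ xs = ‖‖-cong (cached-correct xs)

      -- For a fixed sample the honest run is deterministic up to the subprotocol: the sample
      -- decodes, the cache fills, and the claim fits its width and is read back unchanged.
      ℙ-honest : ∀ b σ xs →
        ℙ[decision b ] (run D f (afterSampling σ xs) (Protocol.honest (Π enc εc εf δ sub) σ)) ≡
        ℙ[decision b ] (run D f (afterClaim σ xs ‖ cached xs ‖)
                                (answering (cached xs) (Sub.honest ‖ cached xs ‖)))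
      ℙ-honest b σ xs = begin
        ℙ[decision b ] (run D f (recv width next) (respond (decodeSample enc m (encodeSample enc xs))))
          ≡⟨ cong (λ ys → ℙ[decision b ] (run D f (recv width next) (respond ys))) (decodeSample-encodeSample enc xs) ⟩
        ℙ[decision b ] (run D f (recv width next) (respond xs))
          ≡⟨ ℙ-queryAll D f b width next (distinct xs) (const false) (withCache xs) ⟩
        ℙ[decision b ] (run D f (recv width next) (send claim reply))
          ≡⟨ cong ℙ[decision b ] (if-yes (length claim ℕ.≤? width) (ℕ.≤-reflexive (length-toBits width W))) ⟩
        ℙ[decision b ] (run D f (afterClaim σ xs (fromBits claim)) reply)
          ≡⟨ cong (λ k → ℙ[decision b ] (run D f (afterClaim σ xs k) reply)) (fromBits-toBits width W W<2^width) ⟩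
        ℙ[decision b ] (run D f (afterClaim σ xs W) reply) ∎
        where
        open ≡-Reasoning
        next : List Bool → Verifier N blackBox
        next w = afterClaim σ xs (fromBits w)
        W : ℕ
        W = ‖ cached xs ‖
        claim : List Bool
        claim = toBits width W
        reply : Prover N blackBox
        reply = answering (cached xs) (Sub.honest W)
        -- A weight takes one of m + 1 values, whence `suc m` under the logarithm.
        W<2^width : W ℕ.< 2 ℕ.^ width
        W<2^width = ℕ.≤-trans (ℕ.s≤s (‖‖-≤ (cached xs))) (n≤2^⌈log₂n⌉ (suc m))

      ℙ[reject]-honest : IsExactHamming sub (g ÷ fromℕ 4) δ → ∀ σ xs →
        ∣ fromℕ ‖ f ∘ lookup xs ‖ ÷ fromℕ m - σ ∣ ≤ εc + g ÷ fromℕ 2 →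
        ℙ[reject] (run D f (afterSampling σ xs) (Protocol.honest (Π enc εc εf δ sub) σ)) ≤ δ
      ℙ[reject]-honest exact σ xs near = begin
        ℙ[reject] (run D f (afterSampling σ xs) (Protocol.honest (Π enc εc εf δ sub) σ))
          ≡⟨ ℙ-honest false σ xs ⟩
        ℙ[reject] (run D f (afterClaim σ xs W) (answering (cached xs) (Sub.honest W)))
          ≡⟨ cong (λ v → ℙ[reject] (run D f v (answering (cached xs) (Sub.honest W))))
               (if-both-yes (W ℕ.≤? m) (∣ fromℕ W ÷ fromℕ m - σ ∣ ≤? εc + g ÷ fromℕ 2) (‖‖-≤ (cached xs))
                 (subst (λ k → ∣ fromℕ k ÷ fromℕ m - σ ∣ ≤ εc + g ÷ fromℕ 2) (sym (‖cached‖ xs)) near)) ⟩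
        ℙ[reject] (run D f (onSample xs (Sub.verifier W)) (answering (cached xs) (Sub.honest W)))
          ≡⟨ ℙ-answering D f xs (cached-correct xs) false (Sub.verifier W) (Sub.honest W) ⟩
        ℙ[reject] t
          ≤⟨ ≤-via (IsExactHamming.complete exact (cached xs) W (‖‖-≤ (cached xs)) refl)
               (trans (cong (λ x → δ - x) (reject≡ (ℙ-total t)))
                 (solve 2 (λ δ a → δ :- (one :- a) := a :- (one :- δ)) refl δ (ℙ[accept] t))) ⟩
        δ ∎
        where
        open ≤-Reasoning
        W : ℕ
        W = ‖ cached xs ‖
        t : Execution m
        t = run tt (cached xs) (Sub.verifier W) (Sub.honest W)
        reject≡ : ∀ {a r} → a + r ≡ 1# → r ≡ 1# - a
        reject≡ {a} {r} eq = trans (solve 2 (λ a r → r := (a :+ r) :- a) refl a r) (cong (_- a) eq)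

      -- The prover sees the sample before it commits to a claim, so the sample mean has to be far
      -- from every claim that passes the threshold test at once.
      ℙ[accept]-cheating : IsExactHamming sub (g ÷ fromℕ 4) δ → 0# ≤ δ → ∀ σ xs →
        (∀ w → ∣ w - σ ∣ ≤ εc + g ÷ fromℕ 2 → g ÷ fromℕ 4 < ∣ fromℕ ‖ f ∘ lookup xs ‖ ÷ fromℕ m - w ∣) →
        ∀ P → ℙ[accept] (run D f (afterSampling σ xs) P) ≤ δ
      ℙ[accept]-cheating exact 0≤δ σ xs far =
        ℙ[accept]-send D f 0≤δ _ _ (ℙ[accept]-recv D f 0≤δ _ _ λ w P →
          if-both (fromBits w ℕ.≤? m) (∣ fromℕ (fromBits w) ÷ fromℕ m - σ ∣ ≤? εc + g ÷ fromℕ 2)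
            (λ v → ℙ[accept] (run D f v P) ≤ δ)
            (λ W≤m near → ≤-trans (≤-reflexive (ℙ-onSample D f xs true (Sub.verifier (fromBits w)) P))
              (IsExactHamming.sound exact (f ∘ lookup xs) (fromBits w) W≤m
                (far (fromℕ (fromBits w) ÷ fromℕ m) near) (embed D f P)))
            0≤δ)

  tail-≤ : ∀ {n} {D : Distribution n} {m B v d} → 0# < v → v * d ≡ fromℕ 2 → TailBound D m B v →
    ∃ λ u → (∀ xs → 0# ≤ u xs) × (∀ xs → B xs → 1# ≤ u xs) × 𝔼ⁿ D m u ≤ d
  tail-≤ 0<v vd≡2 (u , 0≤u , 1≤u , vE≤2) = u , 0≤u , 1≤u ,
    *-cancelˡ-≤ 0<v (≤-trans vE≤2 (≤-reflexive (sym vd≡2)))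

  module _ {N ℓ : ℕ} (enc : Encoding N ℓ) (εc εf δ : ℝ) (admissible : Admissible εc εf δ)
           (sub : HammingProtocol (sampleSize δ (εf - εc)))
           (exact : IsExactHamming sub ((εf - εc) ÷ fromℕ 4) δ) where
    private
      π : Protocol N
      π = Π enc εc εf δ sub
      g : ℝ
      g = εf - εc
      m : ℕ
      m = sampleSize δ g
      0<δ : 0# < δ
      0<δ = proj₁ (proj₂ (proj₂ (proj₂ admissible)))
      0≤δ : 0# ≤ δ
      0≤δ = <⇒≤ 0<δ
      δ<¼ : δ < 1# ÷ fromℕ 4
      δ<¼ = proj₂ (proj₂ (proj₂ (proj₂ admissible)))
      0<g : 0# < g
      0<g = x<y⇒0<y-x (proj₁ (proj₂ admissible))
      L v : ℝ
      L = ln (fromℕ 2 ÷ δ)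
      v = fromℕ 2 ÷ δ
      0<v : 0# < v
      0<v = ÷-pos (fromℕ-pos 1) 0<δ
      1≤L : 1# ≤ L
      1≤L = 1≤ln (4<2÷δ 0<δ δ<¼)
      0≤L : 0# ≤ L
      0≤L = ≤-trans 0≤1 1≤L
      L≥v : ExpAtLeast L v
      L≥v = limit⇒ExpAtLeast (exp-ln v 0<v)
      8L≤mg² : fromℕ 8 * L ≤ fromℕ m * (g * g)
      8L≤mg² = 8ln≤mg² δ g 0<g
      0<m : 0# < fromℕ m
      0<m = ≰⇒> λ m≤0 → <⇒≱ (<-≤-trans (*-pos (fromℕ-pos 7) (<-≤-trans 0<1 1≤L)) 8L≤mg²)
        (≤-trans (*-monoˡ-≤ (square-nonNeg g) m≤0) (≤-reflexive (zeroˡ (g * g))))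

      quarter half : ℝ
      quarter = g ÷ fromℕ 4
      half    = g ÷ fromℕ 2
      4*quarter : fromℕ 4 * quarter ≡ g
      4*quarter = trans (*-comm _ quarter) (÷-cancelʳ (fromℕ-nonZero 3) g)
      2*half : fromℕ 2 * half ≡ g
      2*half = trans (*-comm _ half) (÷-cancelʳ (fromℕ-nonZero 1) g)
      0≤quarter : 0# ≤ quarter
      0≤quarter = ÷-nonNeg (<⇒≤ 0<g) (fromℕ-pos 3)
      0≤half : 0# ≤ half
      0≤half = ÷-nonNeg (<⇒≤ 0<g) (fromℕ-pos 1)
      half≡ : half ≡ fromℕ 2 * quarter
      half≡ = begin
        half                            ≡⟨ sym (*-cancelʳ (fromℕ-nonZero 1) half) ⟩
        half * fromℕ 2 ÷ fromℕ 2        ≡⟨ cong (_÷ fromℕ 2) (trans (*-comm half _) (trans 2*half (sym 4*quarter))) ⟩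
        fromℕ 4 * quarter ÷ fromℕ 2     ≡⟨ cong (_÷ fromℕ 2) (solve 1 (λ q → nat 4 :* q := (nat 2 :* q) :* nat 2) refl quarter) ⟩
        fromℕ 2 * quarter * fromℕ 2 ÷ fromℕ 2 ≡⟨ *-cancelʳ (fromℕ-nonZero 1) _ ⟩
        fromℕ 2 * quarter               ∎
        where open ≡-Reasoning

      -- `2 m (g/4)² = m g² / 8`: the origin of the 8 in the sample size.
      L≤2m·quarter² : L ≤ fromℕ 2 * (fromℕ m * (quarter * quarter))
      L≤2m·quarter² = *-cancelˡ-≤ (fromℕ-pos 7) (≤-trans 8L≤mg² (≤-reflexive (trans
        (cong (λ x → fromℕ m * (x * x)) (sym 4*quarter))
        (solve 2 (λ m q → m :* ((nat 4 :* q) :* (nat 4 :* q)) := nat 8 :* (nat 2 :* (m :* (q :* q)))) refl (fromℕ m) quarter))))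

      -- `2 m (g/2)² = m g² / 2 ≥ 4 L`, and `L ≥ 1`. The additional 1 in the exponent pays for the
      -- union bound over two tails.
      L+1≤2m·half² : L + 1# ≤ fromℕ 2 * (fromℕ m * (half * half))
      L+1≤2m·half² = *-cancelˡ-≤ (fromℕ-pos 1) (≤-trans
        (≤-via (+-mono-≤ (+-mono-≤ 1≤L 1≤L) (+-nonNeg 0≤L (+-nonNeg 0≤L (+-nonNeg 0≤L 0≤L))))
          (solve 1 (λ L → nat 8 :* L :- nat 2 :* (L :+ one) := (L :+ L :+ (L :+ (L :+ (L :+ L)))) :- (one :+ one :+ nat 0)) refl L))
        (≤-trans 8L≤mg² (≤-reflexive (trans
          (cong (λ x → fromℕ m * (x * x)) (sym 2*half))
          (solve 2 (λ m h → m :* ((nat 2 :* h) :* (nat 2 :* h)) := nat 2 :* (nat 2 :* (m :* (h :* h)))) refl (fromℕ m) half)))))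

    module _ (D : Distribution N) (f : Fin N → Bool) (σ : ℝ) where
      private
        p : ℝ
        p = wt D f
        mean : Vec (Fin N) m → ℝ
        mean xs = fromℕ ‖ f ∘ lookup xs ‖ ÷ fromℕ m

        mean-> : ∀ xs {x} → fromℕ m * x < fromℕ ‖ f ∘ lookup xs ‖ → x < mean xs
        mean-> xs {x} h = <-÷ 0<m (subst (_< fromℕ ‖ f ∘ lookup xs ‖) (*-comm (fromℕ m) x) h)

        mean-< : ∀ xs {x} → fromℕ ‖ f ∘ lookup xs ‖ < fromℕ m * x → mean xs < x
        mean-< xs {x} h = ÷-< 0<m (subst (fromℕ ‖ f ∘ lookup xs ‖ <_) (*-comm (fromℕ m) x) h)

        accept : Prover N blackBox → Vec (Fin N) m → ℝ
        accept P xs = ℙ[accept] (run D f (afterSampling enc εc εf δ sub σ xs) P)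

        reject : Vec (Fin N) m → ℝ
        reject xs = ℙ[reject] (run D f (afterSampling enc εc εf δ sub σ xs) (Protocol.honest π σ))

      -- `δ + u` dominates the acceptance probability sample by sample: u covers the bad samples,
      -- and the subprotocol's error δ the others.
      sound-via-tail : ∀ (B : Vec (Fin N) m → Set) → TailBound D m B v →
        (∀ xs → B xs ⊎ (∀ w → ∣ w - σ ∣ ≤ εc + half → quarter < ∣ mean xs - w ∣)) →
        ∀ P → ℙ[accept] (run D f (Protocol.verifier π σ) P) ≤ fromℕ 2 * δ
      sound-via-tail B tail decide P = begin
        ℙ[accept] (run D f (Protocol.verifier π σ) P)   ≡⟨ ℙ-drawMany D f true m (afterSampling enc εc εf δ sub σ) P ⟩
        𝔼ⁿ D m (accept P)                               ≤⟨ 𝔼ⁿ-mono-≤ D m (λ xs → pointwise xs (decide xs)) ⟩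
        𝔼ⁿ D m (λ xs → δ + u xs)                        ≡⟨ trans (𝔼ⁿ-+ D m (const δ) u) (cong (_+ 𝔼ⁿ D m u) (𝔼ⁿ-const D m δ)) ⟩
        δ + 𝔼ⁿ D m u                                    ≤⟨ +-monoʳ-≤ δ (proj₂ (proj₂ (proj₂ tail′))) ⟩
        δ + δ                                           ≡⟨ solve 1 (λ δ → δ :+ δ := nat 2 :* δ) refl δ ⟩
        fromℕ 2 * δ                                     ∎
        where
        open ≤-Reasoning
        tail′ = tail-≤ {D = D} {m} {B} 0<v (÷-cancelʳ (>⇒≢0 0<δ) (fromℕ 2)) tail
        u : Vec (Fin N) m → ℝ
        u = proj₁ tail′
        pointwise : ∀ xs → B xs ⊎ (∀ w → ∣ w - σ ∣ ≤ εc + half → quarter < ∣ mean xs - w ∣) →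
          accept P xs ≤ δ + u xs
        pointwise xs (inj₁ bad) = ≤-trans (ℙ[accept]≤1 (run D f (afterSampling enc εc εf δ sub σ xs) P))
          (≤-trans (proj₁ (proj₂ (proj₂ tail′)) xs bad) (≤-trans (x≤x+y 0≤δ) (≤-reflexive (+-comm _ δ))))
        pointwise xs (inj₂ far) = ≤-trans
          (ℙ[accept]-cheating enc εc εf δ sub D f exact 0≤δ σ xs far P) (x≤x+y (proj₁ (proj₂ tail′) xs))

      -- The sign of `p - σ` selects the single tail to be charged. Of the distance g between the
      -- two thresholds, the test consumes g/2 and the sampling error g/4, which leaves g/4 to the
      -- subprotocol.
      sound : εf < Δ D f σ → ∀ P → ℙ[accept] (run D f (Protocol.verifier π σ) P) ≤ fromℕ 2 * δ
      sound εf<Δ = cases (∣∣-split (p - σ))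
        where
        cases : ∣ p - σ ∣ ≡ p - σ ⊎ ∣ p - σ ∣ ≡ - (p - σ) →
          ∀ P → ℙ[accept] (run D f (Protocol.verifier π σ) P) ≤ fromℕ 2 * δ
        cases (inj₁ eq) = sound-via-tail (λ xs → fromℕ ‖ f ∘ lookup xs ‖ ≤ fromℕ m * (p - quarter))
          (lower-tail D m f 0≤quarter 0≤L L≤2m·quarter² L≥v) decide
          where
          εf<p-σ : εf < p - σ
          εf<p-σ = subst (εf <_) eq εf<Δ
          decide : ∀ xs → _ ⊎ (∀ w → ∣ w - σ ∣ ≤ εc + half → quarter < ∣ mean xs - w ∣)
          decide xs with ≤-or-> (fromℕ ‖ f ∘ lookup xs ‖) (fromℕ m * (p - quarter))
          ... | inj₁ bad  = inj₁ bad
          -- Otherwise `p - σ`, split at the mean and at w, would be less than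
          -- `g/4 + g/4 + (εc + g/2) = εf`.
          ... | inj₂ good = inj₂ λ w near → <-≤-trans
            (≰⇒> λ y-w≤q → <⇒≱ (mean-> xs good) (≤-via
              (+-mono-≤ (+-mono-≤ (<⇒≤ εf<p-σ) (≤-trans (x≤∣x∣ (w - σ)) near)) y-w≤q)
              (trans (solve 7 (λ p q y εf εc w σ → (p :- q) :- y
                 := ((p :- σ :+ (εc :+ nat 2 :* q) :+ q) :- (εf :+ (w :- σ) :+ (y :- w))) :+ ((εf :- εc) :- nat 4 :* q))
                 refl p quarter (mean xs) εf εc w σ)
                (trans (cong₂ (λ x z → ((p - σ + (εc + x) + quarter) - (εf + (w - σ) + (mean xs - w))) + (g - z)) (sym half≡) 4*quarter)
                  (x+[y-y]≡x _ g)))))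
            (x≤∣x∣ (mean xs - w))
        cases (inj₂ eq) = sound-via-tail (λ xs → fromℕ m * (p + quarter) ≤ fromℕ ‖ f ∘ lookup xs ‖)
          (upper-tail D m f 0≤quarter 0≤L L≤2m·quarter² L≥v) decide
          where
          εf<σ-p : εf < - (p - σ)
          εf<σ-p = subst (εf <_) eq εf<Δ
          decide : ∀ xs → _ ⊎ (∀ w → ∣ w - σ ∣ ≤ εc + half → quarter < ∣ mean xs - w ∣)
          decide xs with ≤-or-> (fromℕ m * (p + quarter)) (fromℕ ‖ f ∘ lookup xs ‖)
          ... | inj₁ bad  = inj₁ bad
          ... | inj₂ good = inj₂ λ w near → <-≤-trans
            (≰⇒> λ w-y≤q → <⇒≱ (mean-< xs good) (≤-via
              (+-mono-≤ (+-mono-≤ (<⇒≤ εf<σ-p) (≤-trans (-x≤∣x∣ (w - σ)) near)) w-y≤q)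
              (trans (solve 7 (λ p q y εf εc w σ → y :- (p :+ q)
                 := (((:- (p :- σ)) :+ (εc :+ nat 2 :* q) :+ q) :- (εf :+ (:- (w :- σ)) :+ (:- (y :- w)))) :+ ((εf :- εc) :- nat 4 :* q))
                 refl p quarter (mean xs) εf εc w σ)
                (trans (cong₂ (λ x z → ((- (p - σ) + (εc + x) + quarter) - (εf + - (w - σ) + - (mean xs - w))) + (g - z)) (sym half≡) 4*quarter)
                  (x+[y-y]≡x _ g)))))
            (-x≤∣x∣ (mean xs - w))

      complete : Δ D f σ ≤ εc → ℙ[reject] (run D f (Protocol.verifier π σ) (Protocol.honest π σ)) ≤ fromℕ 2 * δ
      complete Δ≤εc = begin
        ℙ[reject] (run D f (Protocol.verifier π σ) (Protocol.honest π σ))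
          ≡⟨ ℙ-drawMany D f false m (afterSampling enc εc εf δ sub σ) (Protocol.honest π σ) ⟩
        𝔼ⁿ D m reject
          ≤⟨ 𝔼ⁿ-mono-≤ D m pointwise ⟩
        𝔼ⁿ D m (λ xs → δ + (u₁ xs + u₂ xs))
          ≡⟨ trans (𝔼ⁿ-+ D m (const δ) (λ xs → u₁ xs + u₂ xs)) (cong₂ _+_ (𝔼ⁿ-const D m δ) (𝔼ⁿ-+ D m u₁ u₂)) ⟩
        δ + (𝔼ⁿ D m u₁ + 𝔼ⁿ D m u₂)
          ≤⟨ +-monoʳ-≤ δ (+-mono-≤ (proj₂ (proj₂ (proj₂ tail₁))) (proj₂ (proj₂ (proj₂ tail₂)))) ⟩
        δ + (d + d)
          ≡⟨ solve 2 (λ δ d → δ :+ (d :+ d) := δ :+ nat 2 :* d) refl δ d ⟩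
        δ + fromℕ 2 * d
          ≡⟨ cong (δ +_) 2d≡δ ⟩
        δ + δ
          ≡⟨ solve 1 (λ δ → δ :+ δ := nat 2 :* δ) refl δ ⟩
        fromℕ 2 * δ ∎
        where
        open ≤-Reasoning
        -- Each of the two tails may cost δ/2, which asks for `v′ = 4/δ`; it is written
        -- `(1# + 1#) * v` to match `ExpAtLeast-grow` at step 1.
        d v′ : ℝ
        d  = δ ÷ fromℕ 2
        v′ = (1# + 1#) * v
        2d≡δ : fromℕ 2 * d ≡ δ
        2d≡δ = trans (*-comm _ d) (÷-cancelʳ (fromℕ-nonZero 1) δ)
        0<v′ : 0# < v′
        0<v′ = *-pos (<-≤-trans 0<1 (x≤x+y 0≤1)) 0<v
        v′d≡2 : v′ * d ≡ fromℕ 2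
        v′d≡2 = trans (solve 2 (λ v d → ((one :+ one) :* v) :* d := v :* (nat 2 :* d)) refl v d)
          (trans (cong (v *_) 2d≡δ) (÷-cancelʳ (>⇒≢0 0<δ) (fromℕ 2)))
        L+1≥v′ : ExpAtLeast (L + 1#) v′
        L+1≥v′ = ExpAtLeast-grow 0≤L 0≤1 L≥v
        Low High : Vec (Fin N) m → Set
        Low  xs = fromℕ ‖ f ∘ lookup xs ‖ ≤ fromℕ m * (p - half)
        High xs = fromℕ m * (p + half) ≤ fromℕ ‖ f ∘ lookup xs ‖
        tail₁ = tail-≤ {D = D} {m} {Low} 0<v′ v′d≡2 (lower-tail D m f 0≤half (+-nonNeg 0≤L 0≤1) L+1≤2m·half² L+1≥v′)
        tail₂ = tail-≤ {D = D} {m} {High} 0<v′ v′d≡2 (upper-tail D m f 0≤half (+-nonNeg 0≤L 0≤1) L+1≤2m·half² L+1≥v′)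
        u₁ u₂ : Vec (Fin N) m → ℝ
        u₁ = proj₁ tail₁
        u₂ = proj₁ tail₂
        0≤u₁ : ∀ xs → 0# ≤ u₁ xs
        0≤u₁ = proj₁ (proj₂ tail₁)
        0≤u₂ : ∀ xs → 0# ≤ u₂ xs
        0≤u₂ = proj₁ (proj₂ tail₂)
        pointwise : ∀ xs → reject xs ≤ δ + (u₁ xs + u₂ xs)
        pointwise xs with ≤-or-> (fromℕ ‖ f ∘ lookup xs ‖) (fromℕ m * (p - half))
                        | ≤-or-> (fromℕ m * (p + half)) (fromℕ ‖ f ∘ lookup xs ‖)
        ... | inj₁ low | _ = ≤-trans (ℙ[reject]≤1 (run D f (afterSampling enc εc εf δ sub σ xs) (Protocol.honest π σ))) (≤-via
          (+-mono-≤ (+-mono-≤ (proj₁ (proj₂ (proj₂ tail₁)) xs low) 0≤δ) (0≤u₂ xs))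
          (solve 3 (λ δ u w → (δ :+ (u :+ w)) :- one := (u :+ δ :+ w) :- (one :+ nat 0 :+ nat 0)) refl δ (u₁ xs) (u₂ xs)))
        ... | _ | inj₁ high = ≤-trans (ℙ[reject]≤1 (run D f (afterSampling enc εc εf δ sub σ xs) (Protocol.honest π σ))) (≤-via
          (+-mono-≤ (+-mono-≤ (proj₁ (proj₂ (proj₂ tail₂)) xs high) 0≤δ) (0≤u₁ xs))
          (solve 3 (λ δ u w → (δ :+ (u :+ w)) :- one := (w :+ δ :+ u) :- (one :+ nat 0 :+ nat 0)) refl δ (u₁ xs) (u₂ xs)))
        ... | inj₂ above | inj₂ below = ≤-trans
          (ℙ[reject]-honest enc εc εf δ sub D f exact σ xs (∣∣-≤
            (≤-via (+-mono-≤ (<⇒≤ (mean-< xs below)) (≤-trans (x≤∣x∣ (p - σ)) Δ≤εc))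
              (solve 5 (λ y p h e σ → (e :+ h) :- (y :- σ) := ((p :+ h) :+ e) :- (y :+ (p :- σ))) refl (mean xs) p half εc σ))
            (≤-via (+-mono-≤ (<⇒≤ (mean-> xs above)) (≤-trans (-x≤∣x∣ (p - σ)) Δ≤εc))
              (solve 5 (λ y p h e σ → (e :+ h) :- (:- (y :- σ)) := (y :+ e) :- ((p :- h) :+ (:- (p :- σ)))) refl (mean xs) p half εc σ))))
          (x≤x+y (+-nonNeg (0≤u₁ xs) (0≤u₂ xs)))

    interactive : δ ≤ 1# ÷ fromℕ 6 → IsInteractiveProof π εc εf
    interactive δ≤⅙ D f σ _ _ =
      (λ Δ≤εc → ≤-via (≤-trans (complete D f σ Δ≤εc) 2δ≤⅓) (accept-reject (ℙ-total (run D f (Protocol.verifier π σ) (Protocol.honest π σ))))) ,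
      (λ εf<Δ P → ≤-trans (sound D f σ εf<Δ P) 2δ≤⅓)
      where
      third : ℝ
      third = 1# ÷ fromℕ 3
      3*third : fromℕ 3 * third ≡ 1#
      3*third = trans (*-comm _ third) (÷-cancelʳ (fromℕ-nonZero 2) 1#)
      2δ≤⅓ : fromℕ 2 * δ ≤ third
      2δ≤⅓ = ≤-÷ (fromℕ-pos 2) (begin
        fromℕ 2 * δ * fromℕ 3       ≡⟨ solve 1 (λ δ → nat 2 :* δ :* nat 3 := δ :* nat 6) refl δ ⟩
        δ * fromℕ 6                 ≤⟨ *-monoˡ-≤ (fromℕ-nonNeg 6) δ≤⅙ ⟩
        (1# ÷ fromℕ 6) * fromℕ 6    ≡⟨ ÷-cancelʳ (fromℕ-nonZero 5) 1# ⟩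
        1#                          ∎)
        where open ≤-Reasoning
      accept-reject : ∀ {a r} → a + r ≡ 1# → a - fromℕ 2 ÷ fromℕ 3 ≡ third - r
      accept-reject {a} {r} a+r≡1 = begin
        a - fromℕ 2 ÷ fromℕ 3              ≡⟨ cong (λ x → a - fromℕ 2 * x) (sym (*-identityˡ (fromℕ 3 ⁻¹))) ⟩
        a - fromℕ 2 * third                ≡⟨ solve 3 (λ a r t → a :- nat 2 :* t := (a :+ r) :- nat 3 :* t :+ (t :- r)) refl a r third ⟩
        (a + r) - fromℕ 3 * third + (third - r) ≡⟨ cong₂ (λ x y → x - y + (third - r)) a+r≡1 3*third ⟩
        1# - 1# + (third - r)              ≡⟨ solve 1 (λ x → one :- one :+ x := x) refl (third - r) ⟩
        third - r                          ∎
        where open ≡-Reasoning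

-- Samples, queries, communication and rounds.

module Resources (F : CompleteOrderedField) (logarithm : Reals.Logarithm F) where
  open WeightVerification F logarithm
  open OrderedFieldProperties orderedField
  open RealProperties F
  open Exponential F
  open LogarithmProperties logarithm
  open Interaction F logarithm
  open Protocol-Π F logarithm

  square≤1 : ∀ {g} → 0# ≤ g → g ≤ 1# → g * g ≤ 1#
  square≤1 0≤g g≤1 = ≤-trans (*-mono-≤ 0≤1 0≤g g≤1 g≤1) (≤-reflexive (*-identityˡ 1#))

  ln[2÷δ]≤ : ∀ {δ} → 0# < δ → δ < 1# ÷ fromℕ 4 → ln (fromℕ 2 ÷ δ) ≤ fromℕ 2 * ln (1# ÷ δ)
  ln[2÷δ]≤ {δ} 0<δ δ<¼ = begin
    ln (fromℕ 2 ÷ δ)             ≡⟨ cong ln (2÷δ≡2*[1÷δ] δ) ⟩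
    ln (fromℕ 2 * (1# ÷ δ))      ≤⟨ ln-double (4<1÷δ 0<δ δ<¼) ⟩
    ln (1# ÷ δ) + 1#             ≤⟨ +-monoʳ-≤ _ (1≤ln (4<1÷δ 0<δ δ<¼)) ⟩
    ln (1# ÷ δ) + ln (1# ÷ δ)    ≡⟨ solve 1 (λ a → a :+ a := nat 2 :* a) refl (ln (1# ÷ δ)) ⟩
    fromℕ 2 * ln (1# ÷ δ)        ∎
    where open ≤-Reasoning

  -- 17 = 1 + 8 · 2: rounding up costs 1, which is at most ln(1/δ)/g², and ln(2/δ) is at most 2
  -- ln(1/δ).
  sampleSize≤ : ∀ δ g → 0# < δ → δ < 1# ÷ fromℕ 4 → 0# < g → g ≤ 1# →
    fromℕ (sampleSize δ g) ≤ fromℕ 17 * (ln (1# ÷ δ) ÷ (g * g))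
  sampleSize≤ δ g 0<δ δ<¼ 0<g g≤1 = begin
    fromℕ (sampleSize δ g)                      ≤⟨ ⌈x⌉≤1+x (÷-nonNeg (*-nonNeg (fromℕ-nonNeg 8)
                                                     (≤-trans 0≤1 (1≤ln (4<2÷δ 0<δ δ<¼)))) 0<gg) ⟩
    1# + fromℕ 8 * ln (fromℕ 2 ÷ δ) ÷ (g * g)   ≤⟨ +-mono-≤
        (≤-÷ 0<gg (≤-trans (≤-reflexive (*-identityˡ _)) (≤-trans (square≤1 (<⇒≤ 0<g) g≤1) 1≤a)))
        (*-monoˡ-≤ (<⇒≤ (⁻¹-pos 0<gg)) (*-monoʳ-≤ (fromℕ-nonNeg 8) (ln[2÷δ]≤ 0<δ δ<¼))) ⟩
    a ÷ (g * g) + fromℕ 8 * (fromℕ 2 * a) ÷ (g * g) ≡⟨ solve 2 (λ a i → a :* i :+ nat 8 :* (nat 2 :* a) :* i := nat 17 :* (a :* i)) refl a ((g * g) ⁻¹) ⟩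
    fromℕ 17 * (a ÷ (g * g))                    ∎
    where
    open ≤-Reasoning
    a : ℝ
    a = ln (1# ÷ δ)
    1≤a : 1# ≤ a
    1≤a = 1≤ln (4<1÷δ 0<δ δ<¼)
    0<gg : 0# < g * g
    0<gg = *-pos 0<g 0<g

  claimWidth : ℝ → ℝ → ℕ
  claimWidth δ g = ⌈log₂ suc (sampleSize δ g) ⌉

  -- A crude but sufficient bound: the width is logarithmic in 1 / g.
  claimWidth≤ : ∀ δ g → 0# < δ → δ < 1# ÷ fromℕ 4 → 0# < g → g ≤ 1# →
    fromℕ (claimWidth δ g) ≤ fromℕ 38 * ln (1# ÷ δ) * (1# ÷ g)
  claimWidth≤ δ g 0<δ δ<¼ 0<g g≤1 = begin
    fromℕ (claimWidth δ g)                    ≤⟨ fromℕ-mono-≤ (⌈log₂⌉-≤-√ (suc m) k (fromℕ-cancel-≤ {suc m} {k ℕ.* k} 1+m≤k²)) ⟩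
    fromℕ (k ℕ.+ k)                           ≡⟨ fromℕ-+ k k ⟩
    fromℕ k + fromℕ k                         ≤⟨ +-mono-≤ k≤ k≤ ⟩
    fromℕ 19 * (a ÷ g) + fromℕ 19 * (a ÷ g)   ≡⟨ solve 2 (λ a i → nat 19 :* (a :* i) :+ nat 19 :* (a :* i) := nat 38 :* a :* (one :* i)) refl a (g ⁻¹) ⟩
    fromℕ 38 * a * (1# ÷ g)                   ∎
    where
    open ≤-Reasoning
    a c : ℝ
    a = ln (1# ÷ δ)
    -- 18 = 1 + 17 bounds m + 1, and `18 a ≥ 1` gives `18 a / g² ≤ c²`. Rounding c up makes 19, and
    -- doubling makes 38.
    c = fromℕ 18 * a ÷ g
    m k : ℕ
    m = sampleSize δ g
    k = ⌈ c ⌉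
    1≤a : 1# ≤ a
    1≤a = 1≤ln (4<1÷δ 0<δ δ<¼)
    0≤a : 0# ≤ a
    0≤a = ≤-trans 0≤1 1≤a
    0<gg : 0# < g * g
    0<gg = *-pos 0<g 0<g
    0≤c : 0# ≤ c
    0≤c = ÷-nonNeg (*-nonNeg (fromℕ-nonNeg 18) 0≤a) 0<g
    c*g≡ : c * g ≡ fromℕ 18 * a
    c*g≡ = ÷-cancelʳ (>⇒≢0 0<g) (fromℕ 18 * a)
    1≤18a : 1# ≤ fromℕ 18 * a
    1≤18a = ≤-trans 1≤a (≤-via (*-nonNeg (fromℕ-nonNeg 17) 0≤a)
      (solve 1 (λ a → nat 18 :* a :- a := nat 17 :* a :- nat 0) refl a))
    k≤ : fromℕ k ≤ fromℕ 19 * (a ÷ g)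
    k≤ = ≤-trans (⌈x⌉≤1+x 0≤c) (≤-trans
      (+-monoˡ-≤ c (≤-÷ 0<g (≤-trans (≤-reflexive (*-identityˡ g)) (≤-trans g≤1 1≤a))))
      (≤-reflexive (solve 2 (λ a i → a :* i :+ nat 18 :* a :* i := nat 19 :* (a :* i)) refl a (g ⁻¹))))
    1+m≤k² : fromℕ (suc m) ≤ fromℕ (k ℕ.* k)
    1+m≤k² = begin
      1# + fromℕ m                              ≤⟨ +-mono-≤ (≤-÷ 0<gg (≤-trans (≤-reflexive (*-identityˡ _))
                                                     (≤-trans (square≤1 (<⇒≤ 0<g) g≤1) 1≤a))) (sampleSize≤ δ g 0<δ δ<¼ 0<g g≤1) ⟩
      a ÷ (g * g) + fromℕ 17 * (a ÷ (g * g))    ≡⟨ solve 2 (λ a i → a :* i :+ nat 17 :* (a :* i) := nat 18 :* a :* i) refl a ((g * g) ⁻¹) ⟩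
      fromℕ 18 * a ÷ (g * g)                    ≤⟨ ÷-≤ 0<gg (begin
        fromℕ 18 * a                              ≤⟨ ≤-trans (≤-reflexive (sym (*-identityˡ _)))
                                                       (*-monoˡ-≤ (≤-trans 0≤1 1≤18a) 1≤18a) ⟩
        fromℕ 18 * a * (fromℕ 18 * a)             ≡⟨ cong (λ x → x * x) (sym c*g≡) ⟩
        c * g * (c * g)                           ≡⟨ solve 2 (λ c g → c :* g :* (c :* g) := (c :* c) :* (g :* g)) refl c g ⟩
        c * c * (g * g)                           ∎) ⟩
      c * c                                     ≤⟨ *-mono-≤ (fromℕ-nonNeg k) 0≤c (x≤⌈x⌉ c) (x≤⌈x⌉ c) ⟩
      fromℕ k * fromℕ k                         ≡⟨ sym (fromℕ-* k k) ⟩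
      fromℕ (k ℕ.* k)                           ∎

  smaller : ∀ {x y} → 0# < x → 0# < y → ∃ λ z → 0# < z × z ≤ x × z ≤ y
  smaller {x} {y} 0<x 0<y with ≤-total x y
  ... | inj₁ x≤y = x , 0<x , ≤-refl , x≤y
  ... | inj₂ y≤x = y , 0<y , y≤x , ≤-refl

  -- For g at most 1/5 one has 1/g > 4 and hence ln(1/g) ≥ 1, so the width, of order 1/g, can be
  -- multiplied by the polylogarithmic factor that h carries.
  claimWidth+-Õ : ∀ δ h → 0# < δ → δ < 1# ÷ fromℕ 4 → h ∈Õ[ (λ g → 1# ÷ g) ] →
    (λ g → claimWidth δ g ℕ.+ h g) ∈Õ[ (λ g → 1# ÷ g) ]
  claimWidth+-Õ δ h 0<δ δ<¼ (k , C , g₀ , 0<g₀ , h≤) with smaller 0<g₀ (÷-pos 0<1 (fromℕ-pos 4))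
  ... | g₁ , 0<g₁ , g₁≤g₀ , g₁≤⅕ = k , W + C , g₁ , 0<g₁ , bound
    where
    W : ℝ
    W = fromℕ 38 * ln (1# ÷ δ)
    bound : ∀ g → 0# < g → g ≤ g₁ → fromℕ (claimWidth δ g ℕ.+ h g) ≤ (W + C) * (1# ÷ g * ln (1# ÷ g) ^ k)
    bound g 0<g g≤g₁ = begin
      fromℕ (claimWidth δ g ℕ.+ h g)                      ≡⟨ fromℕ-+ (claimWidth δ g) (h g) ⟩
      fromℕ (claimWidth δ g) + fromℕ (h g)                ≤⟨ +-mono-≤ (claimWidth≤ δ g 0<δ δ<¼ 0<g g≤1) (h≤ g 0<g (≤-trans g≤g₁ g₁≤g₀)) ⟩
      W * (1# ÷ g) + C * (1# ÷ g * Λ)                     ≤⟨ +-monoˡ-≤ _ (*-monoʳ-≤ 0≤W (≤-trans (≤-reflexive (sym (*-identityʳ _)))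
                                                               (*-monoʳ-≤ (÷-nonNeg 0≤1 0<g) (1≤x^n k (1≤ln 4<1÷g))))) ⟩
      W * (1# ÷ g * Λ) + C * (1# ÷ g * Λ)                 ≡⟨ sym (distribʳ _ W C) ⟩
      (W + C) * (1# ÷ g * Λ)                              ∎
      where
      open ≤-Reasoning
      Λ : ℝ
      Λ = ln (1# ÷ g) ^ k
      0≤W : 0# ≤ W
      0≤W = *-nonNeg (fromℕ-nonNeg 38) (≤-trans 0≤1 (1≤ln (4<1÷δ 0<δ δ<¼)))
      5g≤1 : fromℕ 5 * g ≤ 1#
      5g≤1 = ≤-trans (*-monoʳ-≤ (fromℕ-nonNeg 5) (≤-trans g≤g₁ g₁≤⅕))
        (≤-reflexive (trans (*-comm _ _) (÷-cancelʳ (fromℕ-nonZero 4) 1#)))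
      g≤1 : g ≤ 1#
      g≤1 = ≤-trans (≤-via (*-nonNeg (fromℕ-nonNeg 4) (<⇒≤ 0<g))
        (solve 1 (λ g → nat 5 :* g :- g := nat 4 :* g :- nat 0) refl g)) 5g≤1
      4<1÷g : fromℕ 4 < 1# ÷ g
      4<1÷g = <-÷ 0<g (<-≤-trans (<-via 0<g (solve 1 (λ g → nat 5 :* g :- nat 4 :* g := g :- nat 0) refl g)) 5g≤1)

  module _ (sub : Family) (logarithmic : IsLogarithmicRound sub) where
    open IsLogarithmicRound logarithmic

    bits : ℝ → ℝ → ℕ
    bits δ g = claimWidth δ g ℕ.+ bitBound δ g

    bits-Õ : ∀ δ → 0# < δ → δ < 1# ÷ fromℕ 4 → bits δ ∈Õ[ (λ g → 1# ÷ g) ]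
    bits-Õ δ 0<δ δ<¼ = claimWidth+-Õ δ (bitBound δ) 0<δ δ<¼ (bitBound-Õ δ 0<δ δ<¼)

    -- The two additional rounds are the sample and the claim; the bits of the claim are contained
    -- in `bits`.
    Within : (N ℓ : ℕ) (δ g : ℝ) → ℕ → ℕ → ℕ → Set
    Within N ℓ δ g r q c =
      r ℕ.≤ roundBound δ g ℕ.+ 2 × q ℕ.≤ queryBound δ g × c ℕ.≤ sampleSize δ g ℕ.* ℓ ℕ.+ bits δ g

    0<εf-εc : ∀ {εc εf δ} → Admissible εc εf δ → 0# < εf - εc
    0<εf-εc (_ , εc<εf , _) = x<y⇒0<y-x εc<εf

    εf-εc≤1 : ∀ {εc εf δ} → Admissible εc εf δ → εf - εc ≤ 1#
    εf-εc≤1 {εc} {εf} (0≤εc , _ , εf≤1 , _) = ≤-via (+-mono-≤ 0≤εc εf≤1)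
      (solve 2 (λ c f → one :- (f :- c) := (c :+ one) :- (nat 0 :+ f)) refl εc εf)

    -- The bounds hold against every prover, since those of the subprotocol apply to its embedding.
    everyRun : InEveryRun sub (λ N ℓ δ g es → verifierSamples es ≡ sampleSize δ g × Stats (Within N ℓ δ g) es)
    everyRun {N} {ℓ} enc εc εf δ adm@(_ , _ , _ , 0<δ , δ<¼) D f σ P =
      Always-drawMany-samples D f Q m (afterSampling enc εc εf δ (sub δ g) σ) P λ xs →
        Always-send D f Q (encodeSample enc xs) _ (ℕ.z≤n , ℕ.z≤n , ℕ.z≤n)
          (Always-recv D f (afterMessage (encodeSample enc xs) Q) (claimWidth δ g) _
            -- The run may break off right after the sample has been sent, so one round and `m * ℓ`
            -- bits must already be within the bounds.
            (1≤R+2 , ℕ.z≤n , subst (ℕ._≤ m ℕ.* ℓ ℕ.+ bits δ g) (sym (ℕ.+-identityʳ (length (encodeSample enc xs))))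
                              (ℕ.≤-trans (ℕ.≤-reflexive (length-encodeSample enc xs)) (ℕ.m≤m+n (m ℕ.* ℓ) (bits δ g))))
            λ w P′ w≤ → if-both (fromBits w ℕ.≤? m) (∣ fromℕ (fromBits w) ÷ fromℕ m - σ ∣ ≤? εc + g ÷ fromℕ 2)
              (λ v → Always (NoSampleStats (afterMessage w (afterMessage (encodeSample enc xs) Q))) (run D f v P′))
              (λ W≤m _ → Always-onSample D f xs (afterMessage w (afterMessage (encodeSample enc xs) Q))
                (HammingProtocol.verifier (sub δ g) (fromBits w)) P′
                (Always-map (λ _ (r , q , c) → within xs w w≤ r q c)
                  (run tt (f ∘ lookup xs) (HammingProtocol.verifier (sub δ g) (fromBits w)) (embed D f P′))
                  (bounded δ g 0<δ δ<¼ (0<εf-εc adm) (εf-εc≤1 adm) (f ∘ lookup xs) (fromBits w) W≤m (embed D f P′))))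
              (refl , within xs w w≤ ℕ.z≤n ℕ.z≤n ℕ.z≤n))
          P
      where
      g : ℝ
      g = εf - εc
      m : ℕ
      m = sampleSize δ g
      Q : ℕ → ℕ → ℕ → Set
      Q = Within N ℓ δ g
      1≤R+2 : 1 ℕ.≤ roundBound δ g ℕ.+ 2
      1≤R+2 = ℕ.≤-trans (ℕ.s≤s ℕ.z≤n) (ℕ.m≤n+m 2 (roundBound δ g))
      within : ∀ (xs : Vec (Fin N) m) w → length w ℕ.≤ claimWidth δ g → ∀ {r q c} →
        r ℕ.≤ roundBound δ g → q ℕ.≤ queryBound δ g → c ℕ.≤ bitBound δ g →
        afterMessage w (afterMessage (encodeSample enc xs) Q) r q c
      within xs w w≤ {r} r≤ q≤ c≤ =
        ℕ.≤-trans (ℕ.+-monoʳ-≤ 2 r≤) (ℕ.≤-reflexive (ℕ.+-comm 2 (roundBound δ g))) ,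
        q≤ ,
        ℕ.+-mono-≤ (ℕ.≤-reflexive (length-encodeSample enc xs)) (ℕ.+-mono-≤ w≤ c≤)

    everyRun-implies : ∀ {R : Property} →
      (∀ {N ℓ δ g} → 0# < δ → δ < 1# ÷ fromℕ 4 → 0# < g → g ≤ 1# → ∀ es →
        verifierSamples es ≡ sampleSize δ g × Stats (Within N ℓ δ g) es → R N ℓ δ g es) →
      InEveryRun sub R
    everyRun-implies h enc εc εf δ adm@(_ , _ , _ , 0<δ , δ<¼) D f σ P =
      Always-map (h 0<δ δ<¼ (0<εf-εc adm) (εf-εc≤1 adm))
        (run D f (Protocol.verifier (Π enc εc εf δ (sub δ (εf - εc))) σ) P)
        (everyRun enc εc εf δ adm D f σ P)

    -- The queries are exactly the deduplicated sample, since everything later is answered from the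
    -- cache. Deduplication gives the bound m, and injectivity of the lookup into `Fin N` the bound
    -- N.
    everyHonestRun : InEveryHonestRun sub (λ N ℓ δ g es →
      proverSamples es ≡ 0 × Unique (proverQueries es) × length (proverQueries es) ℕ.≤ sampleSize δ g ⊓ N)
    everyHonestRun {N} enc εc εf δ adm D f σ =
      Always-drawMany D f Q (λ _ q → q) m (afterSampling enc εc εf δ s σ) honest λ xs →
        subst (λ ys → Always Q (run D f (recv (claimWidth δ g) (next xs)) (respond enc εc εf δ s ys)))
          (sym (decodeSample-encodeSample enc xs))
          (Always-map (λ es (p , q) → p , queries xs q)
            (run D f (recv (claimWidth δ g) (next xs)) (respond enc εc εf δ s xs))
            (Always-queryAll D f (claimWidth δ g) (next xs) (distinct enc εc εf δ s xs) (const false) (withCache enc εc εf δ s xs)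
              (Always-if (does (length (claim xs) ℕ.≤? claimWidth δ g))
                (if-both (fromBits (claim xs) ℕ.≤? m) (∣ fromℕ (fromBits (claim xs)) ÷ fromℕ m - σ ∣ ≤? εc + g ÷ fromℕ 2)
                  (λ v → Always (λ es → proverSamples es ≡ 0 × proverQueries es ≡ []) (run D f v (answering (cache xs) (HammingProtocol.honest s ‖ cache xs ‖))))
                  (λ _ _ → Always-answering D f xs (cache xs) (HammingProtocol.verifier s (fromBits (claim xs))) (HammingProtocol.honest s ‖ cache xs ‖))
                  (refl , refl))
                (refl , refl))))
      where
      g : ℝ
      g = εf - εc
      m : ℕ
      m = sampleSize δ g
      s : HammingProtocol m
      s = sub δ g
      honest : Prover N blackBox
      honest = Protocol.honest (Π enc εc εf δ s) σ
      next : Vec (Fin N) m → List Bool → Verifier N blackBox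
      next xs w = afterClaim enc εc εf δ s σ xs (fromBits w)
      cache : Vec (Fin N) m → Fin m → Bool
      cache = cached enc εc εf δ s D f
      claim : Vec (Fin N) m → List Bool
      claim xs = toBits (claimWidth δ g) ‖ cache xs ‖
      Q : List (Event N) → Set
      Q es = proverSamples es ≡ 0 × Unique (proverQueries es) × length (proverQueries es) ℕ.≤ m ⊓ N
      queries : ∀ xs {qs} → qs ≡ distinct enc εc εf δ s xs → Unique qs × length qs ℕ.≤ m ⊓ N
      queries xs refl = unique , ℕ.⊓-glb
        (ℕ.≤-trans (List.length-deduplicate Fin._≟_ (Vec.toList xs)) (ℕ.≤-reflexive (Vec.length-toList xs)))
        (Unique⇒length≤ unique)
        where
        unique : Unique (distinct enc εc εf δ s xs)
        unique = Unique.deduplicate-! Fin._≟_ (Vec.toList xs)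

    communication≤ : ∀ {N ℓ δ g} (es : List (Event N)) → communication es ℕ.≤ sampleSize δ g ℕ.* ℓ ℕ.+ bits δ g →
      fromℕ (communication es) ≤ fromℕ (sampleSize δ g ℕ.* ℓ) + fromℕ (bits δ g)
    communication≤ {ℓ = ℓ} {δ} {g} es c≤ = ≤-trans (fromℕ-mono-≤ c≤)
      (≤-reflexive (fromℕ-+ (sampleSize δ g ℕ.* ℓ) (bits δ g)))

    sampleBits≤ : ∀ ℓ δ g → 0# < δ → δ < 1# ÷ fromℕ 4 → 0# < g → g ≤ 1# →
      fromℕ (sampleSize δ g ℕ.* ℓ) ≤ fromℕ 17 * (fromℕ ℓ * ln (1# ÷ δ) ÷ (g * g))
    sampleBits≤ ℓ δ g 0<δ δ<¼ 0<g g≤1 = begin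
      fromℕ (sampleSize δ g ℕ.* ℓ)                     ≡⟨ fromℕ-* (sampleSize δ g) ℓ ⟩
      fromℕ (sampleSize δ g) * fromℕ ℓ                 ≤⟨ *-monoˡ-≤ (fromℕ-nonNeg ℓ) (sampleSize≤ δ g 0<δ δ<¼ 0<g g≤1) ⟩
      fromℕ 17 * (ln (1# ÷ δ) ÷ (g * g)) * fromℕ ℓ     ≡⟨ solve 3 (λ a i ℓ → nat 17 :* (a :* i) :* ℓ := nat 17 :* (ℓ :* a :* i))
                                                            refl (ln (1# ÷ δ)) ((g * g) ⁻¹) (fromℕ ℓ) ⟩
      fromℕ 17 * (fromℕ ℓ * ln (1# ÷ δ) ÷ (g * g))     ∎
      where open ≤-Reasoning

theorem4p4 : (F : CompleteOrderedField) (logarithm : Reals.Logarithm F) →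
    let open WeightVerification F logarithm in
    (∀ {N ℓ} (enc : Encoding N ℓ) εc εf δ → Admissible εc εf δ →
    (sub : HammingProtocol (sampleSize δ (εf - εc))) →
    IsExactHamming sub ((εf - εc) ÷ fromℕ 4) δ →
    let π = Π enc εc εf δ sub in
    HasCompletenessError π εc (fromℕ 2 * δ)
    × HasSoundnessError π εf (fromℕ 2 * δ)
    × (δ ≤ 1# ÷ fromℕ 6 → IsInteractiveProof π εc εf))
    ×
    (∀ (sub : Family) → IsLogarithmicRound sub →
    InEveryRun sub (λ N ℓ δ g es → verifierSamples es ≡ sampleSize δ g)
    × (∃ λ C → ∀ δ g → 0# < δ → δ < 1# ÷ fromℕ 4 → 0# < g → g ≤ 1# →
    fromℕ (sampleSize δ g) ≤ C * (ln (1# ÷ δ) ÷ (g * g)))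
    × (∃ λ (q : ℝ → ℝ → ℕ) →
    (∀ δ → 0# < δ → δ < 1# ÷ fromℕ 4 → q δ ∈Õ[ (λ g → 1# ÷ g) ])
    × InEveryRun sub (λ N ℓ δ g es → length (verifierQueries es) ℕ.≤ q δ g))
    × InEveryHonestRun sub (λ N ℓ δ g es →
    proverSamples es ≡ 0
    × Unique (proverQueries es)
    × length (proverQueries es) ℕ.≤ sampleSize δ g ⊓ N)
    × (∃ λ A → ∃ λ (s : ℝ → ℝ → ℕ) →
    (∀ δ → 0# < δ → δ < 1# ÷ fromℕ 4 → s δ ∈Õ[ (λ g → 1# ÷ g) ])
    × InEveryRun sub (λ N ℓ δ g es →
    fromℕ (communication es) ≤ A * fromℕ (sampleSize δ g ℕ.* ℓ) + fromℕ (s δ g)))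
    × (∃ λ B → ∃ λ (s : ℝ → ℝ → ℕ) →
    (∀ δ → 0# < δ → δ < 1# ÷ fromℕ 4 → s δ ∈Õ[ (λ g → 1# ÷ g) ])
    × InEveryRun sub (λ N ℓ δ g es →
    fromℕ (communication es) ≤ B * (fromℕ ℓ * ln (1# ÷ δ) ÷ (g * g)) + fromℕ (s δ g)))
    × (∃ λ c → ∃ λ (r : ℝ → ℝ → ℕ) →
    (∀ δ → 0# < δ → δ < 1# ÷ fromℕ 4 → r δ ∈O[ (λ g → ln (1# ÷ g)) ])
    × InEveryRun sub (λ N ℓ δ g es → rounds es ℕ.≤ r δ g ℕ.+ c)))
theorem4p4 F logarithm =
  (λ enc εc εf δ admissible sub exact →
    (λ D f σ _ _ → complete enc εc εf δ admissible sub exact D f σ) ,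
    (λ D f σ _ _ → sound enc εc εf δ admissible sub exact D f σ) ,
    interactive enc εc εf δ admissible sub exact) ,
  λ sub logarithmic →
    everyRun-implies sub logarithmic (λ _ _ _ _ _ (samples , _) → samples) ,
    (fromℕ 17 , sampleSize≤) ,
    (IsLogarithmicRound.queryBound logarithmic , IsLogarithmicRound.queryBound-Õ logarithmic ,
      everyRun-implies sub logarithmic (λ _ _ _ _ _ (_ , _ , queries , _) → queries)) ,
    everyHonestRun sub logarithmic ,
    (1# , bits sub logarithmic , bits-Õ sub logarithmic ,
      everyRun-implies sub logarithmic (λ {_} {ℓ} {δ} {g} _ _ _ _ es (_ , _ , _ , c≤) →
        ≤-trans (communication≤ sub logarithmic es c≤)
          (+-monoˡ-≤ _ (≤-reflexive (sym (*-identityˡ (fromℕ (sampleSize δ g ℕ.* ℓ)))))))) ,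
    (fromℕ 17 , bits sub logarithmic , bits-Õ sub logarithmic ,
      everyRun-implies sub logarithmic (λ {_} {ℓ} {δ} {g} 0<δ δ<¼ 0<g g≤1 es (_ , _ , _ , c≤) →
        ≤-trans (communication≤ sub logarithmic es c≤) (+-monoˡ-≤ _ (sampleBits≤ sub logarithmic ℓ δ g 0<δ δ<¼ 0<g g≤1)))) ,
    (2 , IsLogarithmicRound.roundBound logarithmic , IsLogarithmicRound.roundBound-O logarithmic ,
      everyRun-implies sub logarithmic (λ _ _ _ _ _ (_ , rounds≤ , _) → rounds≤))
  where
  open WeightVerification F logarithm
  open OrderedFieldProperties orderedField
  open Protocol-Π F logarithm
  open Resources F logarithm
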